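{- Let $G$ be a finite connected graph without loops or multiple edges, with $n$ vertices and $m$ edges, and let $w$ be a quaternionic weight on its arcs. Then \[ {\bf Z}_{\mathbb{H}}(G,w,t)^{ -1}=\mathrm{Sdet}_t\bigl({\bf I}_n-t\tilde{\bf W}+t^2\tilde{\bf D}\bigr)\prod_{i=1}^m\bigl(1-w(e_i)w(e_i^{ -1})t^2\bigr)\bigl(1-w(e_i)w(e_i^{ -1})t^2\bigr)^*. \]
   Context: $\mathbb{H}$ is the real quaternion algebra, $\mathbb{C}=\mathbb{R}+\mathbb{R}i\subset\mathbb{H}$, $x^*=x_0-x_1i-x_2j-x_3k$ for $x=x_0+x_1i+x_2j+x_3k$. $\mathbb{H}[[t]]$ is the ring of formal power series in a central indeterminate $t$, $\alpha^*=\sum\alpha_k^*t^k$; elements with constant term $1$ are invertible. Study determinant: each quaternionic matrix is uniquely ${\bf M}={\bf M}^S+j{\bf M}^P$ with complex ${\bf M}^S,{\bf M}^P$; $\psi({\bf M})=\begin{bmatrix}{\bf M}^S&-\overline{{\bf M}^P}\\ {\bf M}^P&\overline{{\bf M}^S}\end{bmatrix}$; for a square matrix ${\bf M}=\sum_k{\bf M}_kt^k$ over $\mathbb{H}[[t]]$, $\psi_t({\bf M})=\sum_k\psi({\bf M}_k)t^k$ and $\mathrm{Sdet}_t({\bf M})=\det(\psi_t({\bf M}))\in\mathbb{C}[[t]]$. Graph notions: $D(G)$ is the set of arcs, $o(e),t(e)$ origin and terminus, $e^{ -1}$ the reverse arc; arcs are enumerated $e_1,\dots,e_{2m}$ with $e_{m+k}=e_k^{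 -1}$. A quaternionic weight is $w:V(G)\times V(G)\to\mathbb{H}$ vanishing off $D(G)$, $w(e)=w(u,v)$ for $e=(u,v)$; for a path $P=(f_1,\dots,f_\ell)$, $w(P)=w(f_1)\cdots w(f_\ell)$, $|P|=\ell$. A cycle is a path with $t(f_\ell)=o(f_1)$; it has a backtracking if $f_{i+1}=f_i^{ -1}$ for some $i$; it is reduced if neither $C$ nor $C^2$ has a backtracking. $L_{[2m]}$ is the set of Lyndon words over $\{1<\dots<2m\}$. ${\bf Z}_{\mathbb{H}}(G,w,t)=\prod_{C}\{(1-w(C)t^{|C|})(1-w(C)t^{|C|})^*\}^{ -1}$, where $C$ runs over reduced cycles $(e_{i_1},\dots,e_{i_r})$ with $i_1\cdots i_r\in L_{[2m]}$. $\tilde{\bf W}=(\tilde{\bf W}_{uv})$ and $\tilde{\bf D}=(\tilde{\bf D}_{uv})$ are the $n\times n$ matrices over $\mathbb{H}[[t]]$ indexed by $V(G)$ with $\tilde{\bf W}_{uv}=(1-w(e)w(e^{ -1})t^2)^{ -1}w(e)$ if $e=(u,v)\in D(G)$ and $0$ otherwise, and $\tilde{\bf D}_{uv}=\delta_{uv}\sum_{e\in D(G),\,o(e)=u}(1-w(e)w(e^{ -1})t^2)^{ -1}w(e)w(e^{ -1})$. -}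

module Defs where

open import Level using (Level; _⊔_) renaming (suc to lsuc)
open import Algebra.Bundles using (CommutativeRing)
open import Algebra.Bundles.Raw using (RawRing)
open import Relation.Binary.Structures using (IsTotalOrder)
open import Data.Nat as ℕ using (ℕ; zero; suc; _∸_; _≡ᵇ_; _<ᵇ_)
open import Data.Bool using (Bool; true; false; _∧_; _∨_; not; if_then_else_)
open import Data.Fin as Fin using (Fin; toℕ; splitAt; punchIn; _↑ˡ_; _↑ʳ_)
open import Data.Fin.Properties using () renaming (_≟_ to _≟F_)
open import Data.Sum using (_⊎_; inj₁; inj₂)
open import Data.Product using (_×_; _,_; proj₁; proj₂; Σ; ∃; ∃-syntax; swap)
open import Data.List as List using (List; []; _∷_; _++_; [_]; allFin; foldr; filter; concatMap; length)
open import Data.Vec as Vec using (Vec; toList)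
open import Data.Bool.ListAction using (all; any)
open import Data.Bool using (T?)
open import Relation.Nullary using (¬_; does)
open import Relation.Binary.PropositionalEquality using (_≡_; _≢_)

-- The real numbers, axiomatised as a Dedekind-complete ordered field
-- (the carrier of a commutative ring).  Every model is isomorphic to ℝ.

record IsRealNumbers {c ℓ : Level} (R : CommutativeRing c ℓ) : Set (lsuc (c ⊔ ℓ)) where
  open CommutativeRing R
  field
    _≤_        : Carrier → Carrier → Set ℓ
    isTotalOrder : IsTotalOrder _≈_ _≤_
    1≉0        : ¬ (1# ≈ 0#)
    inverse    : ∀ x → ¬ (x ≈ 0#) → ∃[ y ] (x * y ≈ 1#)
    +-mono     : ∀ x y z → x ≤ y → (x + z) ≤ (y + z)
    *-pos      : ∀ x y → 0# ≤ x → 0# ≤ y → 0# ≤ (x * y)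
    complete   : (P : Carrier → Set ℓ) → (∃[ x ] P x) →
                 (∃[ b ] (∀ x → P x → x ≤ b)) →
                 ∃[ s ] ((∀ x → P x → x ≤ s) × (∀ b → (∀ x → P x → x ≤ b) → s ≤ b))

-- Finite simple graphs with a fixed arc enumeration
-- e_1..e_m = edge k (k : Fin m),  e_{m+k} = e_k^{-1}.

record Graph : Set where
  field
    n m     : ℕ
    edge    : Fin m → Fin n × Fin n
    noLoop  : ∀ k → proj₁ (edge k) ≢ proj₂ (edge k)
    noMulti : ∀ k l → (edge k ≡ edge l ⊎ edge k ≡ swap (edge l)) → k ≡ l

  Arc : Set
  Arc = Fin (m ℕ.+ m)

  arc : Arc → Fin n × Fin n
  arc i with splitAt m i
  ... | inj₁ k = edge k
  ... | inj₂ k = swap (edge k)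

  o t : Arc → Fin n
  o i = proj₁ (arc i)
  t i = proj₂ (arc i)

  rev : Arc → Arc
  rev i with splitAt m i
  ... | inj₁ k = m ↑ʳ k
  ... | inj₂ k = k ↑ˡ m

  isArc : Fin n → Fin n → Bool
  isArc u v = any (λ i → does (o i ≟F u) ∧ does (t i ≟F v)) (allFin (m ℕ.+ m))

data Reachable (G : Graph) : Fin (Graph.n G) → Fin (Graph.n G) → Set where
  here : ∀ {u} → Reachable G u u
  step : ∀ {v} (i : Graph.Arc G) → Reachable G (Graph.t G i) v → Reachable G (Graph.o G i) v

Connected : Graph → Set
Connected G = ∀ u v → Reachable G u v

module Words where
  _<lex_ : List ℕ → List ℕ → Bool
  [] <lex [] = false
  [] <lex (_ ∷ _) = true
  (_ ∷ _) <lex [] = false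
  (x ∷ xs) <lex (y ∷ ys) = (x <ᵇ y) ∨ ((x ≡ᵇ y) ∧ (xs <lex ys))

  rotate : ℕ → List ℕ → List ℕ
  rotate k xs = List.drop k xs ++ List.take k xs

  isLyndon : List ℕ → Bool
  isLyndon [] = false
  isLyndon xs@(_ ∷ _) =
    all (λ k → xs <lex rotate (suc k) xs) (List.upTo (length xs ∸ 1))

allWords : (k r : ℕ) → List (Vec (Fin k) r)
allWords k zero = [ Vec.[] ]
allWords k (suc r) = concatMap (λ i → List.map (i Vec.∷_) (allWords k r)) (allFin k)

module CycleDefs (G : Graph) where
  open Graph G

  consecutive : List Arc → List (Arc × Arc)
  consecutive [] = []
  consecutive (x ∷ []) = []
  consecutive (x ∷ y ∷ xs) = (x , y) ∷ consecutive (y ∷ xs)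

  last : Arc → List Arc → Arc
  last x [] = x
  last x (y ∷ ys) = last y ys

  isPath : List Arc → Bool
  isPath fs = all (λ p → does (t (proj₁ p) ≟F o (proj₂ p))) (consecutive fs)

  isCycle : List Arc → Bool
  isCycle [] = false
  isCycle (f ∷ fs) = isPath (f ∷ fs) ∧ does (t (last f fs) ≟F o f)

  hasBacktracking : List Arc → Bool
  hasBacktracking fs = any (λ p → does (proj₂ p ≟F rev (proj₁ p))) (consecutive fs)

  isReduced : List Arc → Bool
  isReduced fs = not (hasBacktracking fs) ∧ not (hasBacktracking (fs ++ fs))

  isLyndonCycle : List Arc → Bool
  isLyndonCycle fs = isCycle fs ∧ isReduced fs ∧ Words.isLyndon (List.map toℕ fs)

  lyndonCycles : ℕ → List (List Arc)
  lyndonCycles r = filter (λ fs → T? (isLyndonCycle fs))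
                          (List.map toList (allWords (m ℕ.+ m) r))

module PS {c ℓ : Level} (A : RawRing c ℓ) where
  open RawRing A

  Series : Set c
  Series = ℕ → Carrier

  _≈ₛ_ : Series → Series → Set ℓ
  f ≈ₛ g = ∀ k → f k ≈ g k

  sumTo : ℕ → (ℕ → Carrier) → Carrier
  sumTo zero f = 0#
  sumTo (suc k) f = sumTo k f + f k

  _⊕_ : Series → Series → Series
  (f ⊕ g) k = f k + g k

  ⊝_ : Series → Series
  (⊝ f) k = - f k

  _⊖_ : Series → Series → Series
  f ⊖ g = f ⊕ (⊝ g)

  _⊗_ : Series → Series → Series
  (f ⊗ g) k = sumTo (suc k) (λ i → f i * g (k ∸ i))

  mono : Carrier → ℕ → Series
  mono a r k = if k ≡ᵇ r then a else 0#

  𝟘 𝟙 : Series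
  𝟘 = mono 0# 0
  𝟙 = mono 1# 0

  -- inverse of a series with constant term 1 (the constant term is
  -- taken to be 1): g_0 = 1, g_k = - Σ_{i=1}^{k} f_i g_{k-i}, so f ⊗ g = 1
  private
    go : Series → ℕ → List Carrier → Carrier
    go f i [] = 0#
    go f i (x ∷ xs) = f (suc i) * x + go f (suc i) xs

    -- [g_k , g_{k-1} , … , g_0]
    invList : Series → ℕ → List Carrier
    invList f zero = [ 1# ]
    invList f (suc k) = (- go f 0 (invList f k)) ∷ invList f k

    headOr : List Carrier → Carrier
    headOr [] = 0#
    headOr (x ∷ _) = x

  inv₁ : Series → Series
  inv₁ f k = headOr (invList f k)

  prodList : List Series → Series
  prodList = foldr _⊗_ 𝟙

  prodFin : ∀ {k} → (Fin k → Series) → Series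
  prodFin {k} F = prodList (List.map F (allFin k))

  sumFin : ∀ {k} → (Fin k → Series) → Series
  sumFin {k} F = foldr _⊕_ 𝟘 (List.map F (allFin k))

  raw : RawRing c ℓ
  raw = record { Carrier = Series ; _≈_ = _≈ₛ_ ; _+_ = _⊕_ ; _*_ = _⊗_
               ; -_ = ⊝_ ; 0# = 𝟘 ; 1# = 𝟙 }

det : {c ℓ : Level} (A : RawRing c ℓ) → ∀ {k} → (Fin k → Fin k → RawRing.Carrier A) → RawRing.Carrier A
det A {zero} M = RawRing.1# A
det A {suc k} M = sumRow (allFin (suc k))
  where
  open RawRing A
  sign : ℕ → Carrier → Carrier
  sign zero x = x
  sign (suc zero) x = - x
  sign (suc (suc i)) x = sign i x
  term : Fin (suc k) → Carrier
  term j = sign (toℕ j) (M Fin.zero j * det A (λ a b → M (Fin.suc a) (punchIn j b)))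
  sumRow : List (Fin (suc k)) → Carrier
  sumRow [] = 0#
  sumRow (j ∷ js) = term j + sumRow js

module Over {c ℓ : Level} (R : CommutativeRing c ℓ) where
  open CommutativeRing R

  record ℂ : Set c where
    constructor _+i_
    field re im : Carrier

  record ℍ : Set c where
    constructor quat   -- x0 + x1 i + x2 j + x3 k
    field x0 x1 x2 x3 : Carrier

  ℂraw : RawRing c ℓ
  ℂraw = record
    { Carrier = ℂ
    ; _≈_ = λ z w → (ℂ.re z ≈ ℂ.re w) × (ℂ.im z ≈ ℂ.im w)
    ; _+_ = λ z w → (ℂ.re z + ℂ.re w) +i (ℂ.im z + ℂ.im w)
    ; _*_ = λ z w → (ℂ.re z * ℂ.re w - ℂ.im z * ℂ.im w) +i (ℂ.re z * ℂ.im w + ℂ.im z * ℂ.re w)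
    ; -_ = λ z → (- ℂ.re z) +i (- ℂ.im z)
    ; 0# = 0# +i 0#
    ; 1# = 1# +i 0#
    }

  conj : ℂ → ℂ
  conj z = ℂ.re z +i (- ℂ.im z)

  ℍraw : RawRing c ℓ
  ℍraw = record
    { Carrier = ℍ
    ; _≈_ = λ p q → (ℍ.x0 p ≈ ℍ.x0 q) × (ℍ.x1 p ≈ ℍ.x1 q) × (ℍ.x2 p ≈ ℍ.x2 q) × (ℍ.x3 p ≈ ℍ.x3 q)
    ; _+_ = λ p q → quat (ℍ.x0 p + ℍ.x0 q) (ℍ.x1 p + ℍ.x1 q) (ℍ.x2 p + ℍ.x2 q) (ℍ.x3 p + ℍ.x3 q)
    ; _*_ = mul
    ; -_ = λ p → quat (- ℍ.x0 p) (- ℍ.x1 p) (- ℍ.x2 p) (- ℍ.x3 p)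
    ; 0# = quat 0# 0# 0# 0#
    ; 1# = quat 1# 0# 0# 0#
    }
    where
    mul : ℍ → ℍ → ℍ
    mul (quat a1 b1 c1 d1) (quat a2 b2 c2 d2) = quat
      (a1 * a2 - b1 * b2 - c1 * c2 - d1 * d2)
      (a1 * b2 + b1 * a2 + c1 * d2 - d1 * c2)
      (a1 * c2 - b1 * d2 + c1 * a2 + d1 * b2)
      (a1 * d2 + b1 * c2 - c1 * b2 + d1 * a2)

  qstar : ℍ → ℍ
  qstar (quat a b c' d) = quat a (- b) (- c') (- d)

  -- q = S + j P with S, P complex:  a + b i + c j + d k = (a + b i) + j (c - d i)
  partS partP : ℍ → ℂ
  partS (quat a b _ _) = a +i b
  partP (quat _ _ c' d) = c' +i (- d)

  ofℂ : ℂ → ℍ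
  ofℂ z = quat (ℂ.re z) (ℂ.im z) 0# 0#

  module Hs = PS ℍraw
  module Cs = PS ℂraw

  star : Hs.Series → Hs.Series
  star f k = qstar (f k)

  ψt : ∀ {k} → (Fin k → Fin k → Hs.Series) → Fin (k ℕ.+ k) → Fin (k ℕ.+ k) → Cs.Series
  ψt {k} M a b with splitAt k a | splitAt k b
  ... | inj₁ u | inj₁ v = λ r → partS (M u v r)
  ... | inj₁ u | inj₂ v = λ r → RawRing.-_ ℂraw (conj (partP (M u v r)))
  ... | inj₂ u | inj₁ v = λ r → partP (M u v r)
  ... | inj₂ u | inj₂ v = λ r → conj (partS (M u v r))

  Sdet : ∀ {k} → (Fin k → Fin k → Hs.Series) → Cs.Series
  Sdet M = det Cs.raw (ψt M)

  module Weighted (G : Graph) (w : Fin (Graph.n G) → Fin (Graph.n G) → ℍ) where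
    open Graph G
    open CycleDefs G
    open Hs
    open RawRing ℍraw using () renaming (_*_ to _·_; 1# to 1ℍ; 0# to 0ℍ)

    wA : Arc → ℍ
    wA i = w (o i) (t i)

    wP : List Arc → ℍ
    wP = foldr (λ i q → wA i · q) 1ℍ

    cycFactor : List Arc → Series
    cycFactor C = 𝟙 ⊖ mono (wP C) (length C)

    -- Z_ℍ(G,w,t): coefficient N is read off from the finite product
    -- over cycles of length ≤ N (longer cycles only affect degrees > N)
    Zfactors : ℕ → List Series
    Zfactors zero = []
    Zfactors (suc r) =
      Zfactors r ++ List.map (λ C → inv₁ (cycFactor C ⊗ star (cycFactor C))) (lyndonCycles (suc r))

    Z : Series
    Z N = prodList (Zfactors N) N

    edgeFactor : Fin n → Fin n → Series
    edgeFactor u v = 𝟙 ⊖ mono (w u v · w v u) 2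

    W̃ : Fin n → Fin n → Series
    W̃ u v = if isArc u v then inv₁ (edgeFactor u v) ⊗ mono (w u v) 0 else 𝟘

    D̃ : Fin n → Fin n → Series
    D̃ u v = if does (u ≟F v)
            then sumFin (λ i → if does (o i ≟F u)
                               then inv₁ (edgeFactor (o i) (t i)) ⊗ mono (w (o i) (t i) · w (t i) (o i)) 0
                               else 𝟘)
            else 𝟘

    mainMatrix : Fin n → Fin n → Series
    mainMatrix u v = ((if does (u ≟F v) then 𝟙 else 𝟘) ⊖ (mono 1ℍ 1 ⊗ W̃ u v)) ⊕ (mono 1ℍ 2 ⊗ D̃ u v)

    rhs : Series
    rhs = (λ k → ofℂ (Sdet mainMatrix k))
          ⊗ prodFin (λ (i : Fin m) → edgeFactor (o (i ↑ˡ m)) (t (i ↑ˡ m))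
                                     ⊗ star (edgeFactor (o (i ↑ˡ m)) (t (i ↑ˡ m))))

    lhs : Series
    lhs = inv₁ Z

  IsWeight : (G : Graph) → (Fin (Graph.n G) → Fin (Graph.n G) → ℍ) → Set ℓ
  IsWeight G w = ∀ u v → (∀ i → Graph.arc G i ≢ (u , v)) → RawRing._≈_ ℍraw (w u v) (RawRing.0# ℍraw)

Fin' : Graph → Set
Fin' G = Fin (Graph.n G)

{-# OPTIONS --safe #-}
module Submission where

-- Let X_a be the matrix whose only nonzero row is row a of the weighted non-backtracking arc matrix.
-- For a word l let b_l be the sum of all words whose nonempty suffixes are all ≥ l.  Passing from l to
-- the next word l⁺ removes exactly the words u l with u counted by b_l if l is Lyndon, and nothing otherwise:
-- b_l (1 - X_l t^|l|) = b_{l⁺} or b_l = b_{l⁺}.  Starting from the sum of all words, (1 - t Σ X_a)⁻¹, this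
-- factors 1 - t Σ X_a as the product of the 1 - X_l t^|l| over the Lyndon words in increasing order.  The Study
-- determinant is multiplicative and X_l has rank one, so the factor of l becomes the norm of 1 - w(l) t^|l|
-- if l is a reduced cycle and 1 otherwise.
--
-- On the other side write the arc matrix as B - J with B = K L through the vertices and J the reversals.
-- Then 1 - t (B - J) = (1 + t J) (1 - t (1 + t J)⁻¹ K L), the identity det (1 - U V) = det (1 - V U) turns the
-- second factor into the vertex matrix 1 - t W̃ + t² D̃, and 1 + t J splits into one 2 × 2 block per edge.

open import Defs
open import Level using (Level; _⊔_)
open import Algebra.Bundles using (Ring; CommutativeRing)
open import Data.Nat as ℕ using (ℕ; zero; suc; _∸_; z≤n; s≤s; _<ᵇ_; _≡ᵇ_)
import Data.Nat.Properties as ℕₚ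
open import Data.List as List using (List; []; _∷_; allFin; _++_; [_]; length; concatMap; foldr; filter)
open import Relation.Binary.PropositionalEquality as ≡ using (_≡_; _≢_)
import Algebra.Properties.Ring as RingProperties
import Algebra.Properties.CommutativeSemigroup as CSP
import Relation.Binary.Reasoning.Setoid as SetoidReasoning
open import Data.Product using (_,_; _×_; proj₁; proj₂; ∃; ∃₂; swap)
open import Algebra.Bundles.Raw using (RawRing)
open import Data.Maybe using (nothing)
import Algebra.Properties.AbelianGroup as AGP
import Algebra.Properties.Semiring.Mult as Mult
import Algebra.Solver.Ring as RingSolver
import Algebra.Solver.Ring.AlmostCommutativeRing as ACR
open import Data.Fin as Fin using (Fin; zero; suc; _↑ˡ_; _↑ʳ_; punchIn; punchOut; inject₁; toℕ; splitAt)
import Data.Fin.Properties as Finₚ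
open import Data.Bool using (Bool; true; false; if_then_else_; T; T?; _∧_; _∨_; not)
open import Data.Sum using (_⊎_; inj₁; inj₂)
open import Data.Empty using (⊥-elim; ⊥)
open import Relation.Nullary using (does; yes; no; ¬_; Dec)
open import Relation.Nullary.Decidable using (dec-true; dec-false; _×-dec_)
import Algebra.Properties.Semiring.Sum as SemiringSum
open import Data.Fin.Induction using (<-weakInduction)
import Algebra.Properties.Group as GP
open import Data.Bool.Properties using (T-∨; T-∧; T-≡; ∧-zeroʳ)
import Data.List.Properties as Listₚ
open import Data.List.Relation.Unary.All as All using (All; []; _∷_)
import Data.List.Relation.Unary.All.Properties as Allₚ
open import Data.List.Relation.Unary.Any as Any using (Any)
open import Data.List.Relation.Unary.AllPairs as AllPairs using (AllPairs; []; _∷_)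
import Data.List.Relation.Unary.AllPairs.Properties as AllPairsₚ
open import Data.List.Membership.Propositional using (_∈_; find; lose)
open import Data.List.Membership.Propositional.Properties using (∈-upTo⁺; ∈-upTo⁻; ∈-concatMap⁺; ∈-allFin; ∈-map⁺)
open import Data.Unit using (⊤; tt)
open import Function.Bundles using (Equivalence)
open import Relation.Binary.Definitions using (tri<; tri≈; tri>)
import Data.List.Relation.Unary.Any.Properties as Anyₚ
open import Data.Vec as Vec using (Vec; toList)
import Data.Vec.Properties as Vecₚ

-- Formal power series

-- The weights do not commute, so the Lyndon factorization is an identity of ordered products of
-- power series over a matrix ring, whereas the zeta function groups its factors by cycle length.
-- The Study determinant bridges the two: its values lie in the commutative ring of complex power
-- series, where factors may be reordered, and norms of quaternionic series lie in the image of that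
-- ring under `ι`. The second obstacle is infinity. The increasing list of all words cannot be
-- exhausted one word at a time (above l come l1, l11, l111 and so on), and the product over cycles
-- has infinitely many factors. Every argument therefore fixes a bound N, uses the words of length
-- at most N and yields identities up to t^N. Sums, products and determinants preserve such
-- identities, because coefficient k of a product reads only coefficients up to k. All inverses that
-- occur are those of series with constant term 1, so the linear algebra is done over rings
-- throughout.

module PowerSeries {c ℓ : Level} (A : Ring c ℓ) where
  open Ring A hiding (zero)
  open PS rawRing
  open RingProperties A
  open SetoidReasoning setoid
  open CSP +-commutativeSemigroup using (interchange)

  sumTo-cong≤ : ∀ n {f g : ℕ → Carrier} → (∀ i → i ℕ.< n → f i ≈ g i) → sumTo n f ≈ sumTo n g
  sumTo-cong≤ zero h = refl
  sumTo-cong≤ (suc n) h = +-cong (sumTo-cong≤ n (λ i p → h i (ℕₚ.m<n⇒m<1+n p))) (h n ℕₚ.≤-refl)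

  sumTo-cons : ∀ n (f : ℕ → Carrier) → sumTo (suc n) f ≈ f 0 + sumTo n (λ i → f (suc i))
  sumTo-cons zero f = +-comm _ _
  sumTo-cons (suc n) f = trans (+-congʳ (sumTo-cons n f)) (+-assoc _ _ _)

  sumTo-+ : ∀ n (f g : ℕ → Carrier) → sumTo n (λ i → f i + g i) ≈ sumTo n f + sumTo n g
  sumTo-+ zero f g = sym (+-identityˡ 0#)
  sumTo-+ (suc n) f g = trans (+-congʳ (sumTo-+ n f g)) (interchange _ _ _ _)

  shift : Series → Series
  shift f k = f (suc k)

  ⊗-zero : ∀ f g → (f ⊗ g) 0 ≈ f 0 * g 0
  ⊗-zero f g = +-identityˡ _

  ⊗-suc : ∀ f g k → (f ⊗ g) (suc k) ≈ f 0 * g (suc k) + (shift f ⊗ g) k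
  ⊗-suc f g k = sumTo-cons (suc k) _

  -- Splits off the last summand where `⊗-suc` splits off the first; comparing the two gives
  -- `⊗-comm` by induction on the coefficient.
  ⊗-sucʳ : ∀ f g k → (f ⊗ g) (suc k) ≈ (f ⊗ shift g) k + f (suc k) * g 0
  ⊗-sucʳ f g k = +-cong
    (sumTo-cong≤ (suc k) (λ i p → *-congˡ (reflexive (≡.cong g (ℕₚ.+-∸-assoc 1 (ℕₚ.≤-pred p))))))
    (*-congˡ (reflexive (≡.cong g (ℕₚ.n∸n≡0 (suc k)))))

  -- Coefficient k of a product reads only coefficients of index at most k. Every truncated identity
  -- below rests on this.
  ⊗-cong≤ : ∀ k {f f' g g' : Series} → (∀ i → i ℕ.≤ k → f i ≈ f' i) → (∀ i → i ℕ.≤ k → g i ≈ g' i) →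
            (f ⊗ g) k ≈ (f' ⊗ g') k
  ⊗-cong≤ k p q = sumTo-cong≤ (suc k) (λ i r → *-cong (p i (ℕₚ.≤-pred r)) (q (k ∸ i) (ℕₚ.m∸n≤m k i)))

  ⊗-cong : ∀ {f f' g g' : Series} → f ≈ₛ f' → g ≈ₛ g' → (f ⊗ g) ≈ₛ (f' ⊗ g')
  ⊗-cong {f} {f'} {g} {g'} p q k = ⊗-cong≤ k {f} {f'} {g} {g'} (λ i _ → p i) (λ i _ → q i)

  ⊗-distribʳ : ∀ h f g → ((f ⊕ g) ⊗ h) ≈ₛ ((f ⊗ h) ⊕ (g ⊗ h))
  ⊗-distribʳ h f g k = trans (sumTo-cong≤ (suc k) (λ i _ → distribʳ _ _ _)) (sumTo-+ (suc k) _ _)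

  ⊗-distribˡ : ∀ h f g → (h ⊗ (f ⊕ g)) ≈ₛ ((h ⊗ f) ⊕ (h ⊗ g))
  ⊗-distribˡ h f g k = trans (sumTo-cong≤ (suc k) (λ i _ → distribˡ _ _ _)) (sumTo-+ (suc k) _ _)

  scale-⊗ : ∀ a f g k → ((λ i → a * f i) ⊗ g) k ≈ a * (f ⊗ g) k
  scale-⊗ a f g zero = begin
    ((λ i → a * f i) ⊗ g) 0 ≈⟨ ⊗-zero (λ i → a * f i) g ⟩
    a * f 0 * g 0           ≈⟨ *-assoc _ _ _ ⟩
    a * (f 0 * g 0)         ≈⟨ *-congˡ (⊗-zero f g) ⟨
    a * (f ⊗ g) 0           ∎
  scale-⊗ a f g (suc k) = begin
    ((λ i → a * f i) ⊗ g) (suc k)                                  ≈⟨ ⊗-suc _ g k ⟩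
    a * f 0 * g (suc k) + ((λ i → a * f (suc i)) ⊗ g) k            ≈⟨ +-cong (*-assoc _ _ _) (scale-⊗ a (shift f) g k) ⟩
    a * (f 0 * g (suc k)) + a * (shift f ⊗ g) k                    ≈⟨ distribˡ _ _ _ ⟨
    a * (f 0 * g (suc k) + (shift f ⊗ g) k)                        ≈⟨ *-congˡ (⊗-suc f g k) ⟨
    a * (f ⊗ g) (suc k)                                            ∎

  -- The shift of f ⊗ g is f 0 times the shift of g plus (shift f) ⊗ g, so the induction hypothesis
  -- applies to `shift f` and no double sum has to be reindexed.
  ⊗-assoc : ∀ f g h → ((f ⊗ g) ⊗ h) ≈ₛ (f ⊗ (g ⊗ h))
  ⊗-assoc f g h zero = begin
    ((f ⊗ g) ⊗ h) 0     ≈⟨ ⊗-zero (f ⊗ g) h ⟩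
    (f ⊗ g) 0 * h 0     ≈⟨ *-congʳ (⊗-zero f g) ⟩
    f 0 * g 0 * h 0     ≈⟨ *-assoc _ _ _ ⟩
    f 0 * (g 0 * h 0)   ≈⟨ *-congˡ (⊗-zero g h) ⟨
    f 0 * (g ⊗ h) 0     ≈⟨ ⊗-zero f (g ⊗ h) ⟨
    (f ⊗ (g ⊗ h)) 0     ∎
  ⊗-assoc f g h (suc k) = begin
    ((f ⊗ g) ⊗ h) (suc k)
      ≈⟨ ⊗-suc (f ⊗ g) h k ⟩
    (f ⊗ g) 0 * h (suc k) + (shift (f ⊗ g) ⊗ h) k
      ≈⟨ +-cong (trans (*-congʳ (⊗-zero f g)) (*-assoc _ _ _)) (⊗-cong {g = h} (⊗-suc f g) (λ _ → refl) k) ⟩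
    f 0 * (g 0 * h (suc k)) + (((λ i → f 0 * shift g i) ⊕ (shift f ⊗ g)) ⊗ h) k
      ≈⟨ +-congˡ (⊗-distribʳ h _ _ k) ⟩
    f 0 * (g 0 * h (suc k)) + (((λ i → f 0 * shift g i) ⊗ h) k + ((shift f ⊗ g) ⊗ h) k)
      ≈⟨ +-congˡ (+-cong (scale-⊗ (f 0) (shift g) h k) (⊗-assoc (shift f) g h k)) ⟩
    f 0 * (g 0 * h (suc k)) + (f 0 * (shift g ⊗ h) k + (shift f ⊗ (g ⊗ h)) k)
      ≈⟨ +-assoc _ _ _ ⟨
    f 0 * (g 0 * h (suc k)) + f 0 * (shift g ⊗ h) k + (shift f ⊗ (g ⊗ h)) k
      ≈⟨ +-congʳ (trans (*-congˡ (⊗-suc g h k)) (distribˡ _ _ _)) ⟨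
    f 0 * (g ⊗ h) (suc k) + (shift f ⊗ (g ⊗ h)) k
      ≈⟨ ⊗-suc f (g ⊗ h) k ⟨
    (f ⊗ (g ⊗ h)) (suc k) ∎

  𝟘≈0 : ∀ k → 𝟘 k ≈ 0#
  𝟘≈0 zero = refl
  𝟘≈0 (suc k) = refl

  ⊗-zeroSeries : ∀ f g → (∀ k → f k ≈ 0#) → ∀ k → (f ⊗ g) k ≈ 0#
  ⊗-zeroSeries f g p zero = trans (⊗-zero f g) (trans (*-congʳ (p 0)) (zeroˡ (g _)))
  ⊗-zeroSeries f g p (suc k) = trans (⊗-suc f g k)
    (trans (+-cong (trans (*-congʳ (p 0)) (zeroˡ (g _))) (⊗-zeroSeries (shift f) g (λ i → p (suc i)) k)) (+-identityˡ _))

  const-⊗ : ∀ a f k → (mono a 0 ⊗ f) k ≈ a * f k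
  const-⊗ a f zero = ⊗-zero (mono a 0) f
  const-⊗ a f (suc k) = trans (⊗-suc (mono a 0) f k)
    (trans (+-congˡ (⊗-zeroSeries _ f (λ _ → refl) k)) (+-identityʳ _))

  ⊗-const : ∀ a f k → (f ⊗ mono a 0) k ≈ f k * a
  ⊗-const a f zero = ⊗-zero f (mono a 0)
  ⊗-const a f (suc k) = trans (⊗-suc f (mono a 0) k)
    (trans (+-cong (zeroʳ _) (⊗-const a (shift f) k)) (+-identityˡ _))

  mono-⊗-suc : ∀ a r f k → (mono a (suc r) ⊗ f) (suc k) ≈ (mono a r ⊗ f) k
  mono-⊗-suc a r f k = trans (⊗-suc (mono a (suc r)) f k) (trans (+-congʳ (zeroˡ _)) (+-identityˡ _))

  mono-⊗-zero : ∀ a r f → (mono a (suc r) ⊗ f) 0 ≈ 0#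
  mono-⊗-zero a r f = trans (⊗-zero (mono a (suc r)) f) (zeroˡ _)

  ⊗-mono-suc : ∀ a r f k → (f ⊗ mono a (suc r)) (suc k) ≈ (f ⊗ mono a r) k
  ⊗-mono-suc a r f k = trans (⊗-sucʳ f (mono a (suc r)) k) (trans (+-congˡ (zeroʳ _)) (+-identityʳ _))

  ⊗-mono-zero : ∀ a r f → (f ⊗ mono a (suc r)) 0 ≈ 0#
  ⊗-mono-zero a r f = trans (⊗-zero f (mono a (suc r))) (zeroʳ _)

  ⊗-mono-+ : ∀ a r f k → (f ⊗ mono a r) (r ℕ.+ k) ≈ f k * a
  ⊗-mono-+ a zero f k = ⊗-const a f k
  ⊗-mono-+ a (suc r) f k = trans (⊗-mono-suc a r f (r ℕ.+ k)) (⊗-mono-+ a r f k)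

  ⊗-mono-< : ∀ a r f k → k ℕ.< r → (f ⊗ mono a r) k ≈ 0#
  ⊗-mono-< a (suc r) f zero p = ⊗-mono-zero a r f
  ⊗-mono-< a (suc r) f (suc k) (s≤s p) = trans (⊗-mono-suc a r f k) (⊗-mono-< a r f k p)

  mono-cong : ∀ {a b} r → a ≈ b → mono a r ≈ₛ mono b r
  mono-cong zero p zero = p
  mono-cong zero p (suc k) = refl
  mono-cong (suc r) p zero = refl
  mono-cong (suc r) p (suc k) = mono-cong r p k

  mono-0 : ∀ r k → mono 0# r k ≈ 0#
  mono-0 zero k = 𝟘≈0 k
  mono-0 (suc r) zero = refl
  mono-0 (suc r) (suc k) = mono-0 r k

  mono-⊗-mono : ∀ a b r s → (mono a r ⊗ mono b s) ≈ₛ mono (a * b) (r ℕ.+ s)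
  mono-⊗-mono a b zero s k = trans (const-⊗ a (mono b s) k) (lem s k)
    where
    lem : ∀ s k → a * mono b s k ≈ mono (a * b) s k
    lem zero zero = refl
    lem zero (suc k) = zeroʳ a
    lem (suc s) zero = zeroʳ a
    lem (suc s) (suc k) = lem s k
  mono-⊗-mono a b (suc r) s zero = mono-⊗-zero a r (mono b s)
  mono-⊗-mono a b (suc r) s (suc k) = trans (mono-⊗-suc a r (mono b s) k) (mono-⊗-mono a b r s k)

  tpow : ℕ → Series
  tpow r = mono 1# r

  -- Only the coefficient `1#` occurs, so powers of the indeterminate are central even over a
  -- noncommutative ring.
  tpow-central : ∀ r f → (tpow r ⊗ f) ≈ₛ (f ⊗ tpow r)
  tpow-central zero f k = trans (const-⊗ 1# f k) (trans (*-identityˡ _) (trans (sym (*-identityʳ _)) (sym (⊗-const 1# f k))))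
  tpow-central (suc r) f zero = trans (mono-⊗-zero 1# r f) (sym (⊗-mono-zero 1# r f))
  tpow-central (suc r) f (suc k) = trans (mono-⊗-suc 1# r f k) (trans (tpow-central r f k) (sym (⊗-mono-suc 1# r f k)))

  seriesRing : Ring c ℓ
  seriesRing = record
    { Carrier = Series ; _≈_ = _≈ₛ_ ; _+_ = _⊕_ ; _*_ = _⊗_ ; -_ = ⊝_ ; 0# = 𝟘 ; 1# = 𝟙
    ; isRing = record
      { +-isAbelianGroup = record
        { isGroup = record
          { isMonoid = record
            { isSemigroup = record
              { isMagma = record
                { isEquivalence = record
                  { refl = λ _ → refl ; sym = λ p k → sym (p k) ; trans = λ p q k → trans (p k) (q k) }
                ; ∙-cong = λ p q k → +-cong (p k) (q k) }
              ; assoc = λ f g h k → +-assoc _ _ _ }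
            ; identity = (λ f k → trans (+-congʳ (𝟘≈0 k)) (+-identityˡ _)) , (λ f k → trans (+-congˡ (𝟘≈0 k)) (+-identityʳ _)) }
          ; inverse = (λ f k → trans (-‿inverseˡ _) (sym (𝟘≈0 k))) , (λ f k → trans (-‿inverseʳ _) (sym (𝟘≈0 k)))
          ; ⁻¹-cong = λ p k → -‿cong (p k) }
        ; comm = λ f g k → +-comm _ _ }
      ; *-cong = ⊗-cong
      ; *-assoc = ⊗-assoc
      ; *-identity = (λ f k → trans (const-⊗ 1# f k) (*-identityˡ _)) , (λ f k → trans (⊗-const 1# f k) (*-identityʳ _))
      ; distrib = ⊗-distribˡ , ⊗-distribʳ } }

  private
    data Tail (T : Series → ℕ → ℕ → Carrier) (f : Series) (k : ℕ) : Carrier → ℕ → Set c where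
      tail : ∀ z → Tail T f k (- T f z k) z

    -- The auxiliary function of inv₁ is private, so invTail is left to unification: abstracting
    -- the starting index 0 in tail-inv₁ forces invTail f z k to be the sum of the f (z+1+i) * inv₁ f (k-i).
    mutual
      invTail : Series → ℕ → ℕ → Carrier
      invTail = _

      tail-inv₁ : ∀ f k → Tail invTail f k (inv₁ f (suc k)) zero
      tail-inv₁ f k with ℕ.zero
      ... | z = tail z

    -- The starting index z is general because the recursion raises it at each step; the inverse
    -- itself uses z = 0.
    invTail-⊗ : ∀ f k z → invTail f z k ≈ ((λ i → f (suc (z ℕ.+ i))) ⊗ inv₁ f) k
    invTail-⊗ f zero z = trans (+-identityʳ _)
      (sym (trans (⊗-zero (λ i → f (suc (z ℕ.+ i))) (inv₁ f)) (*-congʳ (reflexive (≡.cong (λ j → f (suc j)) (ℕₚ.+-identityʳ z))))))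
    invTail-⊗ f (suc k) z = begin
      f (suc z) * inv₁ f (suc k) + invTail f (suc z) k           ≈⟨ +-cong
          (*-congʳ (reflexive (≡.cong (λ j → f (suc j)) (≡.sym (ℕₚ.+-identityʳ z)))))
          (trans (invTail-⊗ f k (suc z))
             (⊗-cong (λ i → reflexive (≡.cong (λ j → f (suc j)) (≡.sym (ℕₚ.+-suc z i)))) (λ i → refl {inv₁ f i}) k)) ⟩
      f (suc (z ℕ.+ 0)) * inv₁ f (suc k) + ((λ i → f (suc (z ℕ.+ suc i))) ⊗ inv₁ f) k ≈⟨ ⊗-suc _ (inv₁ f) k ⟨
      ((λ i → f (suc (z ℕ.+ i))) ⊗ inv₁ f) (suc k)  ∎

  inv₁-suc : ∀ f k → inv₁ f (suc k) ≈ - (shift f ⊗ inv₁ f) k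
  inv₁-suc f k = -‿cong (invTail-⊗ f k 0)

  inv₁-inverseʳ : ∀ f → f 0 ≈ 1# → (f ⊗ inv₁ f) ≈ₛ 𝟙
  inv₁-inverseʳ f p zero = trans (⊗-zero f (inv₁ f)) (trans (*-identityʳ _) p)
  inv₁-inverseʳ f p (suc k) = begin
    (f ⊗ inv₁ f) (suc k)                                      ≈⟨ ⊗-suc f (inv₁ f) k ⟩
    f 0 * inv₁ f (suc k) + (shift f ⊗ inv₁ f) k               ≈⟨ +-congʳ (trans (*-congʳ p) (*-identityˡ _)) ⟩
    inv₁ f (suc k) + (shift f ⊗ inv₁ f) k                     ≈⟨ +-congʳ (inv₁-suc f k) ⟩
    - (shift f ⊗ inv₁ f) k + (shift f ⊗ inv₁ f) k             ≈⟨ -‿inverseˡ _ ⟩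
    0#                                                        ∎

  -- The series g = inv₁ f has constant term `1#` by definition, so it has a right inverse h of its
  -- own. Then f = f (g h) = (f g) h = h, and g f = g h = 1.
  inv₁-inverseˡ : ∀ f → f 0 ≈ 1# → (inv₁ f ⊗ f) ≈ₛ 𝟙
  inv₁-inverseˡ f p = S.trans (S.*-congˡ {g} f≈h) gh≈1
    where
    module S = Ring seriesRing
    g h : Series
    g = inv₁ f
    h = inv₁ g
    gh≈1 : (g ⊗ h) ≈ₛ 𝟙
    gh≈1 = inv₁-inverseʳ g refl
    f≈h : f ≈ₛ h
    f≈h = S.trans (S.sym (S.*-identityʳ f)) (S.trans (S.*-congˡ {f} (S.sym gh≈1))
            (S.trans (S.sym (S.*-assoc f g h)) (S.trans (S.*-congʳ {h} (inv₁-inverseʳ f p)) (S.*-identityˡ h))))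

module CommutativeSeries {c ℓ : Level} (K : CommutativeRing c ℓ) where
  open CommutativeRing K hiding (zero)
  open PS rawRing
  open PowerSeries ring

  ⊗-comm : ∀ f g → (f ⊗ g) ≈ₛ (g ⊗ f)
  ⊗-comm f g zero = trans (⊗-zero f g) (trans (*-comm _ _) (sym (⊗-zero g f)))
  ⊗-comm f g (suc k) = trans (⊗-suc f g k) (trans (+-cong (*-comm _ _) (⊗-comm (shift f) g k))
                         (trans (+-comm _ _) (sym (⊗-sucʳ g f k))))

  seriesCommutativeRing : CommutativeRing c ℓ
  seriesCommutativeRing = record
    { isCommutativeRing = record { isRing = Ring.isRing seriesRing ; *-comm = ⊗-comm } }

-- Complex numbers and quaternions

module DifferenceSolver {c ℓ : Level} (R : CommutativeRing c ℓ) where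
  open CommutativeRing R hiding (zero)
  open RingProperties ring
  open AGP +-abelianGroup using (⁻¹-∙-comm; ⁻¹-involutive; ε⁻¹≈ε)
  open CSP +-commutativeSemigroup using (interchange)
  open Mult semiring using (×-homo-+; ×1-homo-*) renaming (_×_ to _·_)

  -- Coefficients are formal differences of naturals: unlike the elements of R they compute.
  Difference : RawRing _ _
  Difference = record
    { Carrier = ℕ × ℕ ; _≈_ = _≡_
    ; _+_ = λ (a , b) (a' , b') → a ℕ.+ a' , b ℕ.+ b'
    ; _*_ = λ (a , b) (a' , b') → a ℕ.* a' ℕ.+ b ℕ.* b' , a ℕ.* b' ℕ.+ b ℕ.* a'
    ; -_ = λ (a , b) → b , a
    ; 0# = 0 , 0 ; 1# = 1 , 0 }

  value : ℕ × ℕ → Carrier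
  value (a , b) = a · 1# - b · 1#

  private
    -+- : ∀ x y z w → (x + y) - (z + w) ≈ (x - z) + (y - w)
    -+- x y z w = trans (+-congˡ (sym (⁻¹-∙-comm z w))) (interchange _ _ _ _)

    -*- : ∀ x y z w → (x * z + y * w) - (x * w + y * z) ≈ (x - y) * (z - w)
    -*- x y z w = trans (-+- _ _ _ _) (trans (+-cong (trans (+-congˡ (-‿distribʳ-* x w)) (sym (distribˡ x z (- w))))
        (trans (+-cong (trans (sym (⁻¹-involutive _)) (trans (-‿cong (-‿distribˡ-* y w)) (-‿distribʳ-* _ _))) (-‿distribˡ-* y z)) (trans (+-comm _ _) (sym (distribˡ (- y) z (- w))))))
        (sym (distribʳ (z - w) x (- y))))

    ·1-homo : ∀ a b a' b' → (a ℕ.* a' ℕ.+ b ℕ.* b') · 1# ≈ (a · 1#) * (a' · 1#) + (b · 1#) * (b' · 1#)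
    ·1-homo a b a' b' = trans (×-homo-+ 1# (a ℕ.* a') _) (+-cong (×1-homo-* a a') (×1-homo-* b b'))

  morphism : Difference ACR.-Raw-AlmostCommutative⟶ (ACR.fromCommutativeRing R)
  morphism = record
    { ⟦_⟧ = value
    ; +-homo = λ (a , b) (a' , b') → trans (+-cong (×-homo-+ 1# a a') (-‿cong (×-homo-+ 1# b b'))) (-+- _ _ _ _)
    ; *-homo = λ (a , b) (a' , b') → trans (+-cong (·1-homo a b a' b') (-‿cong (·1-homo a b b' a'))) (-*- _ _ _ _)
    ; -‿homo = λ (a , b) → sym (trans (sym (⁻¹-∙-comm _ _)) (trans (+-comm _ _) (+-congʳ (⁻¹-involutive _))))
    ; 0-homo = -‿inverseʳ _
    ; 1-homo = trans (+-cong (+-identityʳ _) ε⁻¹≈ε) (+-identityʳ _) }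

  open RingSolver Difference (ACR.fromCommutativeRing R) morphism (λ _ _ → nothing) public
    using (solve; _:=_; _:+_; _:*_; _:-_; :-_; Polynomial)

module Quaternions {c ℓ : Level} (R : CommutativeRing c ℓ) where
  open CommutativeRing R hiding (zero)
  open Over R
  open DifferenceSolver R
  private
    module Cr = RawRing ℂraw
    module Hr = RawRing ℍraw

  ℂ-commutativeRing : CommutativeRing c ℓ
  ℂ-commutativeRing = record
    { Carrier = ℂ ; _≈_ = Cr._≈_ ; _+_ = Cr._+_ ; _*_ = Cr._*_ ; -_ = Cr.-_ ; 0# = Cr.0# ; 1# = Cr.1#
    ; isCommutativeRing = record
      { isRing = record
        { +-isAbelianGroup = record
          { isGroup = record
            { isMonoid = record
              { isSemigroup = record
                { isMagma = record
                  { isEquivalence = record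
                    { refl = refl , refl
                    ; sym = λ (p , q) → sym p , sym q
                    ; trans = λ (p , q) (p' , q') → trans p p' , trans q q' }
                  ; ∙-cong = λ (p , q) (p' , q') → +-cong p p' , +-cong q q' }
                ; assoc = λ _ _ _ → +-assoc _ _ _ , +-assoc _ _ _ }
              ; identity = (λ _ → +-identityˡ _ , +-identityˡ _) , (λ _ → +-identityʳ _ , +-identityʳ _) }
            ; inverse = (λ _ → -‿inverseˡ _ , -‿inverseˡ _) , (λ _ → -‿inverseʳ _ , -‿inverseʳ _)
            ; ⁻¹-cong = λ (p , q) → -‿cong p , -‿cong q }
          ; comm = λ _ _ → +-comm _ _ , +-comm _ _ }
        ; *-cong = λ (p , q) (p' , q') → +-cong (*-cong p p') (-‿cong (*-cong q q')) , +-cong (*-cong p q') (*-cong q p')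
        ; *-assoc = λ (a +i b) (a' +i b') (a'' +i b'') →
            solve 6 (λ a b c d e f → (a :* c :- b :* d) :* e :- (a :* d :+ b :* c) :* f := a :* (c :* e :- d :* f) :- b :* (c :* f :+ d :* e)) refl a b a' b' a'' b'' ,
            solve 6 (λ a b c d e f → (a :* c :- b :* d) :* f :+ (a :* d :+ b :* c) :* e := a :* (c :* f :+ d :* e) :+ b :* (c :* e :- d :* f)) refl a b a' b' a'' b''
        ; *-identity = idˡ , (λ z → ℂtrans (comm z Cr.1#) (idˡ z))
        ; distrib = distˡ , (λ z x y → ℂtrans (comm (x Cr.+ y) z) (ℂtrans (distˡ z x y) (+-cong (proj₁ (comm z x)) (proj₁ (comm z y)) , +-cong (proj₂ (comm z x)) (proj₂ (comm z y)))))
        }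
      ; *-comm = comm } }
    where
    ℂtrans : ∀ {x y z : ℂ} → x Cr.≈ y → y Cr.≈ z → x Cr.≈ z
    ℂtrans (p , q) (p' , q') = trans p p' , trans q q'
    comm : ∀ z w → z Cr.* w Cr.≈ w Cr.* z
    comm (a +i b) (a' +i b') = +-cong (*-comm a a') (-‿cong (*-comm b b')) , trans (+-comm _ _) (+-cong (*-comm b a') (*-comm a b'))
    idˡ : ∀ z → Cr.1# Cr.* z Cr.≈ z
    idˡ (a +i b) = trans (+-cong (*-identityˡ a) (trans (-‿cong (zeroˡ b)) ε⁻¹≈ε)) (+-identityʳ a) ,
                   trans (+-cong (*-identityˡ b) (zeroˡ a)) (+-identityʳ b)
      where open AGP +-abelianGroup using (ε⁻¹≈ε)
    distˡ : ∀ z x y → z Cr.* (x Cr.+ y) Cr.≈ (z Cr.* x Cr.+ z Cr.* y)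
    distˡ (a +i b) (a' +i b') (a'' +i b'') =
      solve 6 (λ a b c d e f → a :* (c :+ e) :- b :* (d :+ f) := (a :* c :- b :* d) :+ (a :* e :- b :* f)) refl a b a' b' a'' b'' ,
      solve 6 (λ a b c d e f → a :* (d :+ f) :+ b :* (c :+ e) := (a :* d :+ b :* c) :+ (a :* f :+ b :* e)) refl a b a' b' a'' b''

  private
    -- Quaternion arithmetic on the polynomials of the solver: the four components of a ring law can
    -- be stated as quaternion expressions instead of being written out.
    module Poly {n : ℕ} where
      infixl 8 _⊙_
      P⁴ : Set
      P⁴ = Polynomial n × Polynomial n × Polynomial n × Polynomial n
      _⊙_ _⊞_ : P⁴ → P⁴ → P⁴
      (a1 , b1 , c1 , d1) ⊙ (a2 , b2 , c2 , d2) =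
        (a1 :* a2 :- b1 :* b2 :- c1 :* c2 :- d1 :* d2) ,
        (a1 :* b2 :+ b1 :* a2 :+ c1 :* d2 :- d1 :* c2) ,
        (a1 :* c2 :- b1 :* d2 :+ c1 :* a2 :+ d1 :* b2) ,
        (a1 :* d2 :+ b1 :* c2 :- c1 :* b2 :+ d1 :* a2)
      (a1 , b1 , c1 , d1) ⊞ (a2 , b2 , c2 , d2) = a1 :+ a2 , b1 :+ b2 , c1 :+ c2 , d1 :+ d2
      p₀ p₁ p₂ p₃ : P⁴ → Polynomial n
      p₀ (a , _) = a
      p₁ (_ , b , _) = b
      p₂ (_ , _ , c , _) = c
      p₃ (_ , _ , _ , d) = d
    open Poly

    ℍ-assoc : ∀ x y z → (x Hr.* y) Hr.* z Hr.≈ x Hr.* (y Hr.* z)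
    ℍ-assoc (quat a b c d) (quat e f g h) (quat i j k l) =
      solve 12 (λ a b c d e f g h i j k l → let x = a , b , c , d ; y = e , f , g , h ; z = i , j , k , l in
        p₀ (x ⊙ y ⊙ z) := p₀ (x ⊙ (y ⊙ z))) refl a b c d e f g h i j k l ,
      solve 12 (λ a b c d e f g h i j k l → let x = a , b , c , d ; y = e , f , g , h ; z = i , j , k , l in
        p₁ (x ⊙ y ⊙ z) := p₁ (x ⊙ (y ⊙ z))) refl a b c d e f g h i j k l ,
      solve 12 (λ a b c d e f g h i j k l → let x = a , b , c , d ; y = e , f , g , h ; z = i , j , k , l in
        p₂ (x ⊙ y ⊙ z) := p₂ (x ⊙ (y ⊙ z))) refl a b c d e f g h i j k l ,
      solve 12 (λ a b c d e f g h i j k l → let x = a , b , c , d ; y = e , f , g , h ; z = i , j , k , l in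
        p₃ (x ⊙ y ⊙ z) := p₃ (x ⊙ (y ⊙ z))) refl a b c d e f g h i j k l

    ℍ-distribˡ : ∀ x y z → x Hr.* (y Hr.+ z) Hr.≈ (x Hr.* y Hr.+ x Hr.* z)
    ℍ-distribˡ (quat a b c d) (quat e f g h) (quat i j k l) =
      solve 12 (λ a b c d e f g h i j k l → let x = a , b , c , d ; y = e , f , g , h ; z = i , j , k , l in
        p₀ (x ⊙ (y ⊞ z)) := p₀ ((x ⊙ y) ⊞ (x ⊙ z))) refl a b c d e f g h i j k l ,
      solve 12 (λ a b c d e f g h i j k l → let x = a , b , c , d ; y = e , f , g , h ; z = i , j , k , l in
        p₁ (x ⊙ (y ⊞ z)) := p₁ ((x ⊙ y) ⊞ (x ⊙ z))) refl a b c d e f g h i j k l ,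
      solve 12 (λ a b c d e f g h i j k l → let x = a , b , c , d ; y = e , f , g , h ; z = i , j , k , l in
        p₂ (x ⊙ (y ⊞ z)) := p₂ ((x ⊙ y) ⊞ (x ⊙ z))) refl a b c d e f g h i j k l ,
      solve 12 (λ a b c d e f g h i j k l → let x = a , b , c , d ; y = e , f , g , h ; z = i , j , k , l in
        p₃ (x ⊙ (y ⊞ z)) := p₃ ((x ⊙ y) ⊞ (x ⊙ z))) refl a b c d e f g h i j k l

    ℍ-distribʳ : ∀ x y z → (y Hr.+ z) Hr.* x Hr.≈ (y Hr.* x Hr.+ z Hr.* x)
    ℍ-distribʳ (quat a b c d) (quat e f g h) (quat i j k l) =
      solve 12 (λ a b c d e f g h i j k l → let x = a , b , c , d ; y = e , f , g , h ; z = i , j , k , l in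
        p₀ ((y ⊞ z) ⊙ x) := p₀ ((y ⊙ x) ⊞ (z ⊙ x))) refl a b c d e f g h i j k l ,
      solve 12 (λ a b c d e f g h i j k l → let x = a , b , c , d ; y = e , f , g , h ; z = i , j , k , l in
        p₁ ((y ⊞ z) ⊙ x) := p₁ ((y ⊙ x) ⊞ (z ⊙ x))) refl a b c d e f g h i j k l ,
      solve 12 (λ a b c d e f g h i j k l → let x = a , b , c , d ; y = e , f , g , h ; z = i , j , k , l in
        p₂ ((y ⊞ z) ⊙ x) := p₂ ((y ⊙ x) ⊞ (z ⊙ x))) refl a b c d e f g h i j k l ,
      solve 12 (λ a b c d e f g h i j k l → let x = a , b , c , d ; y = e , f , g , h ; z = i , j , k , l in
        p₃ ((y ⊞ z) ⊙ x) := p₃ ((y ⊙ x) ⊞ (z ⊙ x))) refl a b c d e f g h i j k l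

    module _ where
      open AGP +-abelianGroup using (ε⁻¹≈ε)
      add0 : ∀ {x x' y} → x ≈ x' → y ≈ 0# → x + y ≈ x'
      add0 p q = trans (+-cong p q) (+-identityʳ _)
      0add : ∀ {x y y'} → x ≈ 0# → y ≈ y' → x + y ≈ y'
      0add p q = trans (+-cong p q) (+-identityˡ _)
      sub0 : ∀ {x x' y} → x ≈ x' → y ≈ 0# → x - y ≈ x'
      sub0 p q = add0 p (trans (-‿cong q) ε⁻¹≈ε)

    ℍ-identityˡ : ∀ x → Hr.1# Hr.* x Hr.≈ x
    ℍ-identityˡ (quat a b c d) =
      sub0 (sub0 (sub0 (*-identityˡ a) (zeroˡ b)) (zeroˡ c)) (zeroˡ d) ,
      sub0 (add0 (add0 (*-identityˡ b) (zeroˡ a)) (zeroˡ d)) (zeroˡ c) ,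
      add0 (add0 (sub0 (*-identityˡ c) (zeroˡ d)) (zeroˡ a)) (zeroˡ b) ,
      add0 (sub0 (add0 (*-identityˡ d) (zeroˡ c)) (zeroˡ b)) (zeroˡ a)

    ℍ-identityʳ : ∀ x → x Hr.* Hr.1# Hr.≈ x
    ℍ-identityʳ (quat a b c d) =
      sub0 (sub0 (sub0 (*-identityʳ a) (zeroʳ b)) (zeroʳ c)) (zeroʳ d) ,
      sub0 (add0 (0add (zeroʳ a) (*-identityʳ b)) (zeroʳ c)) (zeroʳ d) ,
      add0 (0add (sub0 (zeroʳ a) (zeroʳ b)) (*-identityʳ c)) (zeroʳ d) ,
      0add (sub0 (add0 (zeroʳ a) (zeroʳ b)) (zeroʳ c)) (*-identityʳ d)

  ℍ-ring : Ring c ℓ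
  ℍ-ring = record
    { Carrier = ℍ ; _≈_ = Hr._≈_ ; _+_ = Hr._+_ ; _*_ = Hr._*_ ; -_ = Hr.-_ ; 0# = Hr.0# ; 1# = Hr.1#
    ; isRing = record
      { +-isAbelianGroup = record
        { isGroup = record
          { isMonoid = record
            { isSemigroup = record
              { isMagma = record
                { isEquivalence = record
                  { refl = refl , refl , refl , refl
                  ; sym = λ (p , q , r , s) → sym p , sym q , sym r , sym s
                  ; trans = λ (p , q , r , s) (p' , q' , r' , s') → trans p p' , trans q q' , trans r r' , trans s s' }
                ; ∙-cong = λ (p , q , r , s) (p' , q' , r' , s') → +-cong p p' , +-cong q q' , +-cong r r' , +-cong s s' }
              ; assoc = λ _ _ _ → +-assoc _ _ _ , +-assoc _ _ _ , +-assoc _ _ _ , +-assoc _ _ _ }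
            ; identity = (λ _ → +-identityˡ _ , +-identityˡ _ , +-identityˡ _ , +-identityˡ _)
                       , (λ _ → +-identityʳ _ , +-identityʳ _ , +-identityʳ _ , +-identityʳ _) }
          ; inverse = (λ _ → -‿inverseˡ _ , -‿inverseˡ _ , -‿inverseˡ _ , -‿inverseˡ _)
                    , (λ _ → -‿inverseʳ _ , -‿inverseʳ _ , -‿inverseʳ _ , -‿inverseʳ _)
          ; ⁻¹-cong = λ (p , q , r , s) → -‿cong p , -‿cong q , -‿cong r , -‿cong s }
        ; comm = λ _ _ → +-comm _ _ , +-comm _ _ , +-comm _ _ , +-comm _ _ }
      ; *-cong = λ (p , q , r , s) (p' , q' , r' , s') →
          -c (-c (-c (*-cong p p') (*-cong q q')) (*-cong r r')) (*-cong s s') ,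
          -c (+-cong (+-cong (*-cong p q') (*-cong q p')) (*-cong r s')) (*-cong s r') ,
          +-cong (+-cong (-c (*-cong p r') (*-cong q s')) (*-cong r p')) (*-cong s q') ,
          +-cong (-c (+-cong (*-cong p s') (*-cong q r')) (*-cong r q')) (*-cong s p')
      ; *-assoc = ℍ-assoc
      ; *-identity = ℍ-identityˡ , ℍ-identityʳ
      ; distrib = ℍ-distribˡ , ℍ-distribʳ } }
    where
    -c : ∀ {x x' y y'} → x ≈ x' → y ≈ y' → x - y ≈ x' - y'
    -c p q = +-cong p (-‿cong q)

  -- Since z j = j (conj z) for complex z and j j = -1, the product (S + jP)(S' + jP') has complex
  -- part S S' - conj P P' and j-part P S' + conj S P'.
  partS-* : ∀ x y → partS (x Hr.* y) Cr.≈ (partS x Cr.* partS y Cr.+ (Cr.- (conj (partP x) Cr.* partP y)))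
  partS-* (quat a b c d) (quat e f g h) =
    solve 8 (λ a b c d e f g h → a :* e :- b :* f :- c :* g :- d :* h :=
      (a :* e :- b :* f) :+ :- (c :* g :- (:- (:- d)) :* (:- h))) refl a b c d e f g h ,
    solve 8 (λ a b c d e f g h → a :* f :+ b :* e :+ c :* h :- d :* g :=
      (a :* f :+ b :* e) :+ :- (c :* (:- h) :+ (:- (:- d)) :* g)) refl a b c d e f g h

  partP-* : ∀ x y → partP (x Hr.* y) Cr.≈ (partP x Cr.* partS y Cr.+ conj (partS x) Cr.* partP y)
  partP-* (quat a b c d) (quat e f g h) =
    solve 8 (λ a b c d e f g h → a :* g :- b :* h :+ c :* e :+ d :* f :=
      (c :* e :- (:- d) :* f) :+ (a :* g :- (:- b) :* (:- h))) refl a b c d e f g h ,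
    solve 8 (λ a b c d e f g h → :- (a :* h :+ b :* g :- c :* f :+ d :* e) :=
      (c :* f :+ (:- d) :* e) :+ (a :* (:- h) :+ (:- b) :* g)) refl a b c d e f g h

  conj-* : ∀ z w → conj (z Cr.* w) Cr.≈ (conj z Cr.* conj w)
  conj-* (a +i b) (e +i f) =
    solve 4 (λ a b e f → a :* e :- b :* f := a :* e :- (:- b) :* (:- f)) refl a b e f ,
    solve 4 (λ a b e f → :- (a :* f :+ b :* e) := a :* (:- f) :+ (:- b) :* e) refl a b e f

  open AGP +-abelianGroup using (⁻¹-∙-comm; ⁻¹-involutive; ε⁻¹≈ε)

  conj-+ : ∀ z w → conj (z Cr.+ w) Cr.≈ (conj z Cr.+ conj w)
  conj-+ z w = refl , sym (⁻¹-∙-comm _ _)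

  conj-involutive : ∀ z → conj (conj z) Cr.≈ z
  conj-involutive z = refl , ⁻¹-involutive _

  conj-cong : ∀ {z w} → z Cr.≈ w → conj z Cr.≈ conj w
  conj-cong (p , q) = p , -‿cong q

  partS-+ : ∀ x y → partS (x Hr.+ y) Cr.≈ (partS x Cr.+ partS y)
  partS-+ x y = refl , refl

  partP-+ : ∀ x y → partP (x Hr.+ y) Cr.≈ (partP x Cr.+ partP y)
  partP-+ x y = refl , sym (⁻¹-∙-comm _ _)

  partS-cong : ∀ {x y} → x Hr.≈ y → partS x Cr.≈ partS y
  partS-cong (p , q , _) = p , q

  partP-cong : ∀ {x y} → x Hr.≈ y → partP x Cr.≈ partP y
  partP-cong (_ , _ , r , s) = r , -‿cong s

  parts-injective : ∀ {x y} → partS x Cr.≈ partS y → partP x Cr.≈ partP y → x Hr.≈ y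
  parts-injective (p , q) (r , s) = p , q , r , trans (sym (⁻¹-involutive _)) (trans (-‿cong s) (⁻¹-involutive _))

  partP-1 : partP Hr.1# Cr.≈ Cr.0#
  partP-1 = refl , ε⁻¹≈ε

  partP-ofℂ : ∀ z → partP (ofℂ z) Cr.≈ Cr.0#
  partP-ofℂ z = partP-1

  partP-qstar : ∀ x → partP (qstar x) Cr.≈ (Cr.- partP x)
  partP-qstar x = refl , refl

  ofℂ-cong : ∀ {z w} → z Cr.≈ w → ofℂ z Hr.≈ ofℂ w
  ofℂ-cong (p , q) = p , q , refl , refl

-- Finite sums and matrices

module FiniteSums {c ℓ : Level} (A : Ring c ℓ) where
  open Ring A hiding (zero)
  private
    module S = SemiringSum semiring
  open RingProperties A

  -- Abstract, so that the summands can be inferred by unification.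
  abstract
    sum : ∀ {n} → (Fin n → Carrier) → Carrier
    sum = S.sum

    sum-[] : (f : Fin 0 → Carrier) → sum f ≈ 0#
    sum-[] f = refl

    sum-∷ : ∀ {n} (f : Fin (suc n) → Carrier) → sum f ≈ f zero + sum (λ i → f (suc i))
    sum-∷ f = refl

    sum-cong : ∀ {n} {f g : Fin n → Carrier} → (∀ i → f i ≈ g i) → sum f ≈ sum g
    sum-cong = S.sum-cong-≋

    ∑-zero : ∀ {n} {f : Fin n → Carrier} → (∀ i → f i ≈ 0#) → sum f ≈ 0#
    ∑-zero {n} p = trans (S.sum-cong-≋ p) (S.sum-replicate-zero n)

    ∑-+ : ∀ {n} (f g : Fin n → Carrier) → sum (λ i → f i + g i) ≈ sum f + sum g
    ∑-+ = S.∑-distrib-+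

    ∑-comm : ∀ {m n} (f : Fin m → Fin n → Carrier) → sum (λ i → sum (λ j → f i j)) ≈ sum (λ j → sum (λ i → f i j))
    ∑-comm = S.∑-comm

    *-∑ : ∀ {n} x (f : Fin n → Carrier) → x * sum f ≈ sum (λ i → x * f i)
    *-∑ = S.*-distribˡ-sum

    ∑-* : ∀ {n} x (f : Fin n → Carrier) → sum f * x ≈ sum (λ i → f i * x)
    ∑-* = S.*-distribʳ-sum

    ∑-single : ∀ {n} (i : Fin n) {f : Fin n → Carrier} → (∀ j → j ≢ i → f j ≈ 0#) → sum f ≈ f i
    ∑-single zero p = trans (+-congˡ (∑-zero (λ j → p (suc j) (λ ())))) (+-identityʳ _)
    ∑-single (suc i) p = trans (+-cong (p zero (λ ())) (∑-single i (λ j q → p (suc j) (λ r → q (Finₚ.suc-injective r))))) (+-identityˡ _)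

    ∑-split : ∀ p q (f : Fin (p ℕ.+ q) → Carrier) → sum f ≈ sum (λ i → f (i ↑ˡ q)) + sum (λ i → f (p ↑ʳ i))
    ∑-split zero q f = sym (+-identityˡ _)
    ∑-split (suc p) q f = trans (+-congˡ (∑-split p q (λ i → f (suc i)))) (sym (+-assoc _ _ _))

  ∑-neg : ∀ {n} (f : Fin n → Carrier) → sum (λ i → - f i) ≈ - sum f
  ∑-neg f = trans (sum-cong (λ i → sym (-1*x≈-x (f i)))) (trans (sym (*-∑ (- 1#) f)) (-1*x≈-x _))

  δ : ∀ {n} → Fin n → Fin n → Carrier
  δ i j = if does (i Finₚ.≟ j) then 1# else 0#

  δ-refl : ∀ {n} (i : Fin n) → δ i i ≈ 1#
  δ-refl i rewrite dec-true (i Finₚ.≟ i) ≡.refl = refl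

  δ-≢ : ∀ {n} {i j : Fin n} → i ≢ j → δ i j ≈ 0#
  δ-≢ {i = i} {j} p rewrite dec-false (i Finₚ.≟ j) p = refl

  δ-sym : ∀ {n} (i j : Fin n) → δ i j ≈ δ j i
  δ-sym i j with i Finₚ.≟ j
  ... | yes ≡.refl = sym (δ-refl i)
  ... | no p = sym (δ-≢ (λ q → p (≡.sym q)))

  δ-injective : ∀ {m n} {f : Fin m → Fin n} → (∀ {i j} → f i ≡ f j → i ≡ j) → ∀ i j → δ (f i) (f j) ≈ δ i j
  δ-injective {f = f} inj i j with i Finₚ.≟ j
  ... | yes ≡.refl = δ-refl (f i)
  ... | no p = δ-≢ (λ q → p (inj q))

  ∑-δˡ : ∀ {n} i (f : Fin n → Carrier) → sum (λ j → δ i j * f j) ≈ f i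
  ∑-δˡ i f = trans (∑-single i (λ j p → trans (*-congʳ (δ-≢ (λ q → p (≡.sym q)))) (zeroˡ _)))
                   (trans (*-congʳ (δ-refl i)) (*-identityˡ _))

  ∑-δʳ : ∀ {n} i (f : Fin n → Carrier) → sum (λ j → f j * δ j i) ≈ f i
  ∑-δʳ i f = trans (∑-single i (λ j p → trans (*-congˡ (δ-≢ p)) (zeroʳ _)))
                   (trans (*-congˡ (δ-refl i)) (*-identityʳ _))

module Matrices {c ℓ : Level} (A : Ring c ℓ) where
  open Ring A hiding (zero)
  open FiniteSums A
  open SetoidReasoning setoid

  infix  4 _≋_
  infixl 6 _⊞_
  infixl 7 _⊡_

  Mat : ℕ → ℕ → Set c
  Mat p q = Fin p → Fin q → Carrier

  _≋_ : ∀ {p q} → Mat p q → Mat p q → Set ℓ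
  M ≋ N = ∀ i j → M i j ≈ N i j

  _⊞_ : ∀ {p q} → Mat p q → Mat p q → Mat p q
  (M ⊞ N) i j = M i j + N i j

  ⊟_ : ∀ {p q} → Mat p q → Mat p q
  (⊟ M) i j = - M i j

  _⊡_ : ∀ {p q r} → Mat p q → Mat q r → Mat p r
  (M ⊡ N) i k = sum (λ j → M i j * N j k)

  𝟎 : ∀ {p q} → Mat p q
  𝟎 i j = 0#

  𝐈 : ∀ {p} → Mat p p
  𝐈 = δ

  ⊡-cong : ∀ {p q r} {M M' : Mat p q} {N N' : Mat q r} → M ≋ M' → N ≋ N' → M ⊡ N ≋ M' ⊡ N'
  ⊡-cong p q i k = sum-cong (λ j → *-cong (p i j) (q j k))

  ⊡-assoc : ∀ {p q r s} (L : Mat p q) (M : Mat q r) (N : Mat r s) → (L ⊡ M) ⊡ N ≋ L ⊡ (M ⊡ N)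
  ⊡-assoc L M N i l = begin
    sum (λ k → sum (λ j → L i j * M j k) * N k l)    ≈⟨ sum-cong (λ k → ∑-* (N k l) _) ⟩
    sum (λ k → sum (λ j → L i j * M j k * N k l))    ≈⟨ ∑-comm (λ k j → L i j * M j k * N k l) ⟩
    sum (λ j → sum (λ k → L i j * M j k * N k l))    ≈⟨ sum-cong (λ j → sum-cong (λ k → *-assoc _ _ _)) ⟩
    sum (λ j → sum (λ k → L i j * (M j k * N k l)))  ≈⟨ sum-cong (λ j → *-∑ (L i j) (λ k → M j k * N k l)) ⟨
    sum (λ j → L i j * sum (λ k → M j k * N k l))    ∎

  ⊡-identityˡ : ∀ {p q} (M : Mat p q) → 𝐈 ⊡ M ≋ M
  ⊡-identityˡ M i k = ∑-δˡ i (λ j → M j k)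

  ⊡-identityʳ : ∀ {p q} (M : Mat p q) → M ⊡ 𝐈 ≋ M
  ⊡-identityʳ M i k = ∑-δʳ k (M i)

  ⊡-distribˡ : ∀ {p q r} (L : Mat p q) (M N : Mat q r) → L ⊡ (M ⊞ N) ≋ L ⊡ M ⊞ L ⊡ N
  ⊡-distribˡ L M N i k = trans (sum-cong (λ j → distribˡ _ _ _)) (∑-+ _ _)

  ⊡-distribʳ : ∀ {p q r} (L : Mat q r) (M N : Mat p q) → (M ⊞ N) ⊡ L ≋ M ⊡ L ⊞ N ⊡ L
  ⊡-distribʳ L M N i k = trans (sum-cong (λ j → distribʳ _ _ _)) (∑-+ _ _)

  matrixRing : ℕ → Ring c ℓ
  matrixRing p = record
    { Carrier = Mat p p ; _≈_ = _≋_ ; _+_ = _⊞_ ; _*_ = _⊡_ ; -_ = ⊟_ ; 0# = 𝟎 ; 1# = 𝐈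
    ; isRing = record
      { +-isAbelianGroup = record
        { isGroup = record
          { isMonoid = record
            { isSemigroup = record
              { isMagma = record
                { isEquivalence = record
                  { refl = λ i j → refl ; sym = λ h i j → sym (h i j) ; trans = λ h h' i j → trans (h i j) (h' i j) }
                ; ∙-cong = λ h h' i j → +-cong (h i j) (h' i j) }
              ; assoc = λ _ _ _ i j → +-assoc _ _ _ }
            ; identity = (λ _ i j → +-identityˡ _) , (λ _ i j → +-identityʳ _) }
          ; inverse = (λ _ i j → -‿inverseˡ _) , (λ _ i j → -‿inverseʳ _)
          ; ⁻¹-cong = λ h i j → -‿cong (h i j) }
        ; comm = λ _ _ i j → +-comm _ _ }
      ; *-cong = λ {M} {M'} {N} {N'} → ⊡-cong {M = M} {M'} {N} {N'}
      ; *-assoc = ⊡-assoc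
      ; *-identity = ⊡-identityˡ , ⊡-identityʳ
      ; distrib = ⊡-distribˡ , ⊡-distribʳ } }

-- Determinants over a commutative ring

↑ˡ≢↑ʳ : ∀ {p q} (i : Fin p) (j : Fin q) → i ↑ˡ q ≢ p ↑ʳ j
↑ˡ≢↑ʳ zero j ()
↑ˡ≢↑ʳ (suc i) j e = ↑ˡ≢↑ʳ i j (Finₚ.suc-injective e)

-- Alternation is demanded for neighbouring indices only: neighbours carry opposite signs in the
-- expansion of a determinant, and they stay neighbours when another index is deleted.
data Adjacent : ∀ {n} → Fin n → Fin n → Set where
  adj-zero : ∀ {n} → Adjacent {suc (suc n)} zero (suc zero)
  adj-suc : ∀ {n} {i j : Fin n} → Adjacent i j → Adjacent (suc i) (suc j)

adjacent-inject₁ : ∀ {n} (i : Fin n) → Adjacent (inject₁ i) (suc i)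
adjacent-inject₁ zero = adj-zero
adjacent-inject₁ (suc i) = adj-suc (adjacent-inject₁ i)

adjacent-≢ : ∀ {n} {i j : Fin n} → Adjacent i j → i ≢ j
adjacent-≢ (adj-suc a) p = adjacent-≢ a (Finₚ.suc-injective p)

adjacent-punchOut : ∀ {n} {i j k : Fin (suc n)} → Adjacent i j → (p : k ≢ i) (q : k ≢ j) → Adjacent (punchOut p) (punchOut q)
adjacent-punchOut {k = zero} adj-zero p q = ⊥-elim (p ≡.refl)
adjacent-punchOut {k = suc zero} adj-zero p q = ⊥-elim (q ≡.refl)
adjacent-punchOut {suc (suc n)} {k = suc (suc k)} adj-zero p q = adj-zero
adjacent-punchOut {k = zero} (adj-suc a) p q = a
adjacent-punchOut {suc n} {k = suc k} (adj-suc a) p q = adj-suc (adjacent-punchOut a (λ x → p (≡.cong suc x)) (λ x → q (≡.cong suc x)))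

-- Where the two embeddings differ, one reads column j and the other column i. Hence the minors at
-- two equal neighbouring columns coincide.
adjacent-punchIn : ∀ {n} {i j : Fin (suc n)} → Adjacent i j → ∀ q →
  punchIn i q ≡ punchIn j q ⊎ (punchIn i q ≡ j × punchIn j q ≡ i)
adjacent-punchIn adj-zero zero = inj₂ (≡.refl , ≡.refl)
adjacent-punchIn adj-zero (suc q) = inj₁ ≡.refl
adjacent-punchIn {suc n} (adj-suc a) zero = inj₁ ≡.refl
adjacent-punchIn {suc n} (adj-suc a) (suc q) with adjacent-punchIn a q
... | inj₁ p = inj₁ (≡.cong suc p)
... | inj₂ (p , r) = inj₂ (≡.cong suc p , ≡.cong suc r)

module Determinants {c ℓ : Level} (K : CommutativeRing c ℓ) where
  open CommutativeRing K hiding (zero)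
  open RingProperties ring
  open AGP +-abelianGroup using (ε⁻¹≈ε; ⁻¹-involutive)
  open FiniteSums ring
  open Matrices ring
  open DifferenceSolver K
  open SetoidReasoning setoid

  sgn : ∀ {n} → Fin n → Carrier
  sgn zero = 1#
  sgn (suc j) = - sgn j

  minor : ∀ {n} → Fin (suc n) → Mat (suc n) (suc n) → Mat n n
  minor j M a b = M (suc a) (punchIn j b)

  D : ∀ {n} → Mat n n → Carrier
  D {zero} M = 1#
  D {suc n} M = sum (λ j → sgn j * (M zero j * D (minor j M)))

  D-cong : ∀ {n} {M N : Mat n n} → M ≋ N → D M ≈ D N
  D-cong {zero} p = refl
  D-cong {suc n} p = sum-cong (λ j → *-congˡ (*-cong (p zero j) (D-cong (λ a b → p (suc a) (punchIn j b)))))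

  linear-combination : ∀ {n} a b (f g : Fin n → Carrier) → sum (λ i → a * f i + b * g i) ≈ a * sum f + b * sum g
  linear-combination a b f g = trans (∑-+ _ _) (+-cong (sym (*-∑ a f)) (sym (*-∑ b g)))

  -- In the term of column c the entry is linear and the minor does not see c. In every other term
  -- the entry is common and the minor is linear by induction, in the column to which c moves.
  D-linear : ∀ {n} (c : Fin n) a b {A B C : Mat n n} → (∀ p → A p c ≈ a * B p c + b * C p c) →
    (∀ p q → q ≢ c → A p q ≈ B p q) → (∀ p q → q ≢ c → A p q ≈ C p q) → D A ≈ a * D B + b * D C
  D-linear {suc n} c a b {A} {B} {C} lin AB AC = trans (sum-cong term) (linear-combination a b _ _)
    where
    term : ∀ j → sgn j * (A zero j * D (minor j A)) ≈
                 a * (sgn j * (B zero j * D (minor j B))) + b * (sgn j * (C zero j * D (minor j C)))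
    term j with j Finₚ.≟ c
    ... | yes ≡.refl = begin
      sgn c * (A zero c * D (minor c A)) ≈⟨ *-congˡ (*-congʳ (lin zero)) ⟩
      sgn c * ((a * B zero c + b * C zero c) * D (minor c A))
        ≈⟨ solve 6 (λ s a x b y d → s :* ((a :* x :+ b :* y) :* d) := a :* (s :* (x :* d)) :+ b :* (s :* (y :* d))) refl _ _ _ _ _ _ ⟩
      a * (sgn c * (B zero c * D (minor c A))) + b * (sgn c * (C zero c * D (minor c A)))
        ≈⟨ +-cong (*-congˡ (*-congˡ (*-congˡ (D-cong (λ p q → AB (suc p) (punchIn c q) (Finₚ.punchInᵢ≢i c q))))))
                  (*-congˡ (*-congˡ (*-congˡ (D-cong (λ p q → AC (suc p) (punchIn c q) (Finₚ.punchInᵢ≢i c q)))))) ⟩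
      a * (sgn c * (B zero c * D (minor c B))) + b * (sgn c * (C zero c * D (minor c C))) ∎
    ... | no j≢c = begin
      sgn j * (A zero j * D (minor j A)) ≈⟨ *-congˡ (*-congˡ ih) ⟩
      sgn j * (A zero j * (a * D (minor j B) + b * D (minor j C)))
        ≈⟨ solve 6 (λ s a x b y z → s :* (z :* (a :* x :+ b :* y)) := a :* (s :* (z :* x)) :+ b :* (s :* (z :* y))) refl _ _ _ _ _ _ ⟩
      a * (sgn j * (A zero j * D (minor j B))) + b * (sgn j * (A zero j * D (minor j C)))
        ≈⟨ +-cong (*-congˡ (*-congˡ (*-congʳ (AB zero j j≢c)))) (*-congˡ (*-congˡ (*-congʳ (AC zero j j≢c)))) ⟩
      a * (sgn j * (B zero j * D (minor j B))) + b * (sgn j * (C zero j * D (minor j C))) ∎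
      where
      c' = punchOut j≢c
      eq : punchIn j c' ≡ c
      eq = Finₚ.punchIn-punchOut j≢c
      avoid : ∀ q → q ≢ c' → punchIn j q ≢ c
      avoid q q≢ p = q≢ (Finₚ.punchIn-injective j q c' (≡.trans p (≡.sym eq)))
      ih : D (minor j A) ≈ a * D (minor j B) + b * D (minor j C)
      ih = D-linear c' a b (λ p → ≡.subst (λ x → A (suc p) x ≈ a * B (suc p) x + b * C (suc p) x) (≡.sym eq) (lin (suc p)))
             (λ p q q≢ → AB (suc p) _ (avoid q q≢)) (λ p q q≢ → AC (suc p) _ (avoid q q≢))

  ∑-adjacent : ∀ {n} {i j : Fin n} → Adjacent i j → (f : Fin n → Carrier) → f i + f j ≈ 0# →
    (∀ k → k ≢ i → k ≢ j → f k ≈ 0#) → sum f ≈ 0#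
  ∑-adjacent adj-zero f p q = begin
    sum f                                         ≈⟨ trans (sum-∷ f) (+-congˡ (sum-∷ _)) ⟩
    f zero + (f (suc zero) + sum (λ i → f (suc (suc i)))) ≈⟨ +-congˡ (+-congˡ (∑-zero (λ k → q (suc (suc k)) (λ ()) (λ ())))) ⟩
    f zero + (f (suc zero) + 0#)                  ≈⟨ +-congˡ (+-identityʳ _) ⟩
    f zero + f (suc zero)                         ≈⟨ p ⟩
    0#                                            ∎
  ∑-adjacent (adj-suc a) f p q = trans (sum-∷ f) (trans (+-cong (q zero (λ ()) (λ ()))
    (∑-adjacent a (λ k → f (suc k)) p (λ k r s → q (suc k) (λ e → r (Finₚ.suc-injective e)) (λ e → s (Finₚ.suc-injective e)))))
    (+-identityʳ _))

  sgn-adjacent : ∀ {n} {i j : Fin n} → Adjacent i j → sgn j ≈ - sgn i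
  sgn-adjacent adj-zero = refl
  sgn-adjacent (adj-suc a) = -‿cong (sgn-adjacent a)

  -- The terms of the two equal columns cancel: opposite signs, equal minors. Every other minor
  -- still contains two equal neighbouring columns.
  D-adjacent : ∀ {n} {i j : Fin n} {A : Mat n n} → Adjacent i j → (∀ p → A p i ≈ A p j) → D A ≈ 0#
  D-adjacent {suc n} {i} {j} {A} adj eq = ∑-adjacent adj _ cancel vanish
    where
    minors : D (minor i A) ≈ D (minor j A)
    minors = D-cong (λ p q → lem p q (adjacent-punchIn adj q))
      where
      lem : ∀ p q → punchIn i q ≡ punchIn j q ⊎ (punchIn i q ≡ j × punchIn j q ≡ i) → minor i A p q ≈ minor j A p q
      lem p q (inj₁ e) = reflexive (≡.cong (A (suc p)) e)
      lem p q (inj₂ (e , e')) = trans (reflexive (≡.cong (A (suc p)) e)) (trans (sym (eq (suc p))) (reflexive (≡.cong (A (suc p)) (≡.sym e'))))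
    cancel : sgn i * (A zero i * D (minor i A)) + sgn j * (A zero j * D (minor j A)) ≈ 0#
    cancel = trans (+-cong (*-congˡ (*-cong (eq zero) minors)) (trans (*-congʳ (sgn-adjacent adj)) (sym (-‿distribˡ-* _ _)))) (-‿inverseʳ _)
    vanish : ∀ k → k ≢ i → k ≢ j → sgn k * (A zero k * D (minor k A)) ≈ 0#
    vanish k p q = trans (*-congˡ (trans (*-congˡ (D-adjacent (adjacent-punchOut adj p q)
        (λ r → trans (reflexive (≡.cong (A (suc r)) (Finₚ.punchIn-punchOut p)))
                 (trans (eq (suc r)) (reflexive (≡.cong (A (suc r)) (≡.sym (Finₚ.punchIn-punchOut q)))))))) (zeroʳ _))) (zeroʳ _)

  -- Functions that are linear and alternating in the rows

  record RowAlternating {n} (F : Mat n n → Carrier) : Set (c ⊔ ℓ) where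
    field
      F-cong : ∀ {A B} → A ≋ B → F A ≈ F B
      linear : ∀ i a b {A B C} → (∀ q → A i q ≈ a * B i q + b * C i q) →
        (∀ p → p ≢ i → ∀ q → A p q ≈ B p q) → (∀ p → p ≢ i → ∀ q → A p q ≈ C p q) → F A ≈ a * F B + b * F C
      adjacent : ∀ {A} {i j} → Adjacent i j → (∀ q → A i q ≈ A j q) → F A ≈ 0#

  infixr 5 _◂_
  _◂_ : ∀ {n m} → (Fin m → Carrier) → Mat n m → Mat (suc n) m
  (x ◂ B) zero = x
  (x ◂ B) (suc i) = B i

  module _ {n} {F : Mat n n → Carrier} (alt : RowAlternating F) where
    open RowAlternating alt

    private
      set : Fin n → (Fin n → Carrier) → Mat n n → Mat n n
      set i x A p with p Finₚ.≟ i
      ... | yes _ = x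
      ... | no _ = A p

      set-same : ∀ i x A q → set i x A i q ≈ x q
      set-same i x A q with i Finₚ.≟ i
      ... | yes _ = refl
      ... | no p = ⊥-elim (p ≡.refl)

      set-other : ∀ i x A p → p ≢ i → ∀ q → set i x A p q ≈ A p q
      set-other i x A p p≢ q with p Finₚ.≟ i
      ... | yes e = ⊥-elim (p≢ e)
      ... | no _ = refl

      additive : ∀ i x y A → F (set i (λ q → x q + y q) A) ≈ F (set i x A) + F (set i y A)
      additive i x y A = trans
        (linear i 1# 1#
          (λ q → trans (set-same i _ A q) (+-cong (trans (sym (set-same i x A q)) (sym (*-identityˡ _))) (trans (sym (set-same i y A q)) (sym (*-identityˡ _)))))
          (λ p r q → trans (set-other i _ A p r q) (sym (set-other i x A p r q)))
          (λ p r q → trans (set-other i _ A p r q) (sym (set-other i y A p r q))))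
        (+-cong (*-identityˡ _) (*-identityˡ _))

    -- Polarization: F vanishes on the matrix with x + y in both rows; expanding and dropping the
    -- two terms with equal rows leaves Φ x y + Φ y x = 0.
    swap-adjacent : ∀ {i j} → Adjacent i j → ∀ A B → (∀ q → A i q ≈ B j q) → (∀ q → A j q ≈ B i q) →
      (∀ p → p ≢ i → p ≢ j → ∀ q → A p q ≈ B p q) → F A ≈ - F B
    swap-adjacent {i} {j} adj A B ij ji other = begin
      F A      ≈⟨ F-cong A≋ ⟩
      Φ x y    ≈⟨ +-identityʳ _ ⟨
      Φ x y + 0#              ≈⟨ +-congˡ (-‿inverseʳ _) ⟨
      Φ x y + (Φ y x - Φ y x) ≈⟨ +-assoc _ _ _ ⟨
      Φ x y + Φ y x - Φ y x   ≈⟨ +-congʳ sum-zero ⟩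
      0# - Φ y x              ≈⟨ +-identityˡ _ ⟩
      - Φ y x                 ≈⟨ -‿cong (F-cong B≋) ⟨
      - F B                   ∎
      where
      x y : Fin n → Carrier
      x = A i
      y = A j
      i≢j = adjacent-≢ adj
      Φ : (Fin n → Carrier) → (Fin n → Carrier) → Carrier
      Φ u v = F (set i u (set j v A))
      row-i : ∀ u v q → set i u (set j v A) i q ≈ u q
      row-i u v = set-same i u (set j v A)
      row-j : ∀ u v q → set i u (set j v A) j q ≈ v q
      row-j u v q = trans (set-other i u (set j v A) j (λ e → i≢j (≡.sym e)) q) (set-same j v A q)
      by-rows : ∀ (u v : Fin n → Carrier) (M : Mat n n) → (∀ q → M i q ≈ u q) → (∀ q → M j q ≈ v q) →
        (∀ p → p ≢ i → p ≢ j → ∀ q → M p q ≈ A p q) → M ≋ set i u (set j v A)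
      by-rows u v M a b c p q with p Finₚ.≟ i | p Finₚ.≟ j
      ... | yes ≡.refl | _ = a q
      ... | no _ | yes ≡.refl = trans (b q) (sym (set-same j v A q))
      ... | no r | no s = trans (c p r s q) (sym (set-other j v A p s q))
      A≋ : A ≋ set i x (set j y A)
      A≋ = by-rows x y A (λ _ → refl) (λ _ → refl) (λ _ _ _ _ → refl)
      B≋ : B ≋ set i y (set j x A)
      B≋ = by-rows y x B (λ q → sym (ji q)) (λ q → sym (ij q)) (λ p r s q → sym (other p r s q))
      equal : ∀ u → Φ u u ≈ 0#
      equal u = adjacent adj (λ q → trans (row-i u u q) (sym (row-j u u q)))
      commute : ∀ u v → Φ u v ≈ F (set j v (set i u A))
      commute u v = sym (F-cong (by-rows u v (set j v (set i u A))
        (λ q → trans (set-other j v (set i u A) i i≢j q) (set-same i u A q))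
        (set-same j v (set i u A))
        (λ p r s q → trans (set-other j v (set i u A) p s q) (set-other i u A p r q))))
      addʳ : ∀ u v w → Φ u (λ q → v q + w q) ≈ Φ u v + Φ u w
      addʳ u v w = trans (commute u _) (trans (additive j v w (set i u A)) (sym (+-cong (commute u v) (commute u w))))
      xy : Fin n → Carrier
      xy q = x q + y q
      sum-zero : Φ x y + Φ y x ≈ 0#
      sum-zero = begin
        Φ x y + Φ y x                         ≈⟨ +-cong (+-identityˡ _) (+-identityʳ _) ⟨
        (0# + Φ x y) + (Φ y x + 0#)           ≈⟨ +-cong (+-congʳ (equal x)) (+-congˡ (equal y)) ⟨
        (Φ x x + Φ x y) + (Φ y x + Φ y y)     ≈⟨ +-cong (addʳ x x y) (addʳ y x y) ⟨
        Φ x xy + Φ y xy                       ≈⟨ additive i x y (set j xy A) ⟨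
        Φ xy xy                               ≈⟨ equal xy ⟩
        0#                                    ∎

  module _ {n} {F : Mat (suc n) (suc n) → Carrier} (alt : RowAlternating F) where
    open RowAlternating alt

    -- The repeated row is moved up by swaps of neighbours, each of which only changes the sign,
    -- until it stands next to the first row.
    first-row-repeated : ∀ (i : Fin n) {A} → (∀ q → A zero q ≈ A (suc i) q) → F A ≈ 0#
    first-row-repeated = go n F alt
      where
      go : ∀ n (F : Mat (suc n) (suc n) → Carrier) → RowAlternating F → ∀ (i : Fin n) {A} → (∀ q → A zero q ≈ A (suc i) q) → F A ≈ 0#
      go (suc n) F alt = <-weakInduction (λ i → ∀ {A} → (∀ q → A zero q ≈ A (suc i) q) → F A ≈ 0#)
        (RowAlternating.adjacent alt adj-zero) move
        where
        move : ∀ i → (∀ {A} → (∀ q → A zero q ≈ A (suc (inject₁ i)) q) → F A ≈ 0#) →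
               ∀ {A} → (∀ q → A zero q ≈ A (suc (suc i)) q) → F A ≈ 0#
        move i ih {A} eq = trans (swap-adjacent alt adj A B (λ q → sym (reflexive (≡.cong (λ x → x q) B-j))) (λ q → sym (reflexive (≡.cong (λ x → x q) B-i)))
            (λ p r s q → sym (reflexive (≡.cong (λ x → x q) (B-p p r s)))))
            (trans (-‿cong (ih {B} (λ q → trans (eq q) (sym (reflexive (≡.cong (λ x → x q) B-i)))))) ε⁻¹≈ε)
          where
          a b : Fin (suc (suc n))
          a = suc (inject₁ i)
          b = suc (suc i)
          adj : Adjacent a b
          adj = adj-suc (adjacent-inject₁ i)
          B : Mat (suc (suc n)) (suc (suc n))
          B p with p Finₚ.≟ a | p Finₚ.≟ b
          ... | yes _ | _ = A b
          ... | no _ | yes _ = A a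
          ... | no _ | no _ = A p
          B-i : B a ≡ A b
          B-i with a Finₚ.≟ a
          ... | yes _ = ≡.refl
          ... | no p = ⊥-elim (p ≡.refl)
          B-j : B b ≡ A a
          B-j with b Finₚ.≟ a | b Finₚ.≟ b
          ... | yes p | _ = ⊥-elim (adjacent-≢ adj (≡.sym p))
          ... | no _ | yes _ = ≡.refl
          ... | no _ | no p = ⊥-elim (p ≡.refl)
          B-p : ∀ p → p ≢ a → p ≢ b → B p ≡ A p
          B-p p r s with p Finₚ.≟ a | p Finₚ.≟ b
          ... | yes e | _ = ⊥-elim (r e)
          ... | no _ | yes e = ⊥-elim (s e)
          ... | no _ | no _ = ≡.refl

    zero-row : ∀ i {A} → (∀ q → A i q ≈ 0#) → F A ≈ 0#
    zero-row i {A} p = trans (linear i 0# 0# {A} {A} {A}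
        (λ q → trans (p q) (sym (trans (+-cong (zeroˡ _) (zeroˡ _)) (+-identityˡ _)))) (λ _ _ _ → refl) (λ _ _ _ → refl))
      (trans (+-cong (zeroˡ _) (zeroˡ _)) (+-identityˡ _))

    private
      ◂-cong : ∀ {x y : Fin (suc n) → Carrier} {B C : Mat n (suc n)} → (∀ q → x q ≈ y q) → B ≋ C → (x ◂ B) ≋ (y ◂ C)
      ◂-cong p q zero = p
      ◂-cong p q (suc i) = q i

    first-row-∑ : ∀ {k} (a : Fin k → Carrier) (r : Fin k → Fin (suc n) → Carrier) B →
      F ((λ q → sum (λ j → a j * r j q)) ◂ B) ≈ sum (λ j → a j * F (r j ◂ B))
    first-row-∑ {zero} a r B = trans (zero-row zero (λ q → sum-[] _)) (sym (sum-[] _))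
    first-row-∑ {suc k} a r B = begin
      F ((λ q → sum (λ j → a j * r j q)) ◂ B)
        ≈⟨ linear zero (a zero) 1# {C = (λ q → sum (λ j → a (suc j) * r (suc j) q)) ◂ B} (λ q → trans (sum-∷ _) (+-congˡ (sym (*-identityˡ _)))) other other ⟩
      a zero * F (r zero ◂ B) + 1# * F ((λ q → sum (λ j → a (suc j) * r (suc j) q)) ◂ B)
        ≈⟨ +-congˡ (trans (*-identityˡ _) (first-row-∑ (λ j → a (suc j)) (λ j → r (suc j)) B)) ⟩
      a zero * F (r zero ◂ B) + sum (λ j → a (suc j) * F (r (suc j) ◂ B))
        ≈⟨ sum-∷ _ ⟨
      sum (λ j → a j * F (r j ◂ B)) ∎
      where
      other : ∀ {x y : Fin (suc n) → Carrier} p → p ≢ zero → ∀ q → (x ◂ B) p q ≈ (y ◂ B) p q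
      other zero r = ⊥-elim (r ≡.refl)
      other (suc p) r q = refl

    expand-first-row : ∀ A → F A ≈ sum (λ j → A zero j * F (𝐈 j ◂ (λ p → A (suc p))))
    expand-first-row A = trans (F-cong eq) (first-row-∑ (A zero) 𝐈 (λ p → A (suc p)))
      where
      eq : A ≋ ((λ q → sum (λ j → A zero j * 𝐈 j q)) ◂ (λ p → A (suc p)))
      eq zero q = sym (∑-δʳ q (A zero))
      eq (suc p) q = refl

    insert : Fin (suc n) → (Fin n → Carrier) → Fin (suc n) → Carrier
    insert j x q with j Finₚ.≟ q
    ... | yes _ = 0#
    ... | no p = x (punchOut p)

    private
      insert-linear : ∀ j a b x y z → (∀ q → x q ≈ a * y q + b * z q) → ∀ q → insert j x q ≈ a * insert j y q + b * insert j z q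
      insert-linear j a b x y z p q with j Finₚ.≟ q
      ... | yes _ = sym (trans (+-cong (zeroʳ _) (zeroʳ _)) (+-identityˡ _))
      ... | no r = p (punchOut r)

      insert-cong : ∀ j {x y : Fin n → Carrier} → (∀ q → x q ≈ y q) → ∀ q → insert j x q ≈ insert j y q
      insert-cong j p q with j Finₚ.≟ q
      ... | yes _ = refl
      ... | no r = p (punchOut r)

    insert-𝐈 : ∀ j p q → insert j (𝐈 p) q ≈ 𝐈 (punchIn j p) q
    insert-𝐈 j p q with j Finₚ.≟ q
    ... | yes ≡.refl = sym (δ-≢ (Finₚ.punchInᵢ≢i j p))
    ... | no r = trans (sym (δ-injective {f = punchIn j} (λ {a} {b} → Finₚ.punchIn-injective j a b) p (punchOut r)))
                       (reflexive (≡.cong (δ (punchIn j p)) (Finₚ.punchIn-punchOut r)))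

    -- Subtracting multiples of the first row e_j clears column j of the other rows.
    clear-column : ∀ j (B : Mat n (suc n)) → F (𝐈 j ◂ B) ≈ F (𝐈 j ◂ (λ p → insert j (λ q → B p (punchIn j q))))
    clear-column j B = replace n (λ C → F (𝐈 j ◂ C)) (λ e → F-cong (◂-cong (λ _ → refl) e)) single B
      where
      cleared : (Fin (suc n) → Carrier) → Fin (suc n) → Carrier
      cleared x = insert j (λ q → x (punchIn j q))
      split : ∀ x q → cleared x q ≈ 1# * x q + (- x j) * 𝐈 j q
      split x q with j Finₚ.≟ q
      ... | yes ≡.refl = sym (trans (+-cong (*-identityˡ _) (*-identityʳ _)) (-‿inverseʳ _))
      ... | no r = trans (reflexive (≡.cong x (Finₚ.punchIn-punchOut r)))
                     (sym (trans (+-cong (*-identityˡ _) (zeroʳ _)) (+-identityʳ _)))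
      single : ∀ p (C C' : Mat n (suc n)) → (∀ i → i ≢ p → ∀ q → C i q ≈ C' i q) → (∀ q → C' p q ≈ cleared (C p) q) →
        F (𝐈 j ◂ C) ≈ F (𝐈 j ◂ C')
      single p C C' same eq = sym (begin
        F (𝐈 j ◂ C')
          ≈⟨ linear (suc p) 1# (- C p j) {𝐈 j ◂ C'} {𝐈 j ◂ C} {𝐈 j ◂ E} (λ q → trans (eq q) (trans (split (C p) q) (+-congˡ (*-congˡ (sym (E-p q))))))
               (λ { zero _ _ → refl ; (suc i) r q → sym (same i (λ e → r (≡.cong suc e)) q) })
               (λ { zero _ _ → refl ; (suc i) r q → trans (sym (same i (λ e → r (≡.cong suc e)) q)) (sym (E-i i (λ e → r (≡.cong suc e)) q)) }) ⟩
        1# * F (𝐈 j ◂ C) + (- C p j) * F (𝐈 j ◂ E)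
          ≈⟨ +-cong (*-identityˡ _) (trans (*-congˡ (first-row-repeated p (λ q → sym (E-p q)))) (zeroʳ _)) ⟩
        F (𝐈 j ◂ C) + 0# ≈⟨ +-identityʳ _ ⟩
        F (𝐈 j ◂ C) ∎)
        where
        -- `C` with row p replaced by the first row e_j. Subtracting the multiple `C p j` of e_j
        -- from row p changes F by a multiple of its value on this matrix, which has a repeated row.
        E : Mat n (suc n)
        E i with i Finₚ.≟ p
        ... | yes _ = 𝐈 j
        ... | no _ = C i
        E-p : ∀ q → E p q ≈ 𝐈 j q
        E-p q with p Finₚ.≟ p
        ... | yes _ = refl
        ... | no r = ⊥-elim (r ≡.refl)
        E-i : ∀ i → i ≢ p → ∀ q → E i q ≈ C i q
        E-i i r q with i Finₚ.≟ p
        ... | yes e = ⊥-elim (r e)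
        ... | no _ = refl
      -- The rows are cleared one by one. The number k of rows and the function H vary, so that a
      -- row already cleared is absorbed into H.
      replace : ∀ k (H : Mat k (suc n) → Carrier) → (∀ {C C'} → C ≋ C' → H C ≈ H C') →
        (∀ p C C' → (∀ i → i ≢ p → ∀ q → C i q ≈ C' i q) → (∀ q → C' p q ≈ cleared (C p) q) → H C ≈ H C') →
        ∀ C → H C ≈ H (λ p → cleared (C p))
      replace zero H H-cong one C = H-cong (λ ())
      replace (suc k) H H-cong one C = begin
        H C ≈⟨ one zero C C₀ (λ { zero r → ⊥-elim (r ≡.refl) ; (suc i) r q → refl }) (λ _ → refl) ⟩
        H C₀ ≈⟨ replace k (λ E → H (cleared (C zero) ◂ E)) (λ e → H-cong (λ { zero q → refl ; (suc i) q → e i q }))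
                 (λ p E E' same eq → one (suc p) _ _ (λ { zero _ _ → refl ; (suc i) r q → same i (λ e → r (≡.cong suc e)) q }) eq)
                 (λ p → C (suc p)) ⟩
        H (cleared (C zero) ◂ (λ p → cleared (C (suc p)))) ≈⟨ H-cong (λ { zero q → refl ; (suc i) q → refl }) ⟩
        H (λ p → cleared (C p)) ∎
        where
        C₀ : Mat (suc k) (suc n)
        C₀ = cleared (C zero) ◂ (λ p → C (suc p))

    -- With the first row frozen at e_j and a zero inserted in column j of the others, F becomes an
    -- alternating function of a smaller matrix; the induction in `alternating-unique` runs on it.
    restrict : Fin (suc n) → Mat n n → Carrier
    restrict j B = F (𝐈 j ◂ (λ p → insert j (B p)))

    restrict-alternating : ∀ j → RowAlternating (restrict j)
    restrict-alternating j = record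
      { F-cong = λ e → F-cong (◂-cong (λ _ → refl) (λ p → insert-cong j (e p)))
      ; linear = λ i a b p r s → linear (suc i) a b (insert-linear j a b _ _ _ p)
          (λ { zero _ _ → refl ; (suc k) e → insert-cong j (r k (λ x → e (≡.cong suc x))) })
          (λ { zero _ _ → refl ; (suc k) e → insert-cong j (s k (λ x → e (≡.cong suc x))) })
      ; adjacent = λ adj e → adjacent (adj-suc adj) (insert-cong j e) }

  bring-to-front : ∀ {n} → Fin (suc n) → Fin (suc n) → Fin (suc n)
  bring-to-front j zero = j
  bring-to-front j (suc p) = punchIn j p

  -- The row order is j, 0, ..., j-1, j+1, .... For a successor, one swap of the first two rows puts
  -- row 0 in front, and the rows below form the same kind of cycle for the predecessor.
  bring-to-front-sgn : ∀ {n} {F : Mat (suc n) (suc n) → Carrier} → RowAlternating F → ∀ j →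
    F (λ p → 𝐈 (bring-to-front j p)) ≈ sgn j * F 𝐈
  bring-to-front-sgn {F = F} alt zero = trans (RowAlternating.F-cong alt (λ { zero q → refl ; (suc p) q → refl })) (sym (*-identityˡ _))
  bring-to-front-sgn {suc n} {F} alt (suc j) = begin
    F (λ p → 𝐈 (bring-to-front (suc j) p))
      ≈⟨ swap-adjacent alt adj-zero _ (𝐈 zero ◂ (λ p → insert alt zero (𝐈 (bring-to-front j p))))
           (λ q → sym (insert-𝐈 alt zero j q)) (λ q → refl)
           (λ { zero r s q → ⊥-elim (r ≡.refl) ; (suc zero) r s q → ⊥-elim (s ≡.refl) ; (suc (suc p)) r s q → sym (insert-𝐈 alt zero (punchIn j p) q) }) ⟩
    - restrict alt zero (λ p → 𝐈 (bring-to-front j p)) ≈⟨ -‿cong (bring-to-front-sgn (restrict-alternating alt zero) j) ⟩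
    - (sgn j * restrict alt zero 𝐈) ≈⟨ -‿distribˡ-* _ _ ⟩
    - sgn j * restrict alt zero 𝐈
      ≈⟨ *-congˡ (RowAlternating.F-cong alt (λ { zero q → refl ; (suc p) q → insert-𝐈 alt zero p q })) ⟩
    - sgn j * F 𝐈 ∎

  -- After column j is cleared, the term of e_j in the first row depends on the minor alone. The
  -- induction hypothesis turns it into D of that minor, and the sign comes from moving e_j back to
  -- its place.
  alternating-unique : ∀ {n} {F : Mat n n → Carrier} → RowAlternating F → ∀ A → F A ≈ F 𝐈 * D A
  alternating-unique {zero} alt A = trans (RowAlternating.F-cong alt (λ ())) (sym (*-identityʳ _))
  alternating-unique {suc n} {F} alt A = begin
    F A ≈⟨ expand-first-row alt A ⟩
    sum (λ j → A zero j * F (𝐈 j ◂ (λ p → A (suc p)))) ≈⟨ sum-cong (λ j → *-congˡ (eq j)) ⟩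
    sum (λ j → A zero j * (sgn j * F 𝐈 * D (minor j A)))
      ≈⟨ sum-cong (λ j → solve 4 (λ a s f d → a :* (s :* f :* d) := f :* (s :* (a :* d))) refl _ _ _ _) ⟩
    sum (λ j → F 𝐈 * (sgn j * (A zero j * D (minor j A)))) ≈⟨ *-∑ _ _ ⟨
    F 𝐈 * D A ∎
    where
    eq : ∀ j → F (𝐈 j ◂ (λ p → A (suc p))) ≈ sgn j * F 𝐈 * D (minor j A)
    eq j = begin
      F (𝐈 j ◂ (λ p → A (suc p))) ≈⟨ clear-column alt j _ ⟩
      restrict alt j (minor j A) ≈⟨ alternating-unique (restrict-alternating alt j) (minor j A) ⟩
      restrict alt j 𝐈 * D (minor j A)
        ≈⟨ *-congʳ (RowAlternating.F-cong alt (λ { zero q → refl ; (suc p) q → insert-𝐈 alt j p q })) ⟩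
      F (λ p → 𝐈 (bring-to-front j p)) * D (minor j A) ≈⟨ *-congʳ (bring-to-front-sgn alt j) ⟩
      sgn j * F 𝐈 * D (minor j A) ∎

  _ᵀ : ∀ {p q} → Mat p q → Mat q p
  (M ᵀ) i j = M j i

  D-𝐈 : ∀ n → D (𝐈 {n}) ≈ 1#
  D-𝐈 zero = refl
  D-𝐈 (suc n) = begin
    sum (λ j → sgn j * (𝐈 zero j * D (minor j 𝐈))) ≈⟨ ∑-single zero (λ j p → trans (*-congˡ (trans (*-congʳ (δ-≢ (λ e → p (≡.sym e)))) (zeroˡ _))) (zeroʳ _)) ⟩
    1# * (1# * D (minor zero (𝐈 {suc n}))) ≈⟨ trans (*-identityˡ _) (*-identityˡ _) ⟩
    D (minor zero (𝐈 {suc n})) ≈⟨ D-cong {n} (δ-injective Finₚ.suc-injective) ⟩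
    D (𝐈 {n}) ≈⟨ D-𝐈 n ⟩
    1# ∎

  -- D is linear and alternating in the columns by the expansion along the first row; hence both transposition
  -- and multiplicativity follow from the uniqueness of functions that are linear and alternating in the rows.
  private
    product-alternating : ∀ {n} (B : Mat n n) → RowAlternating (λ A → D ((A ⊡ B) ᵀ))
    product-alternating B = record
      { F-cong = λ e → D-cong (λ p q → sum-cong (λ r → *-congʳ (e q r)))
      ; linear = λ i a b l r s → D-linear i a b
          (λ p → trans (sum-cong (λ k → trans (*-congʳ (l k)) (trans (distribʳ _ _ _) (+-cong (*-assoc _ _ _) (*-assoc _ _ _))))) (linear-combination a b _ _))
          (λ p q e → sum-cong (λ k → *-congʳ (r q e k)))
          (λ p q e → sum-cong (λ k → *-congʳ (s q e k)))
      ; adjacent = λ adj e → D-adjacent adj (λ p → sum-cong (λ k → *-congʳ (e k))) }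

    D-product-ᵀ : ∀ {n} (A B : Mat n n) → D ((A ⊡ B) ᵀ) ≈ D (B ᵀ) * D A
    D-product-ᵀ A B = trans (alternating-unique (product-alternating B) A) (*-congʳ (D-cong (λ p q → ⊡-identityˡ B q p)))

  D-ᵀ : ∀ {n} (A : Mat n n) → D (A ᵀ) ≈ D A
  D-ᵀ {n} A = begin
    D (A ᵀ) ≈⟨ D-cong (λ p q → ⊡-identityʳ A q p) ⟨
    D ((A ⊡ 𝐈) ᵀ) ≈⟨ D-product-ᵀ A 𝐈 ⟩
    D (𝐈 {n} ᵀ) * D A ≈⟨ *-congʳ (trans (D-cong {n} (λ p q → δ-sym q p)) (D-𝐈 n)) ⟩
    1# * D A ≈⟨ *-identityˡ _ ⟩
    D A ∎

  D-⊡ : ∀ {n} (A B : Mat n n) → D (A ⊡ B) ≈ D A * D B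
  D-⊡ A B = trans (sym (D-ᵀ (A ⊡ B))) (trans (D-product-ᵀ A B) (trans (*-comm _ _) (*-congˡ (D-ᵀ B))))

  -- In the expansion along the first row the columns of the second block contribute nothing, and
  -- deleting a column of the first block keeps the block shape.
  D-lower-block : ∀ p q (M : Mat (p ℕ.+ q) (p ℕ.+ q)) → (∀ a b → M (a ↑ˡ q) (p ↑ʳ b) ≈ 0#) →
    D M ≈ D (λ a b → M (a ↑ˡ q) (b ↑ˡ q)) * D (λ a b → M (p ↑ʳ a) (p ↑ʳ b))
  D-lower-block zero q M z = sym (*-identityˡ _)
  D-lower-block (suc p) q M z = begin
    sum (λ j → sgn j * (M zero j * D (minor j M))) ≈⟨ ∑-split (suc p) q _ ⟩
    sum (λ j → sgn (j ↑ˡ q) * (M zero (j ↑ˡ q) * D (minor (j ↑ˡ q) M))) + sum (λ j → sgn (suc p ↑ʳ j) * (M zero (suc p ↑ʳ j) * D (minor (suc p ↑ʳ j) M)))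
      ≈⟨ +-cong (sum-cong left) (∑-zero (λ j → trans (*-congˡ (trans (*-congʳ (z zero j)) (zeroˡ _))) (zeroʳ _))) ⟩
    sum (λ j → sgn j * (X zero j * D (minor j X)) * D Y) + 0# ≈⟨ +-identityʳ _ ⟩
    sum (λ j → sgn j * (X zero j * D (minor j X)) * D Y) ≈⟨ ∑-* _ _ ⟨
    D X * D Y ∎
    where
    X : Mat (suc p) (suc p)
    X a b = M (a ↑ˡ q) (b ↑ˡ q)
    Y : Mat q q
    Y a b = M (suc p ↑ʳ a) (suc p ↑ʳ b)
    sgn-↑ˡ : ∀ {n} (j : Fin n) → sgn (j ↑ˡ q) ≈ sgn j
    sgn-↑ˡ zero = refl
    sgn-↑ˡ (suc j) = -‿cong (sgn-↑ˡ j)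
    punchIn-↑ˡ : ∀ {n} (j : Fin (suc n)) b → punchIn (j ↑ˡ q) (b ↑ˡ q) ≡ punchIn j b ↑ˡ q
    punchIn-↑ˡ zero b = ≡.refl
    punchIn-↑ˡ (suc j) zero = ≡.refl
    punchIn-↑ˡ (suc j) (suc b) = ≡.cong suc (punchIn-↑ˡ j b)
    punchIn-↑ʳ : ∀ {n} (j : Fin (suc n)) b → punchIn (j ↑ˡ q) (n ↑ʳ b) ≡ suc n ↑ʳ b
    punchIn-↑ʳ zero b = ≡.refl
    punchIn-↑ʳ {suc n} (suc j) b = ≡.cong suc (punchIn-↑ʳ j b)
    left : ∀ j → sgn (j ↑ˡ q) * (M zero (j ↑ˡ q) * D (minor (j ↑ˡ q) M)) ≈ sgn j * (X zero j * D (minor j X)) * D Y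
    left j = begin
      sgn (j ↑ˡ q) * (M zero (j ↑ˡ q) * D (minor (j ↑ˡ q) M))
        ≈⟨ *-cong (sgn-↑ˡ j) (*-congˡ (D-lower-block p q (minor (j ↑ˡ q) M) (λ a b → trans (reflexive (≡.cong (M (suc (a ↑ˡ q))) (punchIn-↑ʳ j b))) (z (suc a) b)))) ⟩
      sgn j * (X zero j * (D (λ a b → minor (j ↑ˡ q) M (a ↑ˡ q) (b ↑ˡ q)) * D (λ a b → minor (j ↑ˡ q) M (p ↑ʳ a) (p ↑ʳ b))))
        ≈⟨ *-congˡ (*-congˡ (*-cong (D-cong (λ a b → reflexive (≡.cong (M (suc (a ↑ˡ q))) (punchIn-↑ˡ j b))))
                                    (D-cong (λ a b → reflexive (≡.cong (M (suc (p ↑ʳ a))) (punchIn-↑ʳ j b)))))) ⟩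
      sgn j * (X zero j * (D (minor j X) * D Y)) ≈⟨ trans (*-congˡ (sym (*-assoc _ _ _))) (sym (*-assoc _ _ _)) ⟩
      sgn j * (X zero j * D (minor j X)) * D Y ∎

  D-upper-block : ∀ p q (M : Mat (p ℕ.+ q) (p ℕ.+ q)) → (∀ a b → M (p ↑ʳ a) (b ↑ˡ q) ≈ 0#) →
    D M ≈ D (λ a b → M (a ↑ˡ q) (b ↑ˡ q)) * D (λ a b → M (p ↑ʳ a) (p ↑ʳ b))
  D-upper-block p q M z = begin
    D M     ≈⟨ D-ᵀ M ⟨
    D (M ᵀ) ≈⟨ D-lower-block p q (M ᵀ) (λ a b → z b a) ⟩
    D (X ᵀ) * D (Y ᵀ) ≈⟨ *-cong (D-ᵀ X) (D-ᵀ Y) ⟩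
    D X * D Y ∎
    where
    X : Mat p p
    X a b = M (a ↑ˡ q) (b ↑ˡ q)
    Y : Mat q q
    Y a b = M (p ↑ʳ a) (p ↑ʳ b)

  block : ∀ {p q r s} → Mat p r → Mat p s → Mat q r → Mat q s → Mat (p ℕ.+ q) (r ℕ.+ s)
  block {p} {q} {r} {s} X Y Z W a b = entry (Fin.splitAt p a) (Fin.splitAt r b)
    where
    entry : Fin p ⊎ Fin q → Fin r ⊎ Fin s → Carrier
    entry (inj₁ a) (inj₁ b) = X a b
    entry (inj₁ a) (inj₂ b) = Y a b
    entry (inj₂ a) (inj₁ b) = Z a b
    entry (inj₂ a) (inj₂ b) = W a b

  module _ {p q r s} (X : Mat p r) (Y : Mat p s) (Z : Mat q r) (W : Mat q s) where
    block-ˡˡ : ∀ a b → block X Y Z W (a ↑ˡ q) (b ↑ˡ s) ≡ X a b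
    block-ˡˡ a b rewrite Finₚ.splitAt-↑ˡ p a q | Finₚ.splitAt-↑ˡ r b s = ≡.refl
    block-ˡʳ : ∀ a b → block X Y Z W (a ↑ˡ q) (r ↑ʳ b) ≡ Y a b
    block-ˡʳ a b rewrite Finₚ.splitAt-↑ˡ p a q | Finₚ.splitAt-↑ʳ r s b = ≡.refl
    block-ʳˡ : ∀ a b → block X Y Z W (p ↑ʳ a) (b ↑ˡ s) ≡ Z a b
    block-ʳˡ a b rewrite Finₚ.splitAt-↑ʳ p q a | Finₚ.splitAt-↑ˡ r b s = ≡.refl
    block-ʳʳ : ∀ a b → block X Y Z W (p ↑ʳ a) (r ↑ʳ b) ≡ W a b
    block-ʳʳ a b rewrite Finₚ.splitAt-↑ʳ p q a | Finₚ.splitAt-↑ʳ r s b = ≡.refl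

  by-blocks : ∀ p {q} r {s} {M N : Mat (p ℕ.+ q) (r ℕ.+ s)} →
    (∀ a b → M (a ↑ˡ q) (b ↑ˡ s) ≈ N (a ↑ˡ q) (b ↑ˡ s)) → (∀ a b → M (a ↑ˡ q) (r ↑ʳ b) ≈ N (a ↑ˡ q) (r ↑ʳ b)) →
    (∀ a b → M (p ↑ʳ a) (b ↑ˡ s) ≈ N (p ↑ʳ a) (b ↑ˡ s)) → (∀ a b → M (p ↑ʳ a) (r ↑ʳ b) ≈ N (p ↑ʳ a) (r ↑ʳ b)) → M ≋ N
  by-blocks p {q} r {s} {M} {N} ll lr rl rr i j with Fin.splitAt p i | Fin.splitAt r j | Finₚ.join-splitAt p q i | Finₚ.join-splitAt r s j
  ... | inj₁ a | inj₁ b | ≡.refl | ≡.refl = ll a b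
  ... | inj₁ a | inj₂ b | ≡.refl | ≡.refl = lr a b
  ... | inj₂ a | inj₁ b | ≡.refl | ≡.refl = rl a b
  ... | inj₂ a | inj₂ b | ≡.refl | ≡.refl = rr a b

  block-⊡ : ∀ {p q r s u v} (X : Mat p r) (Y : Mat p s) (Z : Mat q r) (W : Mat q s)
    (X' : Mat r u) (Y' : Mat r v) (Z' : Mat s u) (W' : Mat s v) →
    block X Y Z W ⊡ block X' Y' Z' W' ≋ block (X ⊡ X' ⊞ Y ⊡ Z') (X ⊡ Y' ⊞ Y ⊡ W') (Z ⊡ X' ⊞ W ⊡ Z') (Z ⊡ Y' ⊞ W ⊡ W')
  block-⊡ {p} {q} {r} {s} {u} {v} X Y Z W X' Y' Z' W' = by-blocks p u
    (λ a b → trans (entry _ _ (λ j → block-ˡˡ X Y Z W a j) (λ j → block-ˡʳ X Y Z W a j) (λ j → block-ˡˡ X' Y' Z' W' j b) (λ j → block-ʳˡ X' Y' Z' W' j b)) (reflexive (≡.sym (block-ˡˡ XX XY ZX ZY a b))))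
    (λ a b → trans (entry _ _ (λ j → block-ˡˡ X Y Z W a j) (λ j → block-ˡʳ X Y Z W a j) (λ j → block-ˡʳ X' Y' Z' W' j b) (λ j → block-ʳʳ X' Y' Z' W' j b)) (reflexive (≡.sym (block-ˡʳ XX XY ZX ZY a b))))
    (λ a b → trans (entry _ _ (λ j → block-ʳˡ X Y Z W a j) (λ j → block-ʳʳ X Y Z W a j) (λ j → block-ˡˡ X' Y' Z' W' j b) (λ j → block-ʳˡ X' Y' Z' W' j b)) (reflexive (≡.sym (block-ʳˡ XX XY ZX ZY a b))))
    (λ a b → trans (entry _ _ (λ j → block-ʳˡ X Y Z W a j) (λ j → block-ʳʳ X Y Z W a j) (λ j → block-ˡʳ X' Y' Z' W' j b) (λ j → block-ʳʳ X' Y' Z' W' j b)) (reflexive (≡.sym (block-ʳʳ XX XY ZX ZY a b))))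
    where
    XX : Mat p u
    XX = X ⊡ X' ⊞ Y ⊡ Z'
    XY : Mat p v
    XY = X ⊡ Y' ⊞ Y ⊡ W'
    ZX : Mat q u
    ZX = Z ⊡ X' ⊞ W ⊡ Z'
    ZY : Mat q v
    ZY = Z ⊡ Y' ⊞ W ⊡ W'
    entry : ∀ (f g : Fin (r ℕ.+ s) → Carrier) {x x' : Fin r → Carrier} {y y' : Fin s → Carrier} →
      (∀ j → f (j ↑ˡ s) ≡ x j) → (∀ j → f (r ↑ʳ j) ≡ y j) → (∀ j → g (j ↑ˡ s) ≡ x' j) → (∀ j → g (r ↑ʳ j) ≡ y' j) →
      sum (λ j → f j * g j) ≈ sum (λ j → x j * x' j) + sum (λ j → y j * y' j)
    entry f g fx fy gx gy = trans (∑-split r s _)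
      (+-cong (sum-cong (λ j → *-cong (reflexive (fx j)) (reflexive (gx j)))) (sum-cong (λ j → *-cong (reflexive (fy j)) (reflexive (gy j)))))

  block-cong : ∀ {p q r s} {X X' : Mat p r} {Y Y' : Mat p s} {Z Z' : Mat q r} {W W' : Mat q s} →
    X ≋ X' → Y ≋ Y' → Z ≋ Z' → W ≋ W' → block X Y Z W ≋ block X' Y' Z' W'
  block-cong {p} {q} {r} {s} x y z w a b with Fin.splitAt p a | Fin.splitAt r b
  ... | inj₁ a | inj₁ b = x a b
  ... | inj₁ a | inj₂ b = y a b
  ... | inj₂ a | inj₁ b = z a b
  ... | inj₂ a | inj₂ b = w a b

  D-block-lower : ∀ {p q} (X : Mat p p) (Z : Mat q p) (W : Mat q q) → D (block X 𝟎 Z W) ≈ D X * D W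
  D-block-lower {p} {q} X Z W = trans
    (D-lower-block p q _ (λ a b → reflexive (block-ˡʳ X 𝟎 Z W a b)))
    (*-cong (D-cong (λ a b → reflexive (block-ˡˡ X 𝟎 Z W a b))) (D-cong (λ a b → reflexive (block-ʳʳ X 𝟎 Z W a b))))

  D-block-upper : ∀ {p q} (X : Mat p p) (Y : Mat p q) (W : Mat q q) → D (block X Y 𝟎 W) ≈ D X * D W
  D-block-upper {p} {q} X Y W = trans
    (D-upper-block p q _ (λ a b → reflexive (block-ʳˡ X Y 𝟎 W a b)))
    (*-cong (D-cong (λ a b → reflexive (block-ˡˡ X Y 𝟎 W a b))) (D-cong (λ a b → reflexive (block-ʳʳ X Y 𝟎 W a b))))

  -- [1 0; V 1] [1 U; 0 1-VU] = [1 U; V 1] = [1-UV U; 0 1] [1 0; V 1].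
  D-sylvester : ∀ {p q} (U : Mat p q) (V : Mat q p) → D (𝐈 ⊞ ⊟ (U ⊡ V)) ≈ D (𝐈 ⊞ ⊟ (V ⊡ U))
  D-sylvester {p} {q} U V = begin
    D UV                                    ≈⟨ unit-right UV q ⟨
    D UV * D (𝐈 {q})                        ≈⟨ D-block-upper UV U 𝐈 ⟨
    D (block UV U 𝟎 𝐈)                      ≈⟨ unit-right (block UV U 𝟎 𝐈) (p ℕ.+ q) ⟨
    D (block UV U 𝟎 𝐈) * 1#′                ≈⟨ *-congˡ (trans (D-𝐈 (p ℕ.+ q)) (sym (trans (D-block-lower 𝐈 V 𝐈) (trans (*-cong (D-𝐈 p) (D-𝐈 q)) (*-identityˡ _))))) ⟩
    D (block UV U 𝟎 𝐈) * D (block 𝐈 𝟎 V 𝐈)  ≈⟨ D-⊡ (block UV U 𝟎 𝐈) (block 𝐈 𝟎 V 𝐈) ⟨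
    D (block UV U 𝟎 𝐈 ⊡ block 𝐈 𝟎 V 𝐈)      ≈⟨ D-cong (λ a b → trans (block-⊡ UV U 𝟎 𝐈 𝐈 𝟎 V 𝐈 a b) (trans (block-cong e₁ e₂ e₃ e₄ a b) (sym (block-⊡ 𝐈 𝟎 V 𝐈 𝐈 U 𝟎 VU a b)))) ⟩
    D (block 𝐈 𝟎 V 𝐈 ⊡ block 𝐈 U 𝟎 VU)      ≈⟨ D-⊡ (block 𝐈 𝟎 V 𝐈) (block 𝐈 U 𝟎 VU) ⟩
    D (block 𝐈 𝟎 V 𝐈) * D (block 𝐈 U 𝟎 VU)  ≈⟨ *-cong (D-block-lower 𝐈 V 𝐈) (D-block-upper 𝐈 U VU) ⟩
    (D (𝐈 {p}) * D (𝐈 {q})) * (D (𝐈 {p}) * D VU)  ≈⟨ *-cong (*-cong (D-𝐈 p) (D-𝐈 q)) (*-congʳ (D-𝐈 p)) ⟩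
    (1# * 1#) * (1# * D VU)                 ≈⟨ trans (*-congʳ (*-identityˡ _)) (trans (*-identityˡ _) (*-identityˡ _)) ⟩
    D VU                                    ∎
    where
    UV : Mat p p
    UV = 𝐈 ⊞ ⊟ (U ⊡ V)
    VU : Mat q q
    VU = 𝐈 ⊞ ⊟ (V ⊡ U)
    1#′ = D (𝐈 {p ℕ.+ q})
    unit-right : ∀ {n} (X : Mat n n) m → D X * D (𝐈 {m}) ≈ D X
    unit-right X m = trans (*-congˡ (D-𝐈 m)) (*-identityʳ _)
    zero-⊡ : ∀ {p q r} (X : Mat q r) → 𝟎 {p} ⊡ X ≋ 𝟎
    zero-⊡ X i j = ∑-zero (λ k → zeroˡ _)
    ⊡-zero : ∀ {p q r} (X : Mat p q) → X ⊡ 𝟎 {q} {r} ≋ 𝟎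
    ⊡-zero X i j = ∑-zero (λ k → zeroʳ _)
    e₁ : UV ⊡ 𝐈 ⊞ U ⊡ V ≋ 𝐈 ⊡ 𝐈 ⊞ 𝟎 ⊡ 𝟎
    e₁ a b = begin
      (UV ⊡ 𝐈) a b + (U ⊡ V) a b            ≈⟨ +-congʳ (⊡-identityʳ UV a b) ⟩
      (𝐈 a b - (U ⊡ V) a b) + (U ⊡ V) a b   ≈⟨ trans (+-assoc _ _ _) (+-congˡ (-‿inverseˡ _)) ⟩
      𝐈 a b + 0#                            ≈⟨ +-cong (⊡-identityˡ 𝐈 a b) (zero-⊡ 𝟎 a b) ⟨
      (𝐈 ⊡ 𝐈) a b + (𝟎 {p} {q} ⊡ 𝟎) a b     ∎
    e₂ : UV ⊡ 𝟎 ⊞ U ⊡ 𝐈 ≋ 𝐈 ⊡ U ⊞ 𝟎 ⊡ VU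
    e₂ a b = trans (+-cong (⊡-zero UV a b) (⊡-identityʳ U a b)) (trans (+-comm _ _) (sym (+-cong (⊡-identityˡ U a b) (zero-⊡ VU a b))))
    e₃ : 𝟎 ⊡ 𝐈 ⊞ 𝐈 ⊡ V ≋ V ⊡ 𝐈 ⊞ 𝐈 ⊡ 𝟎
    e₃ a b = trans (+-cong (zero-⊡ 𝐈 a b) (⊡-identityˡ V a b)) (trans (+-comm _ _) (sym (+-cong (⊡-identityʳ V a b) (⊡-zero 𝐈 a b))))
    e₄ : 𝟎 ⊡ 𝟎 ⊞ 𝐈 ⊡ 𝐈 ≋ V ⊡ U ⊞ 𝐈 ⊡ VU
    e₄ a b = begin
      (𝟎 {q} {p} ⊡ 𝟎) a b + (𝐈 ⊡ 𝐈) a b     ≈⟨ +-cong (zero-⊡ 𝟎 a b) (⊡-identityˡ 𝐈 a b) ⟩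
      0# + 𝐈 a b                            ≈⟨ +-congʳ (-‿inverseʳ ((V ⊡ U) a b)) ⟨
      ((V ⊡ U) a b - (V ⊡ U) a b) + 𝐈 a b   ≈⟨ trans (+-assoc _ _ _) (+-congˡ (+-comm _ _)) ⟩
      (V ⊡ U) a b + (𝐈 a b - (V ⊡ U) a b)   ≈⟨ +-congˡ (⊡-identityˡ VU a b) ⟨
      (V ⊡ U) a b + (𝐈 ⊡ VU) a b            ∎

  -- Comparison with the recursive definition of `det`

  private
    data RowSum {k} (S : Mat (suc k) (suc k) → List (Fin (suc k)) → Carrier) (M : Mat (suc k) (suc k)) : Carrier → List (Fin (suc k)) → Set c where
      rest : ∀ x js → RowSum S M (x + S M js) js

    data Sign {k} (S : Mat (suc k) (suc k) → ℕ → Carrier → Carrier) (M : Mat (suc k) (suc k)) : Carrier → ℕ → Carrier → Set c where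
      signed : ∀ n x y → Sign S M (S M n x + y) n x

    -- The local functions of det, recovered by unification.
    mutual
      rowSum : ∀ {k} → Mat (suc k) (suc k) → List (Fin (suc k)) → Carrier
      rowSum = _

      rowSum-det : ∀ {k} (M : Mat (suc k) (suc k)) → RowSum rowSum M (det rawRing M) (List.tabulate suc)
      rowSum-det {k} M with List.tabulate {n = k} Fin.suc
      ... | js = rest _ js

    mutual
      sign : ∀ {k} → Mat (suc k) (suc k) → ℕ → Carrier → Carrier
      sign = _

      sign-rowSum : ∀ {k} (M : Mat (suc k) (suc k)) j → Sign sign M (rowSum M (j ∷ [])) (toℕ j) (M zero j * det rawRing (minor j M))
      sign-rowSum M j with toℕ j | M zero j * det rawRing (minor j M)
      ... | n | x = signed n x _

    sign-sgn : ∀ {k} (M : Mat (suc k) (suc k)) {n} (j : Fin n) x → sign M (toℕ j) x ≈ sgn j * x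
    sign-sgn M zero x = sym (*-identityˡ x)
    sign-sgn M (suc zero) x = sym (-1*x≈-x x)
    sign-sgn M (suc (suc j)) x = trans (sign-sgn M j x) (*-congʳ (sym (⁻¹-involutive _)))

    rowSum-∑ : ∀ {k n} (M : Mat (suc k) (suc k)) (g : Fin n → Fin (suc k)) →
      rowSum M (List.tabulate g) ≈ sum (λ i → sgn (g i) * (M zero (g i) * det rawRing (minor (g i) M)))
    rowSum-∑ {n = zero} M g = sym (sum-[] _)
    rowSum-∑ {n = suc n} M g = trans (+-cong (sign-sgn M (g zero) _) (rowSum-∑ M (λ i → g (suc i)))) (sym (sum-∷ _))

  det≈D : ∀ {n} (M : Mat n n) → det rawRing M ≈ D M
  det≈D {zero} M = refl
  det≈D {suc n} M = trans (rowSum-∑ M (λ i → i)) (sum-cong (λ j → *-congˡ (*-congˡ (det≈D (minor j M)))))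

-- The Study determinant

module RingIdentities {c ℓ : Level} (A : Ring c ℓ) where
  open Ring A
  open RingProperties A
  open AGP +-abelianGroup using (⁻¹-∙-comm)
  open SetoidReasoning setoid
  -- For y = [0 Y; 0 0] and z = [0 0; Z 0] this is the block triangular factorization of [1 Y; Z 1],
  -- and the middle factor carries the Schur complement 1 - YZ.
  nilpotent-factorization : ∀ y z → y * y ≈ 0# → z * z ≈ 0# → ((1# + y) * (1# - y * z)) * (1# + z) ≈ 1# + (y + z)
  nilpotent-factorization y z yy zz = begin
    ((1# + y) * (1# - y * z)) * (1# + z) ≈⟨ *-congʳ left ⟩
    ((1# + y) - y * z) * (1# + z)        ≈⟨ distribˡ _ _ _ ⟩
    ((1# + y) - y * z) * 1# + ((1# + y) - y * z) * z ≈⟨ +-cong (*-identityʳ _) right ⟩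
    ((1# + y) - y * z) + (z + y * z)     ≈⟨ trans (+-assoc _ _ _) (+-congˡ (trans (+-congˡ (+-comm _ _)) (trans (sym (+-assoc _ _ _)) (trans (+-congʳ (-‿inverseˡ _)) (+-identityˡ _))))) ⟩
    (1# + y) + z                         ≈⟨ +-assoc _ _ _ ⟩
    1# + (y + z)                         ∎
    where
    yyz : y * (y * z) ≈ 0#
    yyz = trans (sym (*-assoc _ _ _)) (trans (*-congʳ yy) (zeroˡ _))
    yzz : (y * z) * z ≈ 0#
    yzz = trans (*-assoc _ _ _) (trans (*-congˡ zz) (zeroʳ _))
    left : (1# + y) * (1# - y * z) ≈ (1# + y) - y * z
    left = trans (distribˡ _ _ _) (+-cong (*-identityʳ _) (trans (distribʳ _ _ _)
      (trans (+-cong (*-identityˡ _) (trans (sym (-‿distribʳ-* _ _)) (trans (-‿cong yyz) -0#≈0#))) (+-identityʳ _))))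
    right : ((1# + y) - y * z) * z ≈ z + y * z
    right = trans (distribʳ _ _ _) (trans (+-cong (trans (distribʳ _ _ _) (+-congʳ (*-identityˡ _)))
      (trans (sym (-‿distribˡ-* _ _)) (trans (-‿cong yzz) -0#≈0#))) (+-identityʳ _))

  one-minus : ∀ x y → x * y ≈ 0# → (1# - x) * (1# - y) ≈ 1# - (x + y)
  one-minus x y xy≈0 = trans (distribˡ _ _ _) (trans (+-cong (*-identityʳ _)
      (trans (distribʳ _ _ _) (trans (+-cong (*-identityˡ _) (trans (sym (-‿distribˡ-* x (- y)))
        (trans (-‿cong (trans (sym (-‿distribʳ-* x y)) (trans (-‿cong xy≈0) -0#≈0#))) -0#≈0#))) (+-identityʳ _))))
      (trans (+-assoc _ _ _) (+-congˡ (⁻¹-∙-comm x y))))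

  inverse-unique : ∀ {x y z} → y * x ≈ 1# → x * z ≈ 1# → y ≈ z
  inverse-unique {x} {y} {z} p q = trans (sym (*-identityʳ y)) (trans (*-congˡ (sym q)) (trans (sym (*-assoc y x z)) (trans (*-congʳ p) (*-identityˡ z))))

-- x = σ x + j π x, with κ the complex conjugation.
record Splitting {c ℓ : Level} (H : Ring c ℓ) (C : CommutativeRing c ℓ) : Set (c ⊔ ℓ) where
  private
    module H = Ring H
    module C = CommutativeRing C
  field
    σ π : H.Carrier → C.Carrier
    κ   : C.Carrier → C.Carrier
    σ-cong : ∀ {x y} → x H.≈ y → σ x C.≈ σ y
    π-cong : ∀ {x y} → x H.≈ y → π x C.≈ π y
    κ-cong : ∀ {x y} → x C.≈ y → κ x C.≈ κ y
    σ-+ : ∀ x y → σ (x H.+ y) C.≈ σ x C.+ σ y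
    π-+ : ∀ x y → π (x H.+ y) C.≈ π x C.+ π y
    κ-+ : ∀ x y → κ (x C.+ y) C.≈ κ x C.+ κ y
    κ-* : ∀ x y → κ (x C.* y) C.≈ κ x C.* κ y
    κ-involutive : ∀ x → κ (κ x) C.≈ x
    σ-* : ∀ x y → σ (x H.* y) C.≈ σ x C.* σ y C.- κ (π x) C.* π y
    π-* : ∀ x y → π (x H.* y) C.≈ π x C.* σ y C.+ κ (σ x) C.* π y
    σ-1 : σ H.1# C.≈ C.1#
    π-1 : π H.1# C.≈ C.0#
    κ-1 : κ C.1# C.≈ C.1#

-- The argument uses only the rules of a `Splitting`, so it applies directly to quaternionic power
-- series, where σ, π and κ act coefficientwise.
module StudyDeterminant {c ℓ : Level} (H : Ring c ℓ) (C : CommutativeRing c ℓ) (split : Splitting H C) where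
  private
    module H = Ring H
    module HP = RingProperties H
    module HS = FiniteSums H
  open CommutativeRing C hiding (zero)
  open RingProperties ring
  open AGP +-abelianGroup using (ε⁻¹≈ε; ⁻¹-∙-comm; ⁻¹-involutive)
  open FiniteSums ring
  open Matrices ring
  open Determinants C
  open Splitting split
  module HM = Matrices H
  open HM using () renaming (Mat to HMat)
  open SetoidReasoning setoid

  module Additive (h : H.Carrier → Carrier) (h-cong : ∀ {x y} → x H.≈ y → h x ≈ h y) (h-+ : ∀ x y → h (x H.+ y) ≈ h x + h y) where
    h-0 : h H.0# ≈ 0#
    h-0 = identityʳ-unique (h H.0#) (h H.0#) (trans (sym (h-+ _ _)) (h-cong (H.+-identityˡ _)))
      where open GP +-group

    h-neg : ∀ x → h (H.- x) ≈ - h x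
    h-neg x = inverseˡ-unique (h (H.- x)) (h x) (trans (sym (h-+ _ _)) (trans (h-cong (H.-‿inverseˡ x)) h-0))
      where open GP +-group

    h-∑ : ∀ {n} (f : Fin n → H.Carrier) → h (HS.sum f) ≈ sum (λ i → h (f i))
    h-∑ {zero} f = trans (h-cong (HS.sum-[] f)) (trans h-0 (sym (sum-[] _)))
    h-∑ {suc n} f = trans (h-cong (HS.sum-∷ f)) (trans (h-+ _ _) (trans (+-congˡ (h-∑ (λ i → f (suc i)))) (sym (sum-∷ _))))

    h-⊡ : ∀ (u u' v v' : H.Carrier → Carrier) → (∀ x y → h (x H.* y) ≈ u x * u' y + v x * v' y) →
      ∀ {p q r} (M : HMat p q) (N : HMat q r) i k →
      h ((M HM.⊡ N) i k) ≈ ((λ a b → u (M a b)) ⊡ (λ a b → u' (N a b)) ⊞ (λ a b → v (M a b)) ⊡ (λ a b → v' (N a b))) i k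
    h-⊡ u u' v v' h-* M N i k = trans (h-∑ _) (trans (sum-cong (λ j → h-* (M i j) (N j k))) (∑-+ _ _))

  private
    σ̄ -π̄ : H.Carrier → Carrier
    σ̄ x = κ (σ x)
    -π̄ x = - κ (π x)

    -π̄-cong : ∀ {x y} → x H.≈ y → -π̄ x ≈ -π̄ y
    -π̄-cong p = -‿cong (κ-cong (π-cong p))
    σ̄-cong : ∀ {x y} → x H.≈ y → σ̄ x ≈ σ̄ y
    σ̄-cong p = κ-cong (σ-cong p)
    -π̄-+ : ∀ x y → -π̄ (x H.+ y) ≈ -π̄ x + -π̄ y
    -π̄-+ x y = trans (-‿cong (trans (κ-cong (π-+ x y)) (κ-+ _ _))) (sym (⁻¹-∙-comm _ _))
    σ̄-+ : ∀ x y → σ̄ (x H.+ y) ≈ σ̄ x + σ̄ y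
    σ̄-+ x y = trans (κ-cong (σ-+ x y)) (κ-+ _ _)

    κ-0 : κ 0# ≈ 0#
    κ-0 = identityʳ-unique (κ 0#) (κ 0#) (trans (sym (κ-+ _ _)) (κ-cong (+-identityˡ _)))
      where open GP +-group
    κ-neg : ∀ x → κ (- x) ≈ - κ x
    κ-neg x = inverseˡ-unique (κ (- x)) (κ x) (trans (sym (κ-+ _ _)) (trans (κ-cong (-‿inverseˡ x)) κ-0))
      where open GP +-group

    -- With `-π̄-*`, `π-*` and `σ̄-*` this gives the four blocks of ψ M ⊡ ψ N. The second block
    -- column of ψ follows from the first by conjugation, which is why ψ is multiplicative.
    σ-*′ : ∀ x y → σ (x H.* y) ≈ σ x * σ y + -π̄ x * π y
    σ-*′ x y = trans (σ-* x y) (+-congˡ (-‿distribˡ-* _ _))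
    -π̄-* : ∀ x y → -π̄ (x H.* y) ≈ σ x * -π̄ y + -π̄ x * σ̄ y
    -π̄-* x y = begin
      - κ (π (x H.* y))                       ≈⟨ -‿cong (trans (κ-cong (π-* x y)) (κ-+ _ _)) ⟩
      - (κ (π x * σ y) + κ (κ (σ x) * π y))   ≈⟨ -‿cong (+-cong (κ-* _ _) (trans (κ-* _ _) (*-congʳ (κ-involutive _)))) ⟩
      - (κ (π x) * κ (σ y) + σ x * κ (π y))   ≈⟨ ⁻¹-∙-comm _ _ ⟨
      - (κ (π x) * κ (σ y)) - σ x * κ (π y)   ≈⟨ +-comm _ _ ⟩
      - (σ x * κ (π y)) - κ (π x) * κ (σ y)   ≈⟨ +-cong (-‿distribʳ-* _ _) (-‿distribˡ-* _ _) ⟩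
      σ x * -π̄ y + -π̄ x * σ̄ y                 ∎
    σ̄-* : ∀ x y → σ̄ (x H.* y) ≈ π x * -π̄ y + σ̄ x * σ̄ y
    σ̄-* x y = begin
      κ (σ (x H.* y))                         ≈⟨ trans (κ-cong (σ-* x y)) (κ-+ _ _) ⟩
      κ (σ x * σ y) + κ (- (κ (π x) * π y))   ≈⟨ +-cong (κ-* _ _) (trans (κ-neg _) (-‿cong (trans (κ-* _ _) (*-congʳ (κ-involutive _))))) ⟩
      κ (σ x) * κ (σ y) - π x * κ (π y)       ≈⟨ trans (+-comm _ _) (+-congʳ (-‿distribʳ-* _ _)) ⟩
      π x * -π̄ y + σ̄ x * σ̄ y                  ∎

    module Aσ = Additive σ σ-cong σ-+
    module Aπ = Additive π π-cong π-+
    module Aσ̄ = Additive σ̄ σ̄-cong σ̄-+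
    module A-π̄ = Additive -π̄ -π̄-cong -π̄-+

  private
    map : (H.Carrier → Carrier) → ∀ {p q} → HMat p q → Mat p q
    map h M a b = h (M a b)

  ψ : ∀ {p q} → HMat p q → Mat (p ℕ.+ p) (q ℕ.+ q)
  ψ M = block (map σ M) (map -π̄ M) (map π M) (map σ̄ M)

  ψ-cong : ∀ {p q} {M N : HMat p q} → M HM.≋ N → ψ M ≋ ψ N
  ψ-cong e = block-cong (λ a b → σ-cong (e a b)) (λ a b → -π̄-cong (e a b)) (λ a b → π-cong (e a b)) (λ a b → σ̄-cong (e a b))

  ψ-⊡ : ∀ {p q r} (M : HMat p q) (N : HMat q r) → ψ (M HM.⊡ N) ≋ ψ M ⊡ ψ N
  ψ-⊡ M N a b = trans
    (block-cong (Aσ.h-⊡ σ σ -π̄ π σ-*′ M N) (A-π̄.h-⊡ σ -π̄ -π̄ σ̄ -π̄-* M N)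
                (Aπ.h-⊡ π σ σ̄ π π-* M N) (Aσ̄.h-⊡ π -π̄ σ̄ σ̄ σ̄-* M N) a b)
    (sym (block-⊡ (map σ M) (map -π̄ M) (map π M) (map σ̄ M) (map σ N) (map -π̄ N) (map π N) (map σ̄ N) a b))

  ψ-𝐈 : ∀ {p} → ψ (HM.𝐈 {p}) ≋ 𝐈
  ψ-𝐈 {p} = by-blocks p p
    (λ a b → trans (reflexive (block-ˡˡ (map σ 𝐈ₚ) (map -π̄ 𝐈ₚ) (map π 𝐈ₚ) (map σ̄ 𝐈ₚ) a b)) (trans (δ-map σ σ-1 Aσ.h-0 a b) (sym (δ-injective (Finₚ.↑ˡ-injective p _ _) a b))))
    (λ a b → trans (reflexive (block-ˡʳ (map σ 𝐈ₚ) (map -π̄ 𝐈ₚ) (map π 𝐈ₚ) (map σ̄ 𝐈ₚ) a b)) (trans (δ-zero -π̄ (trans (-‿cong (trans (κ-cong π-1) κ-0)) ε⁻¹≈ε) A-π̄.h-0 a b) (sym (δ-≢ (λ e → ↑ˡ≢↑ʳ a b e)))))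
    (λ a b → trans (reflexive (block-ʳˡ (map σ 𝐈ₚ) (map -π̄ 𝐈ₚ) (map π 𝐈ₚ) (map σ̄ 𝐈ₚ) a b)) (trans (δ-zero π π-1 Aπ.h-0 a b) (sym (δ-≢ (λ e → ↑ˡ≢↑ʳ b a (≡.sym e))))))
    (λ a b → trans (reflexive (block-ʳʳ (map σ 𝐈ₚ) (map -π̄ 𝐈ₚ) (map π 𝐈ₚ) (map σ̄ 𝐈ₚ) a b)) (trans (δ-map σ̄ (trans (κ-cong σ-1) κ-1) Aσ̄.h-0 a b) (sym (δ-injective (Finₚ.↑ʳ-injective p _ _) a b))))
    where
    𝐈ₚ : HMat p p
    𝐈ₚ = HM.𝐈
    δ-map : ∀ {n} (h : H.Carrier → Carrier) → h H.1# ≈ 1# → h H.0# ≈ 0# → ∀ (a b : Fin n) → h (HS.δ a b) ≈ δ a b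
    δ-map h p q a b with a Finₚ.≟ b
    ... | yes _ = p
    ... | no _ = q
    δ-zero : ∀ {n} (h : H.Carrier → Carrier) → h H.1# ≈ 0# → h H.0# ≈ 0# → ∀ (a b : Fin n) → h (HS.δ a b) ≈ 0#
    δ-zero h p q a b with a Finₚ.≟ b
    ... | yes _ = p
    ... | no _ = q

  ψ-minus : ∀ {p q} (M N : HMat p q) → ψ (M HM.⊞ HM.⊟ N) ≋ ψ M ⊞ ⊟ ψ N
  ψ-minus {p} {q} M N a b with Fin.splitAt p a | Fin.splitAt q b
  ... | inj₁ a | inj₁ b = trans (σ-+ _ _) (+-congˡ (Aσ.h-neg _))
  ... | inj₁ a | inj₂ b = trans (-π̄-+ _ _) (+-congˡ (A-π̄.h-neg _))
  ... | inj₂ a | inj₁ b = trans (π-+ _ _) (+-congˡ (Aπ.h-neg _))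
  ... | inj₂ a | inj₂ b = trans (σ̄-+ _ _) (+-congˡ (Aσ̄.h-neg _))

  -- Abstract, so that the matrix can be inferred by unification.
  abstract
    S : ∀ {n} → HMat n n → Carrier
    S M = D (ψ M)

    S≡D-ψ : ∀ {n} (M : HMat n n) → S M ≡ D (ψ M)
    S≡D-ψ M = ≡.refl

  S-cong : ∀ {n} {M N : HMat n n} → M HM.≋ N → S M ≈ S N
  S-cong {M = M} {N} e = trans (reflexive (S≡D-ψ M)) (trans (D-cong (ψ-cong e)) (reflexive (≡.sym (S≡D-ψ N))))

  S-⊡ : ∀ {n} (M N : HMat n n) → S (M HM.⊡ N) ≈ S M * S N
  S-⊡ M N = trans (reflexive (S≡D-ψ _)) (trans (D-cong (ψ-⊡ M N)) (trans (D-⊡ (ψ M) (ψ N))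
    (reflexive (≡.sym (≡.cong₂ _*_ (S≡D-ψ M) (S≡D-ψ N))))))

  S-𝐈 : ∀ n → S (HM.𝐈 {n}) ≈ 1#
  S-𝐈 n = trans (reflexive (S≡D-ψ (HM.𝐈 {n}))) (trans (D-cong (ψ-𝐈 {n})) (D-𝐈 (n ℕ.+ n)))

  S-sylvester : ∀ {p q} (U : HMat p q) (V : HMat q p) → S (HM.𝐈 HM.⊞ HM.⊟ (U HM.⊡ V)) ≈ S (HM.𝐈 HM.⊞ HM.⊟ (V HM.⊡ U))
  S-sylvester U V = begin
    S (HM.𝐈 HM.⊞ HM.⊟ (U HM.⊡ V))      ≈⟨ one U V ⟩
    D (𝐈 ⊞ ⊟ (ψ U ⊡ ψ V))              ≈⟨ D-sylvester (ψ U) (ψ V) ⟩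
    D (𝐈 ⊞ ⊟ (ψ V ⊡ ψ U))              ≈⟨ one V U ⟨
    S (HM.𝐈 HM.⊞ HM.⊟ (V HM.⊡ U))      ∎
    where
    one : ∀ {p q} (U : HMat p q) (V : HMat q p) → S (HM.𝐈 HM.⊞ HM.⊟ (U HM.⊡ V)) ≈ D (𝐈 ⊞ ⊟ (ψ U ⊡ ψ V))
    one {p} U V = trans (reflexive (S≡D-ψ _)) (D-cong (λ a b → trans (ψ-minus HM.𝐈 (U HM.⊡ V) a b) (+-cong (ψ-𝐈 {p} a b) (-‿cong (ψ-⊡ U V a b)))))

  -- The determinant of the 2 × 2 matrix of x under ψ. For quaternionic series it is the norm f f*,
  -- as `norm` shows.
  ν : H.Carrier → Carrier
  ν x = σ x * κ (σ x) + κ (π x) * π x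

  ν-cong : ∀ {x y} → x H.≈ y → ν x ≈ ν y
  ν-cong e = +-cong (*-cong (σ-cong e) (σ̄-cong e)) (*-cong (κ-cong (π-cong e)) (π-cong e))

  S-1×1 : (M : HMat 1 1) → S M ≈ ν (M zero zero)
  S-1×1 M = begin
    S M ≡⟨ S≡D-ψ M ⟩
    sum (λ j → sgn j * (ψ M zero j * D (minor j (ψ M)))) ≈⟨ two _ ⟩
    1# * (σ x * D (minor zero (ψ M))) + (- 1#) * (-π̄ x * D (minor (suc zero) (ψ M)))
      ≈⟨ +-cong (*-identityˡ _) (-1*x≈-x _) ⟩
    σ x * D (minor zero (ψ M)) - -π̄ x * D (minor (suc zero) (ψ M))
      ≈⟨ +-cong (*-congˡ (D₁ (minor zero (ψ M)))) (-‿cong (*-congˡ (D₁ (minor (suc zero) (ψ M))))) ⟩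
    σ x * κ (σ x) - -π̄ x * π x ≈⟨ +-congˡ (trans (-‿distribˡ-* _ _) (*-congʳ (⁻¹-involutive _))) ⟩
    ν x ∎
    where
    x = M zero zero
    two : (f : Fin 2 → Carrier) → sum f ≈ f zero + f (suc zero)
    two f = trans (sum-∷ f) (+-congˡ (trans (sum-∷ _) (trans (+-congˡ (sum-[] _)) (+-identityʳ _))))
    D₁ : (N : Mat 1 1) → D N ≈ N zero zero
    D₁ N = trans (sum-∷ _) (trans (+-cong (trans (*-identityˡ _) (*-identityʳ _)) (sum-[] _)) (+-identityʳ _))

  ν-1 : ν H.1# ≈ 1#
  ν-1 = trans (sym (S-1×1 HM.𝐈)) (S-𝐈 1)

  prod : ∀ {n} → (Fin n → Carrier) → Carrier
  prod {zero} f = 1#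
  prod {suc n} f = f zero * prod (λ i → f (suc i))

  prod-cong : ∀ {n} {f g : Fin n → Carrier} → (∀ i → f i ≈ g i) → prod f ≈ prod g
  prod-cong {zero} p = refl
  prod-cong {suc n} p = *-cong (p zero) (prod-cong (λ i → p (suc i)))

  -- `S-sylvester` with a single inner index: the other side is a 1 × 1 matrix. The order v u
  -- matters, since the entries need not commute.
  S-rank-one : ∀ {p} (u : Fin p → H.Carrier) (v : Fin p → H.Carrier) →
    S (HM.𝐈 HM.⊞ HM.⊟ (λ a b → u a H.* v b)) ≈ ν (H.1# H.- HS.sum (λ a → v a H.* u a))
  S-rank-one u v = begin
    S (HM.𝐈 HM.⊞ HM.⊟ (λ a b → u a H.* v b)) ≈⟨ S-cong (λ a b → H.+-congˡ (H.-‿cong (H.sym (single _)))) ⟩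
    S (HM.𝐈 HM.⊞ HM.⊟ (U HM.⊡ V)) ≈⟨ S-sylvester U V ⟩
    S (HM.𝐈 HM.⊞ HM.⊟ (V HM.⊡ U)) ≈⟨ S-1×1 (HM.𝐈 HM.⊞ HM.⊟ (V HM.⊡ U)) ⟩
    ν (H.1# H.- HS.sum (λ a → v a H.* u a)) ∎
    where
    U : HMat _ 1
    U a _ = u a
    V : HMat 1 _
    V _ b = v b
    single : (f : Fin 1 → H.Carrier) → HS.sum f H.≈ f zero
    single f = H.trans (HS.sum-∷ f) (H.trans (H.+-congˡ (HS.sum-[] _)) (H.+-identityʳ _))

  -- Off-diagonal orthogonality makes 1 - UV the ordered product of the factors 1 - u_i v_i: all
  -- cross terms u_i (v_i u_j) v_j with i < j vanish. Each factor is then evaluated by `S-rank-one`.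
  S-orthogonal : ∀ {p r} (U : HMat p r) (V : HMat r p) → (∀ i j → i ≢ j → (V HM.⊡ U) i j H.≈ H.0#) →
    S (HM.𝐈 HM.⊞ HM.⊟ (U HM.⊡ V)) ≈ prod (λ i → ν (H.1# H.- (V HM.⊡ U) i i))
  S-orthogonal {p} {zero} U V orth = trans (S-cong (λ a b → H.trans (H.+-congˡ (H.trans (H.-‿cong (HS.sum-[] _)) HP.-0#≈0#)) (H.+-identityʳ _))) (S-𝐈 p)
  S-orthogonal {p} {suc r} U V orth = begin
    S (HM.𝐈 HM.⊞ HM.⊟ (U HM.⊡ V)) ≈⟨ S-cong factor ⟨
    S ((HM.𝐈 HM.⊞ HM.⊟ E) HM.⊡ (HM.𝐈 HM.⊞ HM.⊟ (U' HM.⊡ V'))) ≈⟨ S-⊡ _ _ ⟩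
    S (HM.𝐈 HM.⊞ HM.⊟ E) * S (HM.𝐈 HM.⊞ HM.⊟ (U' HM.⊡ V'))
      ≈⟨ *-cong (S-rank-one (λ a → U a zero) (V zero)) (S-orthogonal U' V' (λ i j e → orth (suc i) (suc j) (λ x → e (Finₚ.suc-injective x)))) ⟩
    prod (λ i → ν (H.1# H.- (V HM.⊡ U) i i)) ∎
    where
    E : HMat p p
    E a b = U a zero H.* V zero b
    U' : HMat p r
    U' a i = U a (suc i)
    V' : HMat r p
    V' i = V (suc i)
    EU'V' : (E HM.⊡ (U' HM.⊡ V')) HM.≋ HM.𝟎
    EU'V' a b = H.trans (H.sym (HM.⊡-assoc E U' V' a b)) (HS.∑-zero (λ i → H.trans (H.*-congʳ (H.trans
        (HS.sum-cong (λ c → H.*-assoc _ _ _)) (H.trans (H.sym (HS.*-∑ (U a zero) _)) (H.trans (H.*-congˡ (orth zero (suc i) (λ ()))) (H.zeroʳ _))))) (H.zeroˡ _)))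
    factor : ((HM.𝐈 HM.⊞ HM.⊟ E) HM.⊡ (HM.𝐈 HM.⊞ HM.⊟ (U' HM.⊡ V'))) HM.≋ (HM.𝐈 HM.⊞ HM.⊟ (U HM.⊡ V))
    factor a b = H.trans (RingIdentities.one-minus (HM.matrixRing p) E (U' HM.⊡ V') EU'V' a b) (H.+-congˡ (H.-‿cong (H.sym (HS.sum-∷ _))))

-- Lyndon words

module LyndonWords (k : ℕ) where
  Word : Set
  Word = List (Fin k)

  infix 4 _≺_
  data _≺_ : Word → Word → Set where
    prefix : ∀ {b v} → [] ≺ b ∷ v
    letter : ∀ {a b u v} → a Fin.< b → a ∷ u ≺ b ∷ v
    tail   : ∀ {a u v} → u ≺ v → a ∷ u ≺ a ∷ v

  ≺-irrefl : ∀ {u} → ¬ u ≺ u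
  ≺-irrefl (letter p) = ℕₚ.<-irrefl ≡.refl p
  ≺-irrefl (tail p) = ≺-irrefl p

  ≺-trans : ∀ {u v w} → u ≺ v → v ≺ w → u ≺ w
  ≺-trans prefix (letter q) = prefix
  ≺-trans prefix (tail q) = prefix
  ≺-trans (letter p) (letter q) = letter (ℕₚ.<-trans p q)
  ≺-trans (letter p) (tail q) = letter p
  ≺-trans (tail p) (letter q) = letter q
  ≺-trans (tail p) (tail q) = tail (≺-trans p q)

  ≺-asym : ∀ {u v} → u ≺ v → ¬ v ≺ u
  ≺-asym p q = ≺-irrefl (≺-trans p q)

  ≺-connex : ∀ u v → u ≺ v ⊎ u ≡ v ⊎ v ≺ u
  ≺-connex [] [] = inj₂ (inj₁ ≡.refl)
  ≺-connex [] (b ∷ v) = inj₁ prefix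
  ≺-connex (a ∷ u) [] = inj₂ (inj₂ prefix)
  ≺-connex (a ∷ u) (b ∷ v) with Finₚ.<-cmp a b
  ... | tri< p _ _ = inj₁ (letter p)
  ... | tri> _ _ p = inj₂ (inj₂ (letter p))
  ... | tri≈ _ ≡.refl _ with ≺-connex u v
  ... | inj₁ p = inj₁ (tail p)
  ... | inj₂ (inj₁ p) = inj₂ (inj₁ (≡.cong (a ∷_) p))
  ... | inj₂ (inj₂ p) = inj₂ (inj₂ (tail p))

  ≺-++ : ∀ u {v} → v ≢ [] → u ≺ u ++ v
  ≺-++ [] {[]} p = ⊥-elim (p ≡.refl)
  ≺-++ [] {b ∷ v} p = prefix
  ≺-++ (a ∷ u) p = tail (≺-++ u p)

  ≺-cancel : ∀ s {u v} → s ++ u ≺ s ++ v → u ≺ v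
  ≺-cancel [] p = p
  ≺-cancel (a ∷ s) (letter p) = ⊥-elim (ℕₚ.<-irrefl ≡.refl p)
  ≺-cancel (a ∷ s) (tail p) = ≺-cancel s p

  -- The order is not compatible with appending on the right. This may fail only when u is a proper
  -- prefix of v, and the arguments on Lyndon words branch on that case.
  ≺-split : ∀ {u v} → u ≺ v → (∃ λ y → v ≡ u ++ y × y ≢ []) ⊎ (∀ x y → u ++ x ≺ v ++ y)
  ≺-split (prefix {b} {v}) = inj₁ (b ∷ v , ≡.refl , λ ())
  ≺-split (letter p) = inj₂ (λ x y → letter p)
  ≺-split (tail p) with ≺-split p
  ... | inj₁ (y , ≡.refl , q) = inj₁ (y , ≡.refl , q)
  ... | inj₂ q = inj₂ (λ x y → tail (q x y))

  ≺-++-shorter : ∀ {u v} x → length v ℕ.≤ length u → u ≺ v → u ≺ v ++ x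
  ≺-++-shorter x (s≤s le) (letter p) = letter p
  ≺-++-shorter x (s≤s le) (tail p) = tail (≺-++-shorter x le p)

  <lex⇒≺ : ∀ u v → T (Words._<lex_ (List.map toℕ u) (List.map toℕ v)) → u ≺ v
  <lex⇒≺ [] (b ∷ v) p = prefix
  <lex⇒≺ (a ∷ u) (b ∷ v) p with Equivalence.to (T-∨ {toℕ a <ᵇ toℕ b}) p
  ... | inj₁ q = letter (ℕₚ.<ᵇ⇒< _ _ q)
  ... | inj₂ q with Equivalence.to (T-∧ {toℕ a ≡ᵇ toℕ b}) q
  ... | e , r with Finₚ.toℕ-injective {i = a} {b} (ℕₚ.≡ᵇ⇒≡ _ _ e)
  ... | ≡.refl = tail (<lex⇒≺ u v r)

  ≺⇒<lex : ∀ {u v} → u ≺ v → T (Words._<lex_ (List.map toℕ u) (List.map toℕ v))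
  ≺⇒<lex prefix = tt
  ≺⇒<lex (letter {a} {b} p) = Equivalence.from (T-∨ {toℕ a <ᵇ toℕ b}) (inj₁ (ℕₚ.<⇒<ᵇ p))
  ≺⇒<lex (tail {a} p) = Equivalence.from (T-∨ {toℕ a <ᵇ toℕ a}) (inj₂ (Equivalence.from (T-∧ {toℕ a ≡ᵇ toℕ a}) (ℕₚ.≡⇒≡ᵇ (toℕ a) _ ≡.refl , ≺⇒<lex p)))

  isLyndon : Word → Bool
  isLyndon l = Words.isLyndon (List.map toℕ l)

  drop-++ : ∀ {A : Set} (p s : List A) → List.drop (length p) (p ++ s) ≡ s
  drop-++ [] s = ≡.refl
  drop-++ (a ∷ p) s = drop-++ p s

  take-++ : ∀ {A : Set} (p s : List A) → List.take (length p) (p ++ s) ≡ p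
  take-++ [] s = ≡.refl
  take-++ (a ∷ p) s = ≡.cong (a ∷_) (take-++ p s)

  rotate-++ : ∀ (p s : Word) → Words.rotate (length p) (List.map toℕ (p ++ s)) ≡ List.map toℕ (s ++ p)
  rotate-++ p s
    rewrite Listₚ.map-++ toℕ p s | ≡.sym (Listₚ.length-map toℕ p)
          | drop-++ (List.map toℕ p) (List.map toℕ s) | take-++ (List.map toℕ p) (List.map toℕ s) = ≡.sym (Listₚ.map-++ toℕ s p)

  -- `Words.isLyndon` compares a word with its rotations; the factorization needs the comparison
  -- with proper suffixes.
  record Lyndon (l : Word) : Set where
    constructor lyndon
    field smaller : ∀ p s → p ≢ [] → s ≢ [] → l ≡ p ++ s → l ≺ s

  length-≢[] : ∀ {p : Word} → p ≢ [] → 0 ℕ.< length p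
  length-≢[] {[]} p = ⊥-elim (p ≡.refl)
  length-≢[] {_ ∷ _} p = s≤s z≤n

  length-++-≢ˡ : ∀ (p s : Word) → p ≢ [] → length s ℕ.< length (p ++ s)
  length-++-≢ˡ p s p≢ rewrite Listₚ.length-++ p {s} = ℕₚ.m<n+m (length s) (length-≢[] p≢)

  length-++-≢ʳ : ∀ (p s : Word) → s ≢ [] → length p ℕ.< length (p ++ s)
  length-++-≢ʳ p s s≢ rewrite Listₚ.length-++ p {s} = ℕₚ.m<m+n (length p) (length-≢[] s≢)

  isLyndon⇒rotations : ∀ l → T (isLyndon l) → ∀ p s → p ≢ [] → s ≢ [] → l ≡ p ++ s → l ≺ s ++ p
  isLyndon⇒rotations .([] ++ s) t [] s p≢ s≢ ≡.refl = ⊥-elim (p≢ ≡.refl)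
  isLyndon⇒rotations .((a ∷ p) ++ s) t (a ∷ p) s p≢ s≢ ≡.refl = <lex⇒≺ (a ∷ p ++ s) (s ++ a ∷ p)
    (≡.subst (λ x → T (Words._<lex_ (List.map toℕ (a ∷ p ++ s)) x)) (rotate-++ (a ∷ p) s)
      (All.lookup (Allₚ.all⁺ _ (List.upTo (length (List.map toℕ (p ++ s)))) t)
        (∈-upTo⁺ (≡.subst (length p ℕ.<_) (≡.sym (Listₚ.length-map toℕ (p ++ s))) (length-++-≢ʳ p s s≢)))))

  -- Let l = p s and suppose s ≺ l. If a letter decides this, then s p ≺ l, against the rotation
  -- condition. Otherwise l = s y, and cancelling s in l ≺ s p gives y ≺ p. Since y and p have equal
  -- length, a letter decides, so y s ≺ p s = l, against the condition for the rotation y s.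
  isLyndon⇒Lyndon : ∀ l → T (isLyndon l) → Lyndon l
  isLyndon⇒Lyndon l t = lyndon smaller
    where
    rot = isLyndon⇒rotations l t
    smaller : ∀ p s → p ≢ [] → s ≢ [] → l ≡ p ++ s → l ≺ s
    smaller p s p≢ s≢ e with ≺-connex l s
    ... | inj₁ q = q
    ... | inj₂ (inj₁ q) = ⊥-elim (ℕₚ.<-irrefl (≡.cong length (≡.trans (≡.sym q) e)) (length-++-≢ˡ p s p≢))
    ... | inj₂ (inj₂ q) with ≺-split q
    ... | inj₂ r = ⊥-elim (≺-asym (rot p s p≢ s≢ e) (≡.subst (s ++ p ≺_) (Listₚ.++-identityʳ l) (r p [])))
    ... | inj₁ (y , e' , y≢) = ⊥-elim (contra (≺-split y≺p))
      where
      y≺p : y ≺ p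
      y≺p = ≺-cancel s (≡.subst (_≺ s ++ p) e' (rot p s p≢ s≢ e))
      l≺ys : l ≺ y ++ s
      l≺ys = rot s y s≢ y≢ e'
      same : length y ≡ length p
      same = ℕₚ.+-cancelˡ-≡ (length s) _ _ (≡.trans (≡.sym (Listₚ.length-++ s)) (≡.trans (≡.cong length (≡.trans (≡.sym e') e))
               (≡.trans (Listₚ.length-++ p) (ℕₚ.+-comm (length p) _))))
      contra : (∃ λ z → p ≡ y ++ z × z ≢ []) ⊎ (∀ x z → y ++ x ≺ p ++ z) → ⊥
      contra (inj₁ (z , e″ , z≢)) = ℕₚ.<-irrefl (≡.trans same (≡.cong length e″)) (length-++-≢ʳ y z z≢)
      contra (inj₂ r) = ≺-asym l≺ys (≡.subst (y ++ s ≺_) (≡.sym e) (r s s))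

  -- Take a rotation s p that is not above l. If l ≺ s held, a letter would decide it because s is
  -- shorter than l, and s p would be above l as well.
  ¬isLyndon⇒suffix : ∀ l → l ≢ [] → ¬ T (isLyndon l) → ∃₂ λ p s → s ≢ [] × l ≡ p ++ s × s ≺ l
  ¬isLyndon⇒suffix [] l≢ ¬t = ⊥-elim (l≢ ≡.refl)
  ¬isLyndon⇒suffix (a ∷ l) _ ¬t with find (Allₚ.¬All⇒Any¬ (λ i → T? _) (List.upTo (length (List.map toℕ l))) (λ al → ¬t (Allₚ.all⁻ _ al)))
  ... | i , i∈ , ¬lex = p , s , s≢ , split , smaller
    where
    i<l : i ℕ.< length l
    i<l = ≡.subst (i ℕ.<_) (Listₚ.length-map toℕ l) (∈-upTo⁻ i∈)
    p s : Word
    p = a ∷ List.take i l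
    s = List.drop i l
    split : a ∷ l ≡ p ++ s
    split = ≡.cong (a ∷_) (≡.sym (Listₚ.take++drop≡id i l))
    s≢ : s ≢ []
    s≢ e = ℕₚ.m>n⇒m∸n≢0 i<l (≡.trans (≡.sym (Listₚ.length-drop i l)) (≡.cong length e))
    len-p : length p ≡ suc i
    len-p = ≡.cong suc (≡.trans (Listₚ.length-take i l) (ℕₚ.m≤n⇒m⊓n≡m (ℕₚ.<⇒≤ i<l)))
    ¬rot : ¬ a ∷ l ≺ s ++ p
    ¬rot q = ¬lex (≡.subst (λ x → T (Words._<lex_ (List.map toℕ (a ∷ l)) x))
      (≡.trans (≡.sym (rotate-++ p s)) (≡.cong₂ (λ j x → Words.rotate j (List.map toℕ x)) len-p (≡.sym split))) (≺⇒<lex q))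
    shorter : length s ℕ.< length (a ∷ l)
    shorter = ≡.subst (length s ℕ.<_) (≡.cong length (≡.sym split)) (length-++-≢ˡ p s (λ ()))
    smaller : s ≺ a ∷ l
    smaller with ≺-connex s (a ∷ l)
    ... | inj₁ q = q
    ... | inj₂ (inj₁ q) = ⊥-elim (ℕₚ.<-irrefl (≡.cong length q) shorter)
    ... | inj₂ (inj₂ q) = ⊥-elim (¬rot (≺-++-shorter p (ℕₚ.<⇒≤ shorter) q))

  -- Membership in a list stands for the comparison with l: the list consists of the words from l
  -- upward of length at most N, and passing to the next word means dropping the head.
  SuffixesIn : List Word → Word → Set
  SuffixesIn ws [] = ⊤
  SuffixesIn ws (a ∷ u) = (a ∷ u ∈ ws) × SuffixesIn ws u

  suffixesIn? : ∀ ws u → Dec (SuffixesIn ws u)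
  suffixesIn? ws [] = yes tt
  suffixesIn? ws (a ∷ u) = Any.any? (Listₚ.≡-dec Finₚ._≟_ (a ∷ u)) ws ×-dec suffixesIn? ws u

  suffixesIn-++ : ∀ {ws} p {s} → SuffixesIn ws (p ++ s) → SuffixesIn ws s
  suffixesIn-++ [] h = h
  suffixesIn-++ (a ∷ p) (_ , h) = suffixesIn-++ p h

  suffixesIn-∈ : ∀ {ws} p {s} → s ≢ [] → SuffixesIn ws (p ++ s) → s ∈ ws
  suffixesIn-∈ p {[]} s≢ h = ⊥-elim (s≢ ≡.refl)
  suffixesIn-∈ p {b ∷ s} s≢ h = proj₁ (suffixesIn-++ p h)

  suffixesIn-intro : ∀ {ws} u → (∀ p s → s ≢ [] → u ≡ p ++ s → s ∈ ws) → SuffixesIn ws u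
  suffixesIn-intro [] h = tt
  suffixesIn-intro (a ∷ u) h = h [] (a ∷ u) (λ ()) ≡.refl , suffixesIn-intro u (λ p s s≢ e → h (a ∷ p) s s≢ (≡.cong (a ∷_) e))

  ++-suffix-unique : ∀ (p u : Word) {s v} → p ++ s ≡ u ++ v → length s ≡ length v → s ≡ v
  ++-suffix-unique [] [] e _ = e
  ++-suffix-unique [] (a ∷ u) {s} {v} e q = ⊥-elim (ℕₚ.<-irrefl (≡.trans (≡.sym q) (≡.cong length e)) (length-++-≢ˡ (a ∷ u) v (λ ())))
  ++-suffix-unique (a ∷ p) [] {s} {v} e q = ⊥-elim (ℕₚ.<-irrefl (≡.trans q (≡.cong length (≡.sym e))) (length-++-≢ˡ (a ∷ p) s (λ ())))
  ++-suffix-unique (a ∷ p) (b ∷ u) e q = ++-suffix-unique p u (Listₚ.∷-injectiveʳ e) q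

  -- ws is an upper section of the set of nonempty words of length ≤ N.
  record Section (N : ℕ) (ws : List Word) : Set where
    field
      sorted : AllPairs _≺_ ws
      upper  : ∀ s → s ≢ [] → length s ℕ.≤ N → s ∈ ws ⊎ All (s ≺_) ws
      no-[]  : All (_≢ []) ws

  module _ {N : ℕ} {l : Word} {ws : List Word} (sec : Section N (l ∷ ws)) where
    open Section sec

    l≢[] : l ≢ []
    l≢[] = All.head no-[]

    section-tail : Section N ws
    section-tail = record { sorted = AllPairs.tail sorted ; upper = up ; no-[] = All.tail no-[] }
      where
      up : ∀ s → s ≢ [] → length s ℕ.≤ N → s ∈ ws ⊎ All (s ≺_) ws
      up s s≢ le with upper s s≢ le
      ... | inj₁ (Any.here ≡.refl) = inj₂ (AllPairs.head sorted)
      ... | inj₁ (Any.there p) = inj₁ p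
      ... | inj₂ p = inj₂ (All.tail p)

    ∈⇒¬≺ : ∀ {s} → s ∈ l ∷ ws → ¬ s ≺ l
    ∈⇒¬≺ (Any.here ≡.refl) q = ≺-irrefl q
    ∈⇒¬≺ (Any.there p) q = ≺-asym q (All.lookup (AllPairs.head sorted) p)

    ¬≺⇒∈ : ∀ {s} → s ≢ [] → length s ℕ.≤ N → ¬ s ≺ l → s ∈ l ∷ ws
    ¬≺⇒∈ s≢ le q with upper _ s≢ le
    ... | inj₁ p = p
    ... | inj₂ p = ⊥-elim (q (All.head p))

    l∉ws : ¬ l ∈ ws
    l∉ws p = ≺-irrefl (All.lookup (AllPairs.head sorted) p)

    suffixesIn-weaken : ∀ u → SuffixesIn ws u → SuffixesIn (l ∷ ws) u
    suffixesIn-weaken [] h = tt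
    suffixesIn-weaken (a ∷ u) (p , h) = Any.there p , suffixesIn-weaken u h

    suffixesIn-strengthen : ∀ u → (∀ p s → u ≡ p ++ s → s ≢ l) → SuffixesIn (l ∷ ws) u → SuffixesIn ws u
    suffixesIn-strengthen u avoid h = suffixesIn-intro u in-ws
      where
      in-ws : ∀ p s → s ≢ [] → u ≡ p ++ s → s ∈ ws
      in-ws p s s≢ ≡.refl with suffixesIn-∈ p s≢ h
      ... | Any.here e = ⊥-elim (avoid p s ≡.refl e)
      ... | Any.there q = q

    -- A suffix of u v equal to l would have the length of v, hence would be v itself.
    suffixesIn-++-other : ∀ u v → length v ≡ length l → v ≢ l → SuffixesIn (l ∷ ws) (u ++ v) → SuffixesIn ws (u ++ v)
    suffixesIn-++-other u v len v≢l = suffixesIn-strengthen (u ++ v) (λ p s e s≡l →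
      v≢l (≡.trans (≡.sym (++-suffix-unique p u (≡.sym e) (≡.trans (≡.cong length s≡l) (≡.sym len)))) s≡l))

    suffixesIn-short : ∀ u → length u ℕ.< length l → SuffixesIn (l ∷ ws) u → SuffixesIn ws u
    suffixesIn-short u lt = suffixesIn-strengthen u (λ p s e s≡l → ℕₚ.<⇒≱ lt
      (≡.subst₂ ℕ._≤_ (≡.cong length s≡l) (≡.cong length (≡.sym e)) (≡.subst (length s ℕ.≤_) (≡.sym (Listₚ.length-++ p)) (ℕₚ.m≤n+m _ (length p)))))

    ¬suffixesIn-tail : ∀ u → ¬ SuffixesIn ws (u ++ l)
    ¬suffixesIn-tail u h = l∉ws (suffixesIn-∈ u l≢[] h)

    -- A word with suffix l also has the suffix s ≺ l given by `¬isLyndon⇒suffix`, and s lies below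
    -- the section. So no admissible word has l as a suffix, and removing l from the list loses
    -- nothing.
    suffixesIn-not-lyndon : ∀ u → ¬ T (isLyndon l) → SuffixesIn (l ∷ ws) u → SuffixesIn ws u
    suffixesIn-not-lyndon u ¬lyn h with ¬isLyndon⇒suffix l l≢[] ¬lyn
    ... | p , s , s≢ , e , s≺l = suffixesIn-strengthen u (λ { q r ≡.refl ≡.refl →
        ∈⇒¬≺ (suffixesIn-∈ (q ++ p) s≢ (≡.subst (SuffixesIn (l ∷ ws)) (≡.trans (≡.cong (q ++_) e) (≡.sym (Listₚ.++-assoc q p s))) h)) s≺l }) h

    module _ (lyn : Lyndon l) where
      open Lyndon lyn

      suffixesIn-lyndon : length l ℕ.≤ N → SuffixesIn (l ∷ ws) l
      suffixesIn-lyndon le = suffixesIn-intro l in-ws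
        where
        in-ws : ∀ p s → s ≢ [] → l ≡ p ++ s → s ∈ l ∷ ws
        in-ws [] s s≢ e = Any.here (≡.sym e)
        in-ws (a ∷ p) s s≢ e = ¬≺⇒∈ s≢ (ℕₚ.≤-trans (ℕₚ.<⇒≤ (≡.subst (length s ℕ.<_) (≡.cong length (≡.sym e)) (length-++-≢ˡ (a ∷ p) s (λ ())))) le)
          (≺-asym (smaller (a ∷ p) s (λ ()) s≢ e))

      -- Appending letters raises a word in the order, so the suffixes reaching into u stay at or
      -- above l; the suffixes of l itself are covered by the Lyndon property.
      suffixesIn-append : ∀ u → length (u ++ l) ℕ.≤ N → SuffixesIn (l ∷ ws) u → SuffixesIn (l ∷ ws) (u ++ l)
      suffixesIn-append [] le h = suffixesIn-lyndon le
      suffixesIn-append (a ∷ u) le (p , h) = ¬≺⇒∈ (λ ()) le (not-below p) , suffixesIn-append u (ℕₚ.≤-trans (ℕₚ.n≤1+n _) le) h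
        where
        not-below : a ∷ u ∈ l ∷ ws → ¬ (a ∷ u) ++ l ≺ l
        not-below (Any.here e) q = ≺-irrefl (≺-trans (≡.subst (_≺ (a ∷ u) ++ l) e (≺-++ (a ∷ u) l≢[])) q)
        not-below (Any.there r) q = ≺-irrefl (≺-trans (≺-trans (All.lookup (AllPairs.head sorted) r) (≺-++ (a ∷ u) l≢[])) q)

      -- Let v be a nonempty suffix of u, so that v l is not below l, and suppose v ≺ l. If a letter
      -- decides this, then v l ≺ l. Otherwise l = v y, the Lyndon property gives l ≺ y, and again v
      -- l ≺ v y = l.
      suffixesIn-remove : ∀ u → length (u ++ l) ℕ.≤ N → SuffixesIn (l ∷ ws) (u ++ l) → SuffixesIn (l ∷ ws) u
      suffixesIn-remove [] le h = tt
      suffixesIn-remove (a ∷ u) le (p , h) = ¬≺⇒∈ (λ ()) short not-below , suffixesIn-remove u (ℕₚ.≤-trans (ℕₚ.n≤1+n _) le) h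
        where
        short : length (a ∷ u) ℕ.≤ N
        short = ℕₚ.≤-trans (ℕₚ.<⇒≤ (length-++-≢ʳ (a ∷ u) l l≢[])) le
        not-below : ¬ a ∷ u ≺ l
        not-below q with ≺-split q
        ... | inj₂ r = ∈⇒¬≺ p (≡.subst ((a ∷ u) ++ l ≺_) (Listₚ.++-identityʳ l) (r l []))
        ... | inj₁ (y , e , y≢) = ∈⇒¬≺ p (≡.subst ((a ∷ u) ++ l ≺_) (≡.sym e)
                (prepend (a ∷ u) (smaller (a ∷ u) y (λ ()) y≢ e)))
          where
          prepend : ∀ s {u v} → u ≺ v → s ++ u ≺ s ++ v
          prepend [] r = r
          prepend (b ∷ s) r = tail (prepend s r)

  -- Preorder traversal of the tree of nonempty words of length at most N: prefixes come before
  -- their extensions, which is the lexicographic order.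
  sortedWords : ℕ → List Word
  sortedWords zero = []
  sortedWords (suc N) = concatMap (λ a → [ a ] ∷ List.map (a ∷_) (sortedWords N)) (allFin k)

  ∈-sortedWords : ∀ N s → s ≢ [] → length s ℕ.≤ N → s ∈ sortedWords N
  ∈-sortedWords N [] s≢ le = ⊥-elim (s≢ ≡.refl)
  ∈-sortedWords (suc N) (a ∷ []) s≢ le = ∈-concatMap⁺ _ (lose (∈-allFin a) (Any.here ≡.refl))
  ∈-sortedWords (suc N) (a ∷ b ∷ s) s≢ (s≤s le) =
    ∈-concatMap⁺ _ (lose (∈-allFin a) (Any.there (∈-map⁺ (a ∷_) (∈-sortedWords N (b ∷ s) (λ ()) le))))

  sortedWords-nonempty : ∀ N → All (_≢ []) (sortedWords N)
  sortedWords-nonempty zero = []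
  sortedWords-nonempty (suc N) = Allₚ.concat⁺ (Allₚ.map⁺ (All.universal (λ a → (λ ()) ∷ Allₚ.map⁺ (All.universal (λ _ ()) _)) (allFin k)))

  sortedWords-sorted : ∀ N → AllPairs _≺_ (sortedWords N)
  sortedWords-sorted zero = []
  sortedWords-sorted (suc N) = AllPairsₚ.concat⁺
    (Allₚ.map⁺ (All.universal (λ a →
      Allₚ.map⁺ (All.map (λ {s} s≢ → ≺-++ [ a ] s≢) (sortedWords-nonempty N))
      ∷ AllPairsₚ.map⁺ (AllPairs.map tail (sortedWords-sorted N))) (allFin k)))
    (AllPairsₚ.map⁺ (AllPairsₚ.tabulate⁺-< (λ {a} {b} a<b →
      (letter a<b ∷ Allₚ.map⁺ (All.universal (λ _ → letter a<b) _))
      ∷ Allₚ.map⁺ (All.universal (λ _ → letter a<b ∷ Allₚ.map⁺ (All.universal (λ _ → letter a<b) _)) _))))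

  sortedWords-section : ∀ N → Section N (sortedWords N)
  sortedWords-section N = record
    { sorted = sortedWords-sorted N ; upper = λ s s≢ le → inj₁ (∈-sortedWords N s s≢ le) ; no-[] = sortedWords-nonempty N }

-- Factorization over the Lyndon words in a noncommutative ring

module LyndonFactorization {c ℓ : Level} (A : Ring c ℓ) {k : ℕ} (X : Fin k → Ring.Carrier A) where
  open Ring A hiding (zero)
  open RingProperties A
  open FiniteSums A
  open PS rawRing
  open PowerSeries A
  open LyndonWords k
  open SetoidReasoning setoid
  private
    module S = Ring seriesRing

  eval : Word → Carrier
  eval = foldr (λ a x → X a * x) 1#

  eval-++ : ∀ u v → eval (u ++ v) ≈ eval u * eval v
  eval-++ [] v = sym (*-identityˡ _)
  eval-++ (a ∷ u) v = trans (*-congˡ (eval-++ u v)) (sym (*-assoc _ _ _))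

  sumW : ℕ → (Word → Carrier) → Carrier
  sumW zero g = g []
  sumW (suc r) g = sum (λ a → sumW r (λ u → g (a ∷ u)))

  sumW-cong : ∀ r {g h : Word → Carrier} → (∀ u → length u ≡ r → g u ≈ h u) → sumW r g ≈ sumW r h
  sumW-cong zero p = p [] ≡.refl
  sumW-cong (suc r) p = sum-cong (λ a → sumW-cong r (λ u e → p (a ∷ u) (≡.cong suc e)))

  sumW-+ : ∀ r (g h : Word → Carrier) → sumW r (λ u → g u + h u) ≈ sumW r g + sumW r h
  sumW-+ zero g h = refl
  sumW-+ (suc r) g h = trans (sum-cong (λ a → sumW-+ r _ _)) (∑-+ _ _)

  sumW-*ˡ : ∀ r x (g : Word → Carrier) → sumW r (λ u → x * g u) ≈ x * sumW r g
  sumW-*ˡ zero x g = refl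
  sumW-*ˡ (suc r) x g = trans (sum-cong (λ a → sumW-*ˡ r x _)) (sym (*-∑ _ _))

  sumW-*ʳ : ∀ r x (g : Word → Carrier) → sumW r (λ u → g u * x) ≈ sumW r g * x
  sumW-*ʳ zero x g = refl
  sumW-*ʳ (suc r) x g = trans (sum-cong (λ a → sumW-*ʳ r x _)) (sym (∑-* _ _))

  sumW-0 : ∀ r {g : Word → Carrier} → (∀ u → length u ≡ r → g u ≈ 0#) → sumW r g ≈ 0#
  sumW-0 zero p = p [] ≡.refl
  sumW-0 (suc r) p = ∑-zero (λ a → sumW-0 r (λ u e → p (a ∷ u) (≡.cong suc e)))

  sumW-split : ∀ r s (g : Word → Carrier) → sumW (r ℕ.+ s) g ≈ sumW r (λ u → sumW s (λ v → g (u ++ v)))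
  sumW-split zero s g = refl
  sumW-split (suc r) s g = sum-cong (λ a → sumW-split r s (λ u → g (a ∷ u)))

  sumW-single : ∀ l {g : Word → Carrier} → (∀ v → length v ≡ length l → v ≢ l → g v ≈ 0#) → sumW (length l) g ≈ g l
  sumW-single [] p = refl
  sumW-single (a ∷ l) p = trans
    (∑-single a (λ b b≢a → sumW-0 (length l) (λ u e → p (b ∷ u) (≡.cong suc e) (λ q → b≢a (Listₚ.∷-injectiveˡ q)))))
    (sumW-single l (λ v e v≢l → p (a ∷ v) (≡.cong suc e) (λ q → v≢l (Listₚ.∷-injectiveʳ q))))

  _when_ : ∀ {p} {P : Set p} → Carrier → Dec P → Carrier
  x when d = if does d then x else 0#

  when-cong : ∀ {p q} {P : Set p} {Q : Set q} (d : Dec P) (e : Dec Q) → (P → Q) → (Q → P) → ∀ {x y} → x ≈ y → x when d ≈ y when e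
  when-cong (yes p) (yes q) f g h = h
  when-cong (no p) (no q) f g h = refl
  when-cong (yes p) (no q) f g h = ⊥-elim (q (f p))
  when-cong (no p) (yes q) f g h = ⊥-elim (p (g q))

  when-no : ∀ {p} {P : Set p} (d : Dec P) → ¬ P → ∀ {x} → x when d ≈ 0#
  when-no (yes p) q = ⊥-elim (q p)
  when-no (no _) q = refl

  when-yes : ∀ {p} {P : Set p} (d : Dec P) → P → ∀ {x} → x when d ≈ x
  when-yes (yes p) q = refl
  when-yes (no p) q = ⊥-elim (p q)

  when-* : ∀ {p} {P : Set p} (d : Dec P) {x y} → (x when d) * y ≈ (x * y) when d
  when-* (yes p) = refl
  when-* (no p) = zeroˡ _

  -- For the section that starts at l this represents the series b_l, up to t^N only: a section has
  -- no words longer than N, so longer words are never counted.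
  wordsOver : List Word → Series
  wordsOver ws r = sumW r (λ u → eval u when suffixesIn? ws u)

  lyndonFactor : Word → Series
  lyndonFactor l = if isLyndon l then 𝟙 ⊖ mono (eval l) (length l) else 𝟙

  module _ {N : ℕ} {l : Word} {ws : List Word} (sec : Section N (l ∷ ws)) where
    private
      b b' : Series
      b = wordsOver (l ∷ ws)
      b' = wordsOver ws

    wordsOver-not-lyndon : ¬ T (isLyndon l) → ∀ r → b r ≈ b' r
    wordsOver-not-lyndon ¬lyn r = sumW-cong r (λ u e → when-cong (suffixesIn? (l ∷ ws) u) (suffixesIn? ws u)
      (suffixesIn-not-lyndon sec u ¬lyn) (suffixesIn-weaken sec u) refl)

    -- The words lost when l leaves the list are the u l with u counted before.
    wordsOver-lyndon : Lyndon l → ∀ r → r ℕ.≤ N → b r ≈ (b ⊗ mono (eval l) (length l)) r + b' r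
    wordsOver-lyndon lyn r r≤N with r ℕₚ.<? length l
    ... | yes r<l = trans (sumW-cong r (λ u e → when-cong (suffixesIn? (l ∷ ws) u) (suffixesIn? ws u)
            (suffixesIn-short sec u (≡.subst (ℕ._< length l) (≡.sym e) r<l)) (suffixesIn-weaken sec u) refl))
          (sym (trans (+-congʳ (⊗-mono-< (eval l) (length l) b r r<l)) (+-identityˡ _)))
    ... | no r≮l = ≡.subst (λ r → b r ≈ (b ⊗ mono (eval l) (length l)) r + b' r) j+l≡r main
      where
      j : ℕ
      j = r ∸ length l
      j+l≡r : j ℕ.+ length l ≡ r
      j+l≡r = ℕₚ.m∸n+n≡m (ℕₚ.≮⇒≥ r≮l)
      only-l : Word → Word → Carrier
      only-l u v = ((eval u when suffixesIn? (l ∷ ws) u) * eval l) when Listₚ.≡-dec Finₚ._≟_ v l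
      pointwise : ∀ u v → length u ≡ j → length v ≡ length l →
        eval (u ++ v) when suffixesIn? (l ∷ ws) (u ++ v) ≈ only-l u v + eval (u ++ v) when suffixesIn? ws (u ++ v)
      pointwise u v eu ev with Listₚ.≡-dec Finₚ._≟_ v l
      ... | no v≢l = trans (when-cong (suffixesIn? (l ∷ ws) (u ++ v)) (suffixesIn? ws (u ++ v))
              (suffixesIn-++-other sec u v ev v≢l) (suffixesIn-weaken sec (u ++ v)) refl) (sym (+-identityˡ _))
      ... | yes ≡.refl = begin
        eval (u ++ l) when suffixesIn? (l ∷ ws) (u ++ l)
          ≈⟨ when-cong (suffixesIn? (l ∷ ws) (u ++ l)) (suffixesIn? (l ∷ ws) u)
               (suffixesIn-remove sec lyn u short) (suffixesIn-append sec lyn u short) (eval-++ u l) ⟩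
        (eval u * eval l) when suffixesIn? (l ∷ ws) u        ≈⟨ when-* (suffixesIn? (l ∷ ws) u) ⟨
        (eval u when suffixesIn? (l ∷ ws) u) * eval l        ≈⟨ +-identityʳ _ ⟨
        (eval u when suffixesIn? (l ∷ ws) u) * eval l + 0#   ≈⟨ +-congˡ (when-no (suffixesIn? ws (u ++ l)) (¬suffixesIn-tail sec u)) ⟨
        (eval u when suffixesIn? (l ∷ ws) u) * eval l + eval (u ++ l) when suffixesIn? ws (u ++ l) ∎
        where
        short : length (u ++ l) ℕ.≤ N
        short = ≡.subst (ℕ._≤ N) (≡.trans (≡.sym j+l≡r) (≡.trans (≡.cong (ℕ._+ length l) (≡.sym eu)) (≡.sym (Listₚ.length-++ u)))) r≤N
      at-l : ∀ u → sumW (length l) (only-l u) ≈ (eval u when suffixesIn? (l ∷ ws) u) * eval l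
      at-l u = trans (sumW-single l (λ v _ v≢l → when-no (Listₚ.≡-dec Finₚ._≟_ v l) v≢l)) (when-yes (Listₚ.≡-dec Finₚ._≟_ l l) ≡.refl)
      main : b (j ℕ.+ length l) ≈ (b ⊗ mono (eval l) (length l)) (j ℕ.+ length l) + b' (j ℕ.+ length l)
      main = begin
        b (j ℕ.+ length l) ≈⟨ sumW-split j (length l) _ ⟩
        sumW j (λ u → sumW (length l) (λ v → eval (u ++ v) when suffixesIn? (l ∷ ws) (u ++ v)))
          ≈⟨ sumW-cong j (λ u eu → trans (sumW-cong (length l) (λ v ev → pointwise u v eu ev)) (sumW-+ (length l) _ _)) ⟩
        sumW j (λ u → sumW (length l) (only-l u) + sumW (length l) (λ v → eval (u ++ v) when suffixesIn? ws (u ++ v)))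
          ≈⟨ sumW-+ j _ _ ⟩
        sumW j (λ u → sumW (length l) (only-l u)) + sumW j (λ u → sumW (length l) (λ v → eval (u ++ v) when suffixesIn? ws (u ++ v)))
          ≈⟨ +-cong (trans (sumW-cong j (λ u _ → at-l u)) (sumW-*ʳ j (eval l) _)) (sym (sumW-split j (length l) _)) ⟩
        b j * eval l + b' (j ℕ.+ length l)
          ≈⟨ +-congʳ (trans (reflexive (≡.cong (b ⊗ mono (eval l) (length l)) (ℕₚ.+-comm j (length l)))) (⊗-mono-+ (eval l) (length l) b j)) ⟨
        (b ⊗ mono (eval l) (length l)) (j ℕ.+ length l) + b' (j ℕ.+ length l) ∎

    wordsOver-factor : ∀ r → r ℕ.≤ N → (b ⊗ lyndonFactor l) r ≈ b' r
    wordsOver-factor r r≤N with T? (isLyndon l)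
    ... | yes t with isLyndon l in eq
    ... | true = begin
      (b ⊗ (𝟙 ⊖ mono (eval l) (length l))) r             ≈⟨ ⊗-distribˡ b 𝟙 (⊝ mono (eval l) (length l)) r ⟩
      (b ⊗ 𝟙) r + (b ⊗ (⊝ mono (eval l) (length l))) r   ≈⟨ +-cong (S.*-identityʳ b r) (sym (-distribʳ b (mono (eval l) (length l)) r)) ⟩
      b r - (b ⊗ mono (eval l) (length l)) r             ≈⟨ +-congʳ (trans (wordsOver-lyndon (isLyndon⇒Lyndon l (≡.subst T (≡.sym eq) t)) r r≤N) (+-comm _ _)) ⟩
      b' r + (b ⊗ mono (eval l) (length l)) r - (b ⊗ mono (eval l) (length l)) r ≈⟨ trans (+-assoc _ _ _) (trans (+-congˡ (-‿inverseʳ _)) (+-identityʳ _)) ⟩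
      b' r ∎
      where
      -distribʳ : ∀ f g → (⊝ (f ⊗ g)) ≈ₛ (f ⊗ (⊝ g))
      -distribʳ = RingProperties.-‿distribʳ-* seriesRing
    wordsOver-factor r r≤N | no ¬t with isLyndon l in eq
    ... | true = ⊥-elim (¬t tt)
    ... | false = trans (S.*-identityʳ b r) (wordsOver-not-lyndon (λ t → ≡.subst T eq t) r)

  lyndonProduct : List Word → Series
  lyndonProduct = foldr (λ l f → lyndonFactor l ⊗ f) 𝟙

  -- Each factor removes the head of the section. The empty section admits the empty word alone,
  -- whose series is 1.
  wordsOver-product : ∀ {N} ws → Section N ws → ∀ r → r ℕ.≤ N → (wordsOver ws ⊗ lyndonProduct ws) r ≈ 𝟙 r
  wordsOver-product [] sec r r≤N = trans (S.*-identityʳ (wordsOver []) r) (empty r)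
    where
    empty : ∀ r → wordsOver [] r ≈ 𝟙 r
    empty zero = refl
    empty (suc r) = ∑-zero (λ a → sumW-0 r (λ u _ → when-no (suffixesIn? [] (a ∷ u)) (λ { (() , _) }) {eval (a ∷ u)}))
  wordsOver-product {N} (l ∷ ws) sec r r≤N = begin
    (wordsOver (l ∷ ws) ⊗ (lyndonFactor l ⊗ lyndonProduct ws)) r  ≈⟨ S.*-assoc (wordsOver (l ∷ ws)) (lyndonFactor l) (lyndonProduct ws) r ⟨
    ((wordsOver (l ∷ ws) ⊗ lyndonFactor l) ⊗ lyndonProduct ws) r
      ≈⟨ ⊗-cong≤ r {g = lyndonProduct ws} (λ i i≤r → wordsOver-factor sec i (ℕₚ.≤-trans i≤r r≤N)) (λ _ _ → refl) ⟩
    (wordsOver ws ⊗ lyndonProduct ws) r                           ≈⟨ wordsOver-product ws (section-tail sec) r r≤N ⟩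
    𝟙 r ∎

  allWordsSum : Series
  allWordsSum r = sumW r eval

  letters : Carrier
  letters = sum X

  -- Splitting off the first letter of a nonempty word turns the sum over words of length r + 1 into
  -- `letters` times the sum over words of length r.
  geometric : ((𝟙 ⊖ mono letters 1) ⊗ allWordsSum) ≈ₛ 𝟙
  geometric r = trans (⊗-distribʳ allWordsSum 𝟙 (⊝ mono letters 1) r)
      (trans (+-cong (S.*-identityˡ allWordsSum r) (sym (RingProperties.-‿distribˡ-* seriesRing (mono letters 1) allWordsSum r))) (lem r))
    where
    lem : ∀ r → allWordsSum r - (mono letters 1 ⊗ allWordsSum) r ≈ 𝟙 r
    lem zero = trans (+-congˡ (trans (-‿cong (mono-⊗-zero letters 0 allWordsSum)) -0#≈0#)) (+-identityʳ _)
    lem (suc r) = trans (+-cong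
        (trans (sum-cong (λ a → sumW-*ˡ r (X a) eval)) (sym (∑-* _ _)))
        (-‿cong (trans (mono-⊗-suc letters 0 allWordsSum r) (const-⊗ letters allWordsSum r)))) (-‿inverseʳ _)

  wordsOver-sortedWords : ∀ N r → r ℕ.≤ N → wordsOver (sortedWords N) r ≈ allWordsSum r
  wordsOver-sortedWords N r r≤N = sumW-cong r (λ u e → when-yes (suffixesIn? (sortedWords N) u)
    (suffixesIn-intro u (λ p s s≢ eq → ∈-sortedWords N s s≢ (ℕₚ.≤-trans (≡.subst (length s ℕ.≤_)
        (≡.sym (≡.trans (≡.cong length eq) (Listₚ.length-++ p))) (ℕₚ.m≤n+m _ (length p))) (≡.subst (ℕ._≤ N) (≡.sym e) r≤N)))))

  -- The sum of all words has L as a left inverse and, up to t^N, the Lyndon product P as a right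
  -- inverse. Hence L = L (W P) = (L W) P = P to that order, with W the sum of all words.
  lyndon-factorization : ∀ N r → r ℕ.≤ N → (𝟙 ⊖ mono letters 1) r ≈ lyndonProduct (sortedWords N) r
  lyndon-factorization N r r≤N = begin
    L r                              ≈⟨ S.*-identityʳ L r ⟨
    (L ⊗ 𝟙) r                        ≈⟨ ⊗-cong≤ r {f = L} (λ _ _ → refl) (λ i i≤r → trans (sym (wordsOver-product (sortedWords N) (sortedWords-section N) i (ℕₚ.≤-trans i≤r r≤N)))
                                           (⊗-cong≤ i {g = P} (λ j j≤i → wordsOver-sortedWords N j (ℕₚ.≤-trans j≤i (ℕₚ.≤-trans i≤r r≤N))) (λ _ _ → refl))) ⟩
    (L ⊗ (allWordsSum ⊗ P)) r        ≈⟨ S.*-assoc L allWordsSum P r ⟨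
    ((L ⊗ allWordsSum) ⊗ P) r        ≈⟨ S.*-congʳ {P} geometric r ⟩
    (𝟙 ⊗ P) r                        ≈⟨ S.*-identityˡ P r ⟩
    P r                              ∎
    where
    L P : Series
    L = 𝟙 ⊖ mono letters 1
    P = lyndonProduct (sortedWords N)

-- From arcs to vertices

module Arcs (G : Graph) where
  open Graph G

  data Side : Arc → Set where
    forward  : ∀ k → Side (k ↑ˡ m)
    backward : ∀ k → Side (m ↑ʳ k)

  side : ∀ e → Side e
  side e with splitAt m e | Finₚ.join-splitAt m m e
  ... | inj₁ k | ≡.refl = forward k
  ... | inj₂ k | ≡.refl = backward k

  rev-↑ˡ : ∀ k → rev (k ↑ˡ m) ≡ m ↑ʳ k
  rev-↑ˡ k rewrite Finₚ.splitAt-↑ˡ m k m = ≡.refl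

  rev-↑ʳ : ∀ k → rev (m ↑ʳ k) ≡ k ↑ˡ m
  rev-↑ʳ k rewrite Finₚ.splitAt-↑ʳ m m k = ≡.refl

  arc-↑ˡ : ∀ k → arc (k ↑ˡ m) ≡ edge k
  arc-↑ˡ k rewrite Finₚ.splitAt-↑ˡ m k m = ≡.refl

  arc-↑ʳ : ∀ k → arc (m ↑ʳ k) ≡ swap (edge k)
  arc-↑ʳ k rewrite Finₚ.splitAt-↑ʳ m m k = ≡.refl

  rev-rev : ∀ e → rev (rev e) ≡ e
  rev-rev e with side e
  ... | forward k = ≡.trans (≡.cong rev (rev-↑ˡ k)) (rev-↑ʳ k)
  ... | backward k = ≡.trans (≡.cong rev (rev-↑ʳ k)) (rev-↑ˡ k)

  arc-rev : ∀ e → arc (rev e) ≡ swap (arc e)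
  arc-rev e with side e
  ... | forward k = ≡.trans (≡.cong arc (rev-↑ˡ k)) (≡.trans (arc-↑ʳ k) (≡.cong swap (≡.sym (arc-↑ˡ k))))
  ... | backward k = ≡.trans (≡.cong arc (rev-↑ʳ k)) (≡.trans (arc-↑ˡ k) (≡.cong swap (≡.sym (arc-↑ʳ k))))

  o-rev : ∀ e → o (rev e) ≡ t e
  o-rev e = ≡.cong proj₁ (arc-rev e)

  t-rev : ∀ e → t (rev e) ≡ o e
  t-rev e = ≡.cong proj₂ (arc-rev e)

  -- Arcs from opposite halves with the same ends would force k = l by `noMulti`; that edge would
  -- then equal its own reverse and be a loop.
  arc-injective : ∀ {e f} → arc e ≡ arc f → e ≡ f
  arc-injective {e} {f} eq with side e | side f
  ... | forward k | forward l = ≡.cong (_↑ˡ m) (noMulti k l (inj₁ (≡.trans (≡.sym (arc-↑ˡ k)) (≡.trans eq (arc-↑ˡ l)))))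
  ... | backward k | backward l = ≡.cong (m ↑ʳ_) (noMulti k l (inj₁ (≡.cong swap (≡.trans (≡.sym (arc-↑ʳ k)) (≡.trans eq (arc-↑ʳ l))))))
  ... | forward k | backward l = opposite (noMulti k l (inj₂ e'))
    where
    e' : edge k ≡ swap (edge l)
    e' = ≡.trans (≡.sym (arc-↑ˡ k)) (≡.trans eq (arc-↑ʳ l))
    opposite : ∀ {X : Set} → k ≡ l → X
    opposite ≡.refl with () ← noLoop k (≡.cong proj₁ e')
  ... | backward k | forward l = opposite (noMulti k l (inj₂ (≡.cong swap e')))
    where
    e' : swap (edge k) ≡ edge l
    e' = ≡.trans (≡.sym (arc-↑ʳ k)) (≡.trans eq (arc-↑ˡ l))
    opposite : ∀ {X : Set} → k ≡ l → X
    opposite ≡.refl with () ← noLoop k (≡.sym (≡.cong proj₁ e'))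

module Bass {c ℓ : Level} (H : Ring c ℓ) (C : CommutativeRing c ℓ) (split : Splitting H C)
    (G : Graph) (x φ⁻¹ : Graph.Arc G → Ring.Carrier H) where
  open Graph G
  open Arcs G
  open Ring H hiding (zero)
  open RingProperties H
  open FiniteSums H
  open Matrices H
  open StudyDeterminant H C split using (S; S-cong; S-⊡; S-𝐈; S-sylvester; S-orthogonal; ν; ν-cong; ν-1; prod; prod-cong)
  private
    module C = CommutativeRing C
    M = m ℕ.+ m

  φ : Arc → Carrier
  φ e = 1# - x e * x (rev e)

  J B : Mat M M
  J e f = x e * δ (rev e) f
  B e f = x e * δ (t e) (o f)

  -- The inverse of 𝐈 + J: as J² is diagonal with entries x e * x (rev e), the matrix 𝐈 - J² is the
  -- diagonal of φ, and (𝐈 + J)⁻¹ = (𝐈 - J²)⁻¹ (𝐈 - J). The inverses in `W̃` and `D̃` originate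
  -- here.
  Q : Mat M M
  Q e f = φ⁻¹ e * (δ e f - x e * δ (rev e) f)

  K : Mat M n
  K e v = x e * δ (t e) v

  L : Mat n M
  L u f = δ u (o f)

  private
    -- `a` is the part of J on the rows e_k and `b` the part on the reversed arcs. Both, and their
    -- product `ab`, are factored through m dimensions, so that `S-orthogonal` applies to them.
    U₁ U₂ : Mat M m
    U₁ e k = δ e (k ↑ˡ m)
    U₂ e k = δ e (m ↑ʳ k)
    V₁ V₂ V₃ : Mat m M
    V₁ k f = x (k ↑ˡ m) * δ (m ↑ʳ k) f
    V₂ k f = x (m ↑ʳ k) * δ (k ↑ˡ m) f
    V₃ k f = x (k ↑ˡ m) * x (m ↑ʳ k) * δ (k ↑ˡ m) f
    a b ab : Mat M M
    a = U₁ ⊡ V₁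
    b = U₂ ⊡ V₂
    ab = U₁ ⊡ V₃

    δ-lr : ∀ (i j : Fin m) → δ (i ↑ˡ m) (m ↑ʳ j) ≈ 0#
    δ-lr i j = δ-≢ (↑ˡ≢↑ʳ i j)
    δ-rl : ∀ (i j : Fin m) → δ (m ↑ʳ i) (j ↑ˡ m) ≈ 0#
    δ-rl i j = δ-≢ (λ e → ↑ˡ≢↑ʳ j i (≡.sym e))
    δ-ll : ∀ (i j : Fin m) → δ (i ↑ˡ m) (j ↑ˡ m) ≈ δ i j
    δ-ll = δ-injective (Finₚ.↑ˡ-injective m _ _)
    δ-rr : ∀ (i j : Fin m) → δ (m ↑ʳ i) (m ↑ʳ j) ≈ δ i j
    δ-rr = δ-injective (Finₚ.↑ʳ-injective m _ _)

    U₁-l : ∀ {q} (V : Mat m q) k f → (U₁ ⊡ V) (k ↑ˡ m) f ≈ V k f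
    U₁-l V k f = trans (sum-cong (λ j → *-congʳ (δ-ll k j))) (∑-δˡ k (λ j → V j f))
    U₁-r : ∀ {q} (V : Mat m q) k f → (U₁ ⊡ V) (m ↑ʳ k) f ≈ 0#
    U₁-r V k f = ∑-zero (λ j → trans (*-congʳ (δ-rl k j)) (zeroˡ _))
    U₂-r : ∀ {q} (V : Mat m q) k f → (U₂ ⊡ V) (m ↑ʳ k) f ≈ V k f
    U₂-r V k f = trans (sum-cong (λ j → *-congʳ (δ-rr k j))) (∑-δˡ k (λ j → V j f))
    U₂-l : ∀ {q} (V : Mat m q) k f → (U₂ ⊡ V) (k ↑ˡ m) f ≈ 0#
    U₂-l V k f = ∑-zero (λ j → trans (*-congʳ (δ-lr k j)) (zeroˡ _))

    at : ∀ {q} y (e : Arc) (N : Mat M q) f → sum (λ g → y * δ e g * N g f) ≈ y * N e f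
    at y e N f = trans (sum-cong (λ g → *-assoc _ _ _)) (trans (sym (*-∑ y _)) (*-congˡ (∑-δˡ e (λ g → N g f))))

    V₁-⊡ : ∀ {q} (N : Mat M q) k f → (V₁ ⊡ N) k f ≈ x (k ↑ˡ m) * N (m ↑ʳ k) f
    V₁-⊡ N k = at _ (m ↑ʳ k) N
    V₂-⊡ : ∀ {q} (N : Mat M q) k f → (V₂ ⊡ N) k f ≈ x (m ↑ʳ k) * N (k ↑ˡ m) f
    V₂-⊡ N k = at _ (k ↑ˡ m) N
    V₃-⊡ : ∀ {q} (N : Mat M q) k f → (V₃ ⊡ N) k f ≈ x (k ↑ˡ m) * x (m ↑ʳ k) * N (k ↑ˡ m) f
    V₃-⊡ N k = at _ (k ↑ˡ m) N

    J≋a+b : J ≋ a ⊞ b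
    J≋a+b e f with side e
    ... | forward k = trans (*-congˡ (reflexive (≡.cong (λ g → δ g f) (rev-↑ˡ k))))
            (sym (trans (+-cong (U₁-l V₁ k f) (U₂-l V₂ k f)) (+-identityʳ _)))
    ... | backward k = trans (*-congˡ (reflexive (≡.cong (λ g → δ g f) (rev-↑ʳ k))))
            (sym (trans (+-cong (U₁-r V₁ k f) (U₂-r V₂ k f)) (+-identityˡ _)))

    a² : a ⊡ a ≋ 𝟎
    a² e f = trans (⊡-assoc U₁ V₁ a e f) (∑-zero (λ k → trans (*-congˡ (trans (V₁-⊡ a k f) (trans (*-congˡ (U₁-r V₁ k f)) (zeroʳ _)))) (zeroʳ _)))
    b² : b ⊡ b ≋ 𝟎
    b² e f = trans (⊡-assoc U₂ V₂ b e f) (∑-zero (λ k → trans (*-congˡ (trans (V₂-⊡ b k f) (trans (*-congˡ (U₂-l V₂ k f)) (zeroʳ _)))) (zeroʳ _)))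
    a⊡b : a ⊡ b ≋ ab
    a⊡b e f = trans (⊡-assoc U₁ V₁ b e f) (sum-cong (λ k → *-congˡ (trans (V₁-⊡ b k f) (trans (*-congˡ (U₂-r V₂ k f)) (sym (*-assoc _ _ _))))))

    prod-1 : ∀ {k} {f : Fin k → C.Carrier} → (∀ i → f i C.≈ C.1#) → prod f C.≈ C.1#
    prod-1 {zero} p = C.refl
    prod-1 {suc k} p = C.trans (C.*-cong (p zero) (prod-1 (λ i → p (suc i)))) (C.*-identityˡ _)

    -- With the sign moved into V this is `S-orthogonal` for a vanishing product V U, and every norm
    -- factor is ν of 1.
    S-nilpotent : (U : Mat M m) (V : Mat m M) → V ⊡ U ≋ 𝟎 → S (𝐈 ⊞ U ⊡ V) C.≈ C.1#
    S-nilpotent U V z = C.trans (S-cong (λ e f → +-congˡ (sym (trans (-‿cong (trans (sum-cong (λ k → sym (-‿distribʳ-* _ _))) (∑-neg _))) (AGP.⁻¹-involutive +-abelianGroup _)))))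
      (C.trans (S-orthogonal U (⊟ V) (λ i j _ → zero' i j)) (prod-1 (λ i → C.trans (ν-cong (trans (+-congˡ (trans (-‿cong (zero' i i)) -0#≈0#)) (+-identityʳ _))) ν-1)))
      where
      zero' : ∀ i j → ((⊟ V) ⊡ U) i j ≈ 0#
      zero' i j = trans (sum-cong (λ k → sym (-‿distribˡ-* _ _))) (trans (∑-neg _) (trans (-‿cong (z i j)) -0#≈0#))

  -- In the factorization of 1 + (a + b) the outer factors have Study determinant 1. The middle one
  -- is diagonal, since going from e_k to its reverse and back stays on the edge k.
  S-𝐈+J : S (𝐈 ⊞ J) C.≈ prod (λ k → ν (φ (k ↑ˡ m)))
  S-𝐈+J = begin
    S (𝐈 ⊞ J) ≈⟨ S-cong (λ e f → trans (+-congˡ (J≋a+b e f)) (sym (RingIdentities.nilpotent-factorization (matrixRing M) a b a² b² e f))) ⟩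
    S (((𝐈 ⊞ a) ⊡ (𝐈 ⊞ ⊟ (a ⊡ b))) ⊡ (𝐈 ⊞ b)) ≈⟨ C.trans (S-⊡ _ _) (C.*-congʳ (S-⊡ _ _)) ⟩
    S (𝐈 ⊞ a) C.* S (𝐈 ⊞ ⊟ (a ⊡ b)) C.* S (𝐈 ⊞ b)
      ≈⟨ C.*-cong (C.*-cong (S-nilpotent U₁ V₁ (λ i j → trans (V₁-⊡ U₁ i j) (trans (*-congˡ (δ-rl i j)) (zeroʳ _)))) (S-cong (λ e f → +-congˡ (-‿cong (a⊡b e f)))))
           (S-nilpotent U₂ V₂ (λ i j → trans (V₂-⊡ U₂ i j) (trans (*-congˡ (δ-lr i j)) (zeroʳ _)))) ⟩
    C.1# C.* S (𝐈 ⊞ ⊟ ab) C.* C.1# ≈⟨ C.trans (C.*-identityʳ _) (C.*-identityˡ _) ⟩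
    S (𝐈 ⊞ ⊟ ab) ≈⟨ S-orthogonal U₁ V₃ (λ i j i≢j → trans (V₃-⊡ U₁ i j) (trans (*-congˡ (trans (δ-ll i j) (δ-≢ i≢j))) (zeroʳ _))) ⟩
    prod (λ k → ν (1# - (V₃ ⊡ U₁) k k)) ≈⟨ prod-cong (λ k → ν-cong (+-congˡ (-‿cong (trans (V₃-⊡ U₁ k k) (trans (*-congˡ (trans (δ-ll k k) (δ-refl k)))
        (trans (*-identityʳ _) (*-congˡ (reflexive (≡.cong x (≡.sym (rev-↑ˡ k)))))))))))  ⟩
    prod (λ k → ν (φ (k ↑ˡ m))) ∎
    where open SetoidReasoning C.setoid

  module _ (φ⁻¹-inverse : ∀ e → φ⁻¹ e * φ e ≈ 1#) where
    open SetoidReasoning setoid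

    Q-⊡ : ∀ {q} (N : Mat M q) e f → (Q ⊡ N) e f ≈ φ⁻¹ e * (N e f - x e * N (rev e) f)
    Q-⊡ N e f = begin
      sum (λ g → φ⁻¹ e * (δ e g - x e * δ (rev e) g) * N g f) ≈⟨ sum-cong (λ g → *-assoc _ _ _) ⟩
      sum (λ g → φ⁻¹ e * ((δ e g - x e * δ (rev e) g) * N g f)) ≈⟨ *-∑ _ _ ⟨
      φ⁻¹ e * sum (λ g → (δ e g - x e * δ (rev e) g) * N g f)
        ≈⟨ *-congˡ (trans (sum-cong (λ g → trans (distribʳ _ _ _) (+-congˡ (sym (-‿distribˡ-* _ _))))) (trans (∑-+ _ _) (+-cong (∑-δˡ e (λ g → N g f)) (trans (∑-neg _) (-‿cong (at (x e) (rev e) N f)))))) ⟩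
      φ⁻¹ e * (N e f - x e * N (rev e) f) ∎

    Q-inverse : Q ⊡ (𝐈 ⊞ J) ≋ 𝐈
    Q-inverse e f = begin
      (Q ⊡ (𝐈 ⊞ J)) e f ≈⟨ Q-⊡ (𝐈 ⊞ J) e f ⟩
      φ⁻¹ e * ((δ e f + x e * δ (rev e) f) - x e * (δ (rev e) f + x (rev e) * δ (rev (rev e)) f))
        ≈⟨ *-congˡ (trans (+-assoc _ _ _) (+-congˡ (trans (+-congˡ (trans (-‿cong (distribˡ _ _ _)) (sym (⁻¹-∙-comm _ _)))) (trans (sym (+-assoc _ _ _)) (trans (+-congʳ (-‿inverseʳ _)) (+-identityˡ _)))))) ⟩
      φ⁻¹ e * (δ e f - x e * (x (rev e) * δ (rev (rev e)) f))
        ≈⟨ *-congˡ (+-cong (sym (*-identityˡ _)) (trans (-‿cong (trans (*-congˡ (*-congˡ (reflexive (≡.cong (λ g → δ g f) (rev-rev e))))) (sym (*-assoc _ _ _)))) (-‿distribˡ-* _ _))) ⟩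
      φ⁻¹ e * (1# * δ e f + - (x e * x (rev e)) * δ e f) ≈⟨ *-congˡ (distribʳ _ _ _) ⟨
      φ⁻¹ e * (φ e * δ e f) ≈⟨ *-assoc _ _ _ ⟨
      φ⁻¹ e * φ e * δ e f ≈⟨ trans (*-congʳ (φ⁻¹-inverse e)) (*-identityˡ _) ⟩
      δ e f ∎
      where open AGP +-abelianGroup using (⁻¹-∙-comm)

    B≋K⊡L : B ≋ K ⊡ L
    B≋K⊡L e f = sym (trans (sum-cong (λ v → *-assoc _ _ _)) (trans (sym (*-∑ _ _)) (*-congˡ (∑-δˡ (t e) (λ v → δ v (o f))))))

    Q-M : Q ⊡ (𝐈 ⊞ ⊟ (B ⊞ ⊟ J)) ≋ 𝐈 ⊞ ⊟ ((Q ⊡ K) ⊡ L)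
    Q-M e f = begin
      (Q ⊡ (𝐈 ⊞ ⊟ (B ⊞ ⊟ J))) e f ≈⟨ ⊡-cong {M = Q} {Q} (λ _ _ → refl) regroup e f ⟩
      (Q ⊡ ((𝐈 ⊞ J) ⊞ ⊟ B)) e f ≈⟨ ⊡-distribˡ Q (𝐈 ⊞ J) (⊟ B) e f ⟩
      (Q ⊡ (𝐈 ⊞ J)) e f + (Q ⊡ (⊟ B)) e f
        ≈⟨ +-cong (Q-inverse e f) (trans (sum-cong (λ g → sym (-‿distribʳ-* _ _))) (trans (∑-neg _)
             (-‿cong (trans (sum-cong (λ g → *-congˡ (B≋K⊡L g f))) (sym (⊡-assoc Q K L e f)))))) ⟩
      (𝐈 ⊞ ⊟ ((Q ⊡ K) ⊡ L)) e f ∎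
      where
      open AGP +-abelianGroup using (⁻¹-∙-comm; ⁻¹-involutive)
      regroup : 𝐈 ⊞ ⊟ (B ⊞ ⊟ J) ≋ (𝐈 ⊞ J) ⊞ ⊟ B
      regroup e f = trans (+-congˡ (trans (sym (⁻¹-∙-comm _ _)) (trans (+-comm _ _) (+-congʳ (⁻¹-involutive _))))) (sym (+-assoc _ _ _))

    bass : S (𝐈 ⊞ ⊟ (B ⊞ ⊟ J)) C.≈ S (𝐈 ⊞ ⊟ (L ⊡ (Q ⊡ K))) C.* prod (λ k → ν (φ (k ↑ˡ m)))
    bass = CR.begin
      S M′ CR.≈⟨ C.*-identityˡ _ ⟨
      -- The factor 1 is written as S (𝐈 + J) S Q. Then S Q combines with S M′ into the determinant
      -- that goes down to the vertices, and S (𝐈 + J) remains as the product over edges.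
      C.1# C.* S M′ CR.≈⟨ C.*-congʳ (C.trans (C.sym (S-𝐈 M)) (C.trans (S-cong (λ e f → sym (Q-inverse e f))) (C.trans (S-⊡ Q (𝐈 ⊞ J)) (C.*-comm _ _)))) ⟩
      (S (𝐈 ⊞ J) C.* S Q) C.* S M′ CR.≈⟨ C.*-assoc _ _ _ ⟩
      S (𝐈 ⊞ J) C.* (S Q C.* S M′) CR.≈⟨ C.*-congˡ (C.sym (S-⊡ Q M′)) ⟩
      S (𝐈 ⊞ J) C.* S (Q ⊡ M′) CR.≈⟨ C.*-cong S-𝐈+J (C.trans (S-cong Q-M) (S-sylvester (Q ⊡ K) L)) ⟩
      prod (λ k → ν (φ (k ↑ˡ m))) C.* S (𝐈 ⊞ ⊟ (L ⊡ (Q ⊡ K))) CR.≈⟨ C.*-comm _ _ ⟩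
      S (𝐈 ⊞ ⊟ (L ⊡ (Q ⊡ K))) C.* prod (λ k → ν (φ (k ↑ˡ m))) CR.∎
      where
      module CR = SetoidReasoning C.setoid
      M′ : Mat M M
      M′ = 𝐈 ⊞ ⊟ (B ⊞ ⊟ J)

    L-Q-K : ∀ u v → (L ⊡ (Q ⊡ K)) u v ≈ sum (λ e → δ u (o e) * (φ⁻¹ e * (x e * δ (t e) v - x e * (x (rev e) * δ (o e) v))))
    L-Q-K u v = sum-cong (λ e → *-congˡ (trans (Q-⊡ K e v)
      (*-congˡ (+-congˡ (-‿cong (*-congˡ (*-congˡ (reflexive (≡.cong (λ w → δ w v) (t-rev e))))))))))

module VertexMatrix {c ℓ : Level} (H : Ring c ℓ) (G : Graph) where
  open Graph G
  open Arcs G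
  open Ring H hiding (zero)
  open RingProperties H
  open FiniteSums H
  open SetoidReasoning setoid

  private
    match : ∀ u v e → T (does (o e Finₚ.≟ u) ∧ does (t e Finₚ.≟ v)) → arc e ≡ (u , v)
    match u v e p with o e Finₚ.≟ u | t e Finₚ.≟ v
    ... | yes ≡.refl | yes ≡.refl = ≡.refl

    match⁻¹ : ∀ e → T (does (o e Finₚ.≟ o e) ∧ does (t e Finₚ.≟ t e))
    match⁻¹ e rewrite dec-true (o e Finₚ.≟ o e) ≡.refl | dec-true (t e Finₚ.≟ t e) ≡.refl = _

  isArc⇒arc : ∀ u v → T (isArc u v) → ∃ λ e → arc e ≡ (u , v)
  isArc⇒arc u v p with find (Anyₚ.any⁻ _ (allFin _) p)
  ... | e , _ , q = e , match u v e q

  arc⇒isArc : ∀ e → T (isArc (o e) (t e))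
  arc⇒isArc e = Anyₚ.any⁺ _ (lose (∈-allFin e) (match⁻¹ e))

  -- By `arc-injective` at most one summand survives, and `isArc` tells whether there is one.
  ∑-arcs-between : ∀ (y : Fin n → Fin n → Carrier) u v →
    sum (λ e → δ u (o e) * (y (o e) (t e) * δ (t e) v)) ≈ (if isArc u v then y u v else 0#)
  ∑-arcs-between y u v with isArc u v in eq
  ... | true with isArc⇒arc u v (Equivalence.from T-≡ eq)
  ... | e₀ , p = trans (∑-single e₀ other) (trans (*-cong (reflexive (≡.cong (λ w → δ u (proj₁ w)) p)) (*-cong (reflexive (≡.cong (λ w → y (proj₁ w) (proj₂ w)) p)) (reflexive (≡.cong (λ w → δ (proj₂ w) v) p))))
        (trans (*-cong (δ-refl u) (*-congˡ (δ-refl v))) (trans (*-identityˡ _) (*-identityʳ _))))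
    where
    other : ∀ e → e ≢ e₀ → δ u (o e) * (y (o e) (t e) * δ (t e) v) ≈ 0#
    other e e≢ with u Finₚ.≟ o e | t e Finₚ.≟ v
    ... | no _ | _ = zeroˡ _
    ... | yes _ | no _ = trans (*-congˡ (zeroʳ _)) (zeroʳ _)
    ... | yes ≡.refl | yes ≡.refl = ⊥-elim (e≢ (arc-injective (≡.sym p)))
  ∑-arcs-between y u v | false = ∑-zero none
    where
    none : ∀ e → δ u (o e) * (y (o e) (t e) * δ (t e) v) ≈ 0#
    none e with u Finₚ.≟ o e | t e Finₚ.≟ v
    ... | no _ | _ = zeroˡ _
    ... | yes _ | no _ = trans (*-congˡ (zeroʳ _)) (zeroʳ _)
    ... | yes ≡.refl | yes ≡.refl = ⊥-elim (≡.subst T eq (arc⇒isArc e))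

  -- An arc followed by its reverse returns to its origin, so these terms form a diagonal matrix;
  -- they become `D̃`.
  ∑-arcs-from : ∀ (z : Arc → Carrier) u v →
    sum (λ e → δ u (o e) * (z e * δ (o e) v)) ≈ (if does (u Finₚ.≟ v) then sum (λ e → if does (o e Finₚ.≟ u) then z e else 0#) else 0#)
  ∑-arcs-from z u v with u Finₚ.≟ v
  ... | yes ≡.refl = sum-cong same
    where
    same : ∀ e → δ u (o e) * (z e * δ (o e) u) ≈ (if does (o e Finₚ.≟ u) then z e else 0#)
    same e with o e Finₚ.≟ u
    ... | no _ = trans (*-congˡ (zeroʳ _)) (zeroʳ _)
    ... | yes ≡.refl = trans (*-cong (δ-refl (o e)) (*-identityʳ _)) (*-identityˡ _)
  ... | no u≢v = ∑-zero diff
    where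
    diff : ∀ e → δ u (o e) * (z e * δ (o e) v) ≈ 0#
    diff e with u Finₚ.≟ o e
    ... | no _ = zeroˡ _
    ... | yes ≡.refl = trans (*-congˡ (trans (*-congˡ (δ-≢ u≢v)) (zeroʳ _))) (zeroʳ _)

  module _ (τ : Carrier) (τ-central : ∀ z → τ * z ≈ z * τ) (w φ⁻¹ : Arc → Carrier) (y : Fin n → Fin n → Carrier)
      (y-arc : ∀ e → φ⁻¹ e * w e ≈ y (o e) (t e)) where

    private
      x : Arc → Carrier
      x e = τ * w e

      z : Arc → Carrier
      z e = φ⁻¹ e * (w e * w (rev e))

      pull : ∀ p q → p * (τ * q) ≈ τ * (p * q)
      pull p q = trans (sym (*-assoc _ _ _)) (trans (*-congʳ (sym (τ-central p))) (*-assoc _ _ _))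

      term : ∀ u v e → δ u (o e) * (φ⁻¹ e * (x e * δ (t e) v - x e * (x (rev e) * δ (o e) v))) ≈
        τ * (δ u (o e) * (y (o e) (t e) * δ (t e) v)) - τ * τ * (δ u (o e) * (z e * δ (o e) v))
      term u v e = begin
        δ u (o e) * (φ⁻¹ e * (x e * δ (t e) v - x e * (x (rev e) * δ (o e) v)))
          ≈⟨ trans (*-congˡ (trans (distribˡ _ _ _) (+-congˡ (sym (-‿distribʳ-* _ _))))) (trans (distribˡ _ _ _) (+-congˡ (sym (-‿distribʳ-* _ _)))) ⟩
        δ u (o e) * (φ⁻¹ e * (x e * δ (t e) v)) - δ u (o e) * (φ⁻¹ e * (x e * (x (rev e) * δ (o e) v)))
          ≈⟨ +-cong first (-‿cong second) ⟩
        τ * (δ u (o e) * (y (o e) (t e) * δ (t e) v)) - τ * τ * (δ u (o e) * (z e * δ (o e) v)) ∎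
        where
        first : δ u (o e) * (φ⁻¹ e * (x e * δ (t e) v)) ≈ τ * (δ u (o e) * (y (o e) (t e) * δ (t e) v))
        first = trans (*-congˡ (trans (*-congˡ (*-assoc _ _ _)) (trans (pull _ _) (*-congˡ (trans (sym (*-assoc _ _ _)) (*-congʳ (y-arc e))))))) (pull _ _)
        second : δ u (o e) * (φ⁻¹ e * (x e * (x (rev e) * δ (o e) v))) ≈ τ * τ * (δ u (o e) * (z e * δ (o e) v))
        second = begin
          δ u (o e) * (φ⁻¹ e * (x e * (x (rev e) * δ (o e) v)))
            ≈⟨ *-congˡ (*-congˡ (trans (*-assoc _ _ _) (*-congˡ (trans (*-congˡ (*-assoc _ _ _)) (pull _ _))))) ⟩
          δ u (o e) * (φ⁻¹ e * (τ * (τ * (w e * (w (rev e) * δ (o e) v)))))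
            ≈⟨ *-congˡ (trans (pull _ _) (*-congˡ (pull _ _))) ⟩
          δ u (o e) * (τ * (τ * (φ⁻¹ e * (w e * (w (rev e) * δ (o e) v)))))
            ≈⟨ trans (pull _ _) (*-congˡ (pull _ _)) ⟩
          τ * (τ * (δ u (o e) * (φ⁻¹ e * (w e * (w (rev e) * δ (o e) v)))))
            ≈⟨ sym (*-assoc _ _ _) ⟩
          τ * τ * (δ u (o e) * (φ⁻¹ e * (w e * (w (rev e) * δ (o e) v))))
            ≈⟨ *-congˡ (*-congˡ (trans (*-congˡ (sym (*-assoc _ _ _))) (sym (*-assoc _ _ _)))) ⟩
          τ * τ * (δ u (o e) * (z e * δ (o e) v)) ∎

    vertex-entry : ∀ u v →
      sum (λ e → δ u (o e) * (φ⁻¹ e * (x e * δ (t e) v - x e * (x (rev e) * δ (o e) v)))) ≈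
      τ * (if isArc u v then y u v else 0#)
      - τ * τ * (if does (u Finₚ.≟ v) then sum (λ e → if does (o e Finₚ.≟ u) then z e else 0#) else 0#)
    vertex-entry u v = begin
      sum (λ e → δ u (o e) * (φ⁻¹ e * (x e * δ (t e) v - x e * (x (rev e) * δ (o e) v)))) ≈⟨ sum-cong (term u v) ⟩
      sum (λ e → τ * (δ u (o e) * (y (o e) (t e) * δ (t e) v)) - τ * τ * (δ u (o e) * (z e * δ (o e) v)))
        ≈⟨ trans (∑-+ _ _) (+-cong (sym (*-∑ _ _)) (trans (∑-neg _) (-‿cong (sym (*-∑ _ _))))) ⟩
      τ * sum (λ e → δ u (o e) * (y (o e) (t e) * δ (t e) v)) - τ * τ * sum (λ e → δ u (o e) * (z e * δ (o e) v))
        ≈⟨ +-cong (*-congˡ (∑-arcs-between y u v)) (-‿cong (*-congˡ (∑-arcs-from z u v))) ⟩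
      τ * (if isArc u v then y u v else 0#)
        - τ * τ * (if does (u Finₚ.≟ v) then sum (λ e → if does (o e Finₚ.≟ u) then z e else 0#) else 0#) ∎

    -- The sign of the t² term is plus because the second summand of `vertex-entry`, which comes
    -- from the -J in Q, is subtracted twice.
    vertex-matrix : ∀ u v {s d τ₂} →
      s ≈ sum (λ e → δ u (o e) * (φ⁻¹ e * (x e * δ (t e) v - x e * (x (rev e) * δ (o e) v)))) → τ * τ ≈ τ₂ →
      (if does (u Finₚ.≟ v) then sum (λ e → if does (o e Finₚ.≟ u) then z e else 0#) else 0#) ≈ d →
      δ u v - s ≈ (δ u v - τ * (if isArc u v then y u v else 0#)) + τ₂ * d
    vertex-matrix u v {s} {d} {τ₂} p q r = begin
      δ u v - s                            ≈⟨ +-congˡ (-‿cong (trans p (trans (vertex-entry u v) (+-congˡ (-‿cong (*-cong q r)))))) ⟩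
      δ u v - (τ * W - τ₂ * d)             ≈⟨ +-congˡ (trans (sym (⁻¹-∙-comm _ _)) (+-congˡ (⁻¹-involutive _))) ⟩
      δ u v + (- (τ * W) + τ₂ * d)         ≈⟨ +-assoc _ _ _ ⟨
      (δ u v - τ * W) + τ₂ * d             ∎
      where
      open AGP +-abelianGroup using (⁻¹-∙-comm; ⁻¹-involutive)
      W = if isArc u v then y u v else 0#

module EdgeToVertex {c ℓ : Level} (H : Ring c ℓ) (C : CommutativeRing c ℓ) (split : Splitting H C) (G : Graph)
    (τ : Ring.Carrier H) (w φ⁻¹ : Graph.Arc G → Ring.Carrier H) where
  open Graph G
  open Arcs G
  open Ring H hiding (zero)
  open FiniteSums H
  open Matrices H
  open StudyDeterminant H C split using (S; S-cong; ν; ν-cong; prod; prod-cong)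
  private
    module C = CommutativeRing C
    x : Arc → Carrier
    x e = τ * w e
    module B = Bass H C split G x φ⁻¹

  -- The concrete series enter only through equations, so the passage from arcs to vertices is
  -- carried out in an arbitrary ring with a central element τ.
  edge-to-vertex : (∀ z → τ * z ≈ z * τ) →
    (φ : Arc → Carrier) → (∀ e → φ e ≈ 1# - (τ * w e) * (τ * w (rev e))) → (∀ e → φ⁻¹ e * φ e ≈ 1#) →
    (y : Fin n → Fin n → Carrier) → (∀ e → φ⁻¹ e * w e ≈ y (o e) (t e)) →
    (d : Arc → Carrier) → (∀ e → φ⁻¹ e * (w e * w (rev e)) ≈ d e) →
    (W D M : Mat n n) (τ₂ : Carrier) → τ * τ ≈ τ₂ →
    (∀ u v → W u v ≈ (if isArc u v then y u v else 0#)) →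
    (∀ u v → D u v ≈ (if does (u Finₚ.≟ v) then sum (λ e → if does (o e Finₚ.≟ u) then d e else 0#) else 0#)) →
    (∀ u v → M u v ≈ (δ u v - τ * W u v) + τ₂ * D u v) →
    (E : Mat (m ℕ.+ m) (m ℕ.+ m)) → (∀ e f → E e f ≈ τ * w e * δ (t e) (o f) - τ * w e * δ (rev e) f) →
    S (𝐈 ⊞ ⊟ E) C.≈ S M C.* prod (λ k → ν (φ (k ↑ˡ m)))
  edge-to-vertex central φ φ-eq φ⁻¹-φ y y-arc d d-eq W D M τ₂ ττ W-eq D-eq M-eq E E-eq =
    C.trans (S-cong (λ e f → +-congˡ (-‿cong (E-eq e f))))
      (C.trans (B.bass inverse) (C.*-cong (S-cong main) (prod-cong (λ k → ν-cong (sym (φ-eq (k ↑ˡ m)))))))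
    where
    inverse : ∀ e → φ⁻¹ e * B.φ e ≈ 1#
    inverse e = trans (*-congˡ (sym (φ-eq e))) (φ⁻¹-φ e)
    D-sum : ∀ u v → (if does (u Finₚ.≟ v) then sum (λ e → if does (o e Finₚ.≟ u) then φ⁻¹ e * (w e * w (rev e)) else 0#) else 0#) ≈ D u v
    D-sum u v = trans (choose (does (u Finₚ.≟ v)) (sum-cong (λ e → choose (does (o e Finₚ.≟ u)) (d-eq e)))) (sym (D-eq u v))
      where
      choose : ∀ b {p q} → p ≈ q → (if b then p else 0#) ≈ (if b then q else 0#)
      choose true e = e
      choose false e = refl
    main : (𝐈 ⊞ ⊟ (B.L ⊡ (B.Q ⊡ B.K))) ≋ M
    main u v = trans (VertexMatrix.vertex-matrix H G τ central w φ⁻¹ y y-arc u v (B.L-Q-K inverse u v) ττ (D-sum u v))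
      (trans (+-congʳ (+-congˡ (-‿cong (*-congˡ (sym (W-eq u v)))))) (sym (M-eq u v)))

-- Quaternionic power series

module SumToMap {c ℓ : Level} (A B : Ring c ℓ) (h : Ring.Carrier A → Ring.Carrier B) where
  private
    module A = Ring A
    module B = Ring B
    module PA = PS A.rawRing
    module PB = PS B.rawRing

  sumTo-map : (∀ x y → h (x A.+ y) B.≈ h x B.+ h y) → h A.0# B.≈ B.0# →
    ∀ n f → h (PA.sumTo n f) B.≈ PB.sumTo n (λ i → h (f i))
  sumTo-map h-+ h-0 zero f = h-0
  sumTo-map h-+ h-0 (suc n) f = B.trans (h-+ _ _) (B.+-congʳ (sumTo-map h-+ h-0 n f))

module QuaternionSeries {c ℓ : Level} (R : CommutativeRing c ℓ) where
  open Over R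
  open Quaternions R
  private
    module ℂ′ = CommutativeRing ℂ-commutativeRing
    module ℍ′ = Ring ℍ-ring
    module PC = PowerSeries ℂ′.ring
    module PH = PowerSeries ℍ-ring

  Hser : Ring c ℓ
  Hser = PH.seriesRing

  Cser : CommutativeRing c ℓ
  Cser = CommutativeSeries.seriesCommutativeRing ℂ-commutativeRing

  private
    module C = CommutativeRing Cser
    module R′ = CommutativeRing R

  σ π : Hs.Series → Cs.Series
  σ f r = partS (f r)
  π f r = partP (f r)

  κ : Cs.Series → Cs.Series
  κ f r = conj (f r)

  ι : Cs.Series → Hs.Series
  ι f r = ofℂ (f r)

  private
    partP-0 : partP ℍ′.0# ℂ′.≈ ℂ′.0#
    partP-0 = partP-1
    conj-0 : conj ℂ′.0# ℂ′.≈ ℂ′.0#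
    conj-0 = partP-1

    sumTo-neg : ∀ n f → Cs.sumTo n (λ i → ℂ′.- f i) ℂ′.≈ (ℂ′.- Cs.sumTo n f)
    sumTo-neg zero f = ℂ′.sym (RingProperties.-0#≈0# ℂ′.ring)
    sumTo-neg (suc n) f = ℂ′.trans (ℂ′.+-congʳ (sumTo-neg n f)) (AGP.⁻¹-∙-comm ℂ′.+-abelianGroup _ _)

  σ-⊗ : ∀ f g → σ (f Hs.⊗ g) Cs.≈ₛ ((σ f Cs.⊗ σ g) Cs.⊖ (κ (π f) Cs.⊗ π g))
  σ-⊗ f g k = ℂ′.trans (SumToMap.sumTo-map ℍ-ring ℂ′.ring partS partS-+ ℂ′.refl (suc k) (λ i → f i ℍ′.* g (k ∸ i)))
    (ℂ′.trans (PC.sumTo-cong≤ (suc k) (λ i _ → partS-* (f i) (g (k ∸ i))))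
    (ℂ′.trans (PC.sumTo-+ (suc k) (λ i → partS (f i) ℂ′.* partS (g (k ∸ i))) _)
    (ℂ′.+-congˡ (sumTo-neg (suc k) (λ i → conj (partP (f i)) ℂ′.* partP (g (k ∸ i)))))))

  π-⊗ : ∀ f g → π (f Hs.⊗ g) Cs.≈ₛ ((π f Cs.⊗ σ g) Cs.⊕ (κ (σ f) Cs.⊗ π g))
  π-⊗ f g k = ℂ′.trans (SumToMap.sumTo-map ℍ-ring ℂ′.ring partP partP-+ partP-0 (suc k) (λ i → f i ℍ′.* g (k ∸ i)))
    (ℂ′.trans (PC.sumTo-cong≤ (suc k) (λ i _ → partP-* (f i) (g (k ∸ i))))
    (PC.sumTo-+ (suc k) (λ i → partP (f i) ℂ′.* partS (g (k ∸ i))) _))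

  κ-⊗ : ∀ f g → κ (f Cs.⊗ g) Cs.≈ₛ (κ f Cs.⊗ κ g)
  κ-⊗ f g k = ℂ′.trans (SumToMap.sumTo-map ℂ′.ring ℂ′.ring conj conj-+ conj-0 (suc k) (λ i → f i ℂ′.* g (k ∸ i)))
    (PC.sumTo-cong≤ (suc k) (λ i _ → conj-* (f i) (g (k ∸ i))))

  splitting : Splitting Hser Cser
  splitting = record
    { σ = σ ; π = π ; κ = κ
    ; σ-cong = λ p k → partS-cong (p k)
    ; π-cong = λ p k → partP-cong (p k)
    ; κ-cong = λ p k → conj-cong (p k)
    ; σ-+ = λ f g k → partS-+ (f k) (g k)
    ; π-+ = λ f g k → partP-+ (f k) (g k)
    ; κ-+ = λ f g k → conj-+ (f k) (g k)
    ; κ-* = κ-⊗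
    ; κ-involutive = λ f k → conj-involutive (f k)
    ; σ-* = σ-⊗
    ; π-* = π-⊗
    ; σ-1 = λ { zero → ℂ′.refl ; (suc k) → ℂ′.refl }
    ; π-1 = λ { zero → partP-1 ; (suc k) → partP-0 }
    ; κ-1 = λ { zero → partP-1′ ; (suc k) → conj-0 } }
    where
    partP-1′ : conj ℂ′.1# ℂ′.≈ ℂ′.1#
    partP-1′ = R′.refl , AGP.ε⁻¹≈ε R′.+-abelianGroup

  module Study = StudyDeterminant Hser Cser splitting
  open Study
  open Determinants Cser using (D; D-cong; det≈D; minor; sgn)

  Sdet≈S : ∀ {k} (M : Fin k → Fin k → Hs.Series) → Sdet M Cs.≈ₛ S M
  Sdet≈S {k} M = C.trans (det≈D (ψt M)) (C.trans (D-cong same) (C.reflexive (≡.sym (S≡D-ψ M))))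
    where
    same : ∀ a b → ψt M a b C.≈ ψ M a b
    same a b with splitAt k a | splitAt k b
    ... | inj₁ u | inj₁ v = C.refl {λ r → partS (M u v r)}
    ... | inj₁ u | inj₂ v = C.refl {λ r → ℂ′.- conj (partP (M u v r))}
    ... | inj₂ u | inj₁ v = C.refl {λ r → partP (M u v r)}
    ... | inj₂ u | inj₂ v = C.refl {λ r → conj (partS (M u v r))}

  series-injective : ∀ {f g} → σ f Cs.≈ₛ σ g → π f Cs.≈ₛ π g → f Hs.≈ₛ g
  series-injective p q k = parts-injective (p k) (q k)

  π-ι : ∀ f → π (ι f) Cs.≈ₛ Cs.𝟘
  π-ι f k = ℂ′.trans (partP-ofℂ (f k)) (ℂ′.sym (PC.𝟘≈0 k))

  ι-cong : ∀ {f g} → f Cs.≈ₛ g → ι f Hs.≈ₛ ι g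
  ι-cong p k = ofℂ-cong (p k)

  -- Both sides are compared through σ and π, and π of an embedded series is 0. Multiplicativity
  -- allows products of norms to be rearranged in the commutative ring `Cser`.
  ι-⊗ : ∀ f g → ι (f Cs.⊗ g) Hs.≈ₛ (ι f Hs.⊗ ι g)
  ι-⊗ f g = series-injective {ι (f Cs.⊗ g)} {ι f Hs.⊗ ι g} s p
    where
    open SetoidReasoning C.setoid
    κ-0 : κ Cs.𝟘 C.≈ Cs.𝟘
    κ-0 zero = conj-0
    κ-0 (suc k) = conj-0
    s : σ (ι (f Cs.⊗ g)) C.≈ σ (ι f Hs.⊗ ι g)
    s = C.sym (begin
      σ (ι f Hs.⊗ ι g)                                  ≈⟨ σ-⊗ (ι f) (ι g) ⟩
      (f C.* g) C.- (κ (π (ι f)) C.* π (ι g))           ≈⟨ C.+-congˡ {f C.* g} (C.-‿cong (C.*-congˡ {κ (π (ι f))} (π-ι g))) ⟩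
      (f C.* g) C.- (κ (π (ι f)) C.* Cs.𝟘)              ≈⟨ C.+-congˡ {f C.* g} (C.trans (C.-‿cong (C.zeroʳ (κ (π (ι f))))) (RingProperties.-0#≈0# C.ring)) ⟩
      (f C.* g) C.+ Cs.𝟘                                ≈⟨ C.+-identityʳ (f C.* g) ⟩
      f C.* g                                           ∎)
    p : π (ι (f Cs.⊗ g)) C.≈ π (ι f Hs.⊗ ι g)
    p = C.trans (π-ι (f Cs.⊗ g)) (C.sym (begin
      π (ι f Hs.⊗ ι g)                                  ≈⟨ π-⊗ (ι f) (ι g) ⟩
      (π (ι f) C.* g) C.+ (κ f C.* π (ι g))             ≈⟨ C.+-cong (C.*-congʳ {g} (π-ι f)) (C.*-congˡ {κ f} (π-ι g)) ⟩
      (Cs.𝟘 C.* g) C.+ (κ f C.* Cs.𝟘)                   ≈⟨ C.+-cong (C.zeroˡ g) (C.zeroʳ (κ f)) ⟩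
      Cs.𝟘 C.+ Cs.𝟘                                     ≈⟨ C.+-identityˡ Cs.𝟘 ⟩
      Cs.𝟘                                              ∎))

  ι-1 : ι Cs.𝟙 Hs.≈ₛ Hs.𝟙
  ι-1 zero = ℍ′.refl
  ι-1 (suc k) = ℍ′.refl

  -- Complex series commute, so the two terms of the j-part cancel and f f* lies in the image of ι.
  norm : ∀ f → (f Hs.⊗ star f) Hs.≈ₛ ι (ν f)
  norm f = series-injective {f Hs.⊗ star f} {ι (ν f)} s p
    where
    open SetoidReasoning C.setoid
    π-star : π (star f) C.≈ (C.- π f)
    π-star k = partP-qstar (f k)
    s : σ (f Hs.⊗ star f) C.≈ ν f
    s = begin
      σ (f Hs.⊗ star f)                              ≈⟨ σ-⊗ f (star f) ⟩
      (σ f C.* κ (σ f)) C.- (κ (π f) C.* π (star f)) ≈⟨ C.+-congˡ {σ f C.* κ (σ f)} (C.-‿cong (C.*-congˡ {κ (π f)} π-star)) ⟩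
      (σ f C.* κ (σ f)) C.- (κ (π f) C.* (C.- π f))  ≈⟨ C.+-congˡ {σ f C.* κ (σ f)} (C.trans (C.-‿cong (C.sym (RingProperties.-‿distribʳ-* C.ring (κ (π f)) (π f)))) (AGP.⁻¹-involutive C.+-abelianGroup _)) ⟩
      ν f                                            ∎
    p : π (f Hs.⊗ star f) C.≈ π (ι (ν f))
    p = C.trans (begin
      π (f Hs.⊗ star f)                              ≈⟨ π-⊗ f (star f) ⟩
      (π f C.* κ (σ f)) C.+ (κ (σ f) C.* π (star f)) ≈⟨ C.+-cong (C.*-comm (π f) (κ (σ f))) (C.trans (C.*-congˡ {κ (σ f)} π-star) (C.sym (RingProperties.-‿distribʳ-* C.ring (κ (σ f)) (π f)))) ⟩
      (κ (σ f) C.* π f) C.- (κ (σ f) C.* π f)        ≈⟨ C.-‿inverseʳ (κ (σ f) C.* π f) ⟩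
      Cs.𝟘                                           ∎) (C.sym (π-ι (ν f)))

  -- The Lyndon factorization is available only up to t^N. The determinant is built from sums and
  -- products, so it respects equality to that order.
  module Truncated (N : ℕ) where
    infix 4 _≃_
    _≃_ : Cs.Series → Cs.Series → Set ℓ
    f ≃ g = ∀ k → k ℕ.≤ N → f k ℂ′.≈ g k

    ⊗-≃ : ∀ {f f' g g'} → f ≃ f' → g ≃ g' → f Cs.⊗ g ≃ f' Cs.⊗ g'
    ⊗-≃ {f} {f'} {g} {g'} p q k k≤N = PC.⊗-cong≤ k {f} {f'} {g} {g'} (λ i i≤k → p i (ℕₚ.≤-trans i≤k k≤N)) (λ i i≤k → q i (ℕₚ.≤-trans i≤k k≤N))

    sum-≃ : ∀ {n} {f g : Fin n → Cs.Series} → (∀ i → f i ≃ g i) → FiniteSums.sum C.ring f ≃ FiniteSums.sum C.ring g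
    sum-≃ {zero} {f} {g} p k k≤N = ℂ′.trans (F.sum-[] f k) (ℂ′.sym (F.sum-[] g k))
      where module F = FiniteSums C.ring
    sum-≃ {suc n} {f} {g} p k k≤N = ℂ′.trans (F.sum-∷ f k) (ℂ′.trans (ℂ′.+-cong (p zero k k≤N) (sum-≃ (λ i → p (suc i)) k k≤N)) (ℂ′.sym (F.sum-∷ g k)))
      where module F = FiniteSums C.ring

    D-≃ : ∀ {n} {M M' : Fin n → Fin n → Cs.Series} → (∀ a b → M a b ≃ M' a b) → D M ≃ D M'
    D-≃ {zero} p k k≤N = ℂ′.refl
    D-≃ {suc n} {M} {M'} p = sum-≃ (λ j → ⊗-≃ {sgn j} {sgn j} {M zero j C.* D (minor j M)} {M' zero j C.* D (minor j M')} (λ _ _ → ℂ′.refl)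
      (⊗-≃ {M zero j} {M' zero j} {D (minor j M)} {D (minor j M')} (p zero j) (D-≃ (λ a b → p (suc a) _))))

    S-≃ : ∀ {n} {M M' : Fin n → Fin n → Hs.Series} → (∀ a b k → k ℕ.≤ N → M a b k ℍ′.≈ M' a b k) → S M ≃ S M'
    S-≃ {n} {M} {M'} p k k≤N = ℂ′.trans (C.reflexive (S≡D-ψ M) k) (ℂ′.trans (D-≃ ψ-≃ k k≤N) (ℂ′.sym (C.reflexive (S≡D-ψ M') k)))
      where
      ψ-≃ : ∀ a b → ψ M a b ≃ ψ M' a b
      ψ-≃ a b k k≤N with splitAt n a | splitAt n b
      ... | inj₁ u | inj₁ v = partS-cong (p u v k k≤N)
      ... | inj₁ u | inj₂ v = ℂ′.-‿cong (conj-cong (partP-cong (p u v k k≤N)))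
      ... | inj₂ u | inj₁ v = partP-cong (p u v k k≤N)
      ... | inj₂ u | inj₂ v = conj-cong (partS-cong (p u v k k≤N))

-- Series of matrices and matrices of series

module MatrixSeries {c ℓ : Level} (A : Ring c ℓ) (p : ℕ) where
  open Ring A hiding (zero)
  open FiniteSums A
  private
    module PA = PS rawRing
    module S = Ring (PowerSeries.seriesRing A)
    module SS = FiniteSums (PowerSeries.seriesRing A)
    module MA = Matrices A
    module MS = Matrices (PowerSeries.seriesRing A)
    module PM = PS (Ring.rawRing (MA.matrixRing p))
  open PowerSeries A

  -- The Lyndon factorization lives in power series over the matrix ring, the Study determinant on
  -- matrices over the power series ring; this transposition of arguments is a ring homomorphism
  -- between them.
  Θ : PM.Series → MS.Mat p p
  Θ f i j r = f r i j

  sum-coefficient : ∀ {n} (F : Fin n → PA.Series) r → SS.sum F r ≈ sum (λ i → F i r)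
  sum-coefficient {zero} F r = trans (SS.sum-[] F r) (trans (𝟘≈0 r) (sym (sum-[] _)))
  sum-coefficient {suc n} F r = trans (SS.sum-∷ F r) (trans (+-congˡ (sum-coefficient (λ i → F (suc i)) r)) (sym (sum-∷ _)))

  sum-sumTo : ∀ {n} r (F : Fin n → ℕ → Carrier) → sum (λ i → PA.sumTo r (F i)) ≈ PA.sumTo r (λ s → sum (λ i → F i s))
  sum-sumTo zero F = ∑-zero (λ i → refl)
  sum-sumTo (suc r) F = trans (∑-+ _ _) (+-congʳ (sum-sumTo r F))

  Θ-⊗ : ∀ f g → Θ (f PM.⊗ g) MS.≋ Θ f MS.⊡ Θ g
  Θ-⊗ f g i j r = trans (SumToMap.sumTo-map (MA.matrixRing p) A (λ M → M i j) (λ _ _ → refl) refl (suc r) (λ s → f s MA.⊡ g (r ∸ s)))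
    (trans (sym (sum-sumTo (suc r) (λ q s → f s i q * g (r ∸ s) q j)))
           (sym (sum-coefficient (λ q → Θ f i q PA.⊗ Θ g q j) r)))

  Θ-𝟙 : Θ PM.𝟙 MS.≋ MS.𝐈
  Θ-𝟙 i j zero with i Finₚ.≟ j
  ... | yes _ = refl
  ... | no _ = refl
  Θ-𝟙 i j (suc r) with i Finₚ.≟ j
  ... | yes _ = refl
  ... | no _ = refl

  Θ-mono : ∀ M r i j → Θ (PM.mono M r) i j S.≈ PA.mono (M i j) r
  Θ-mono M zero i j zero = refl
  Θ-mono M zero i j (suc k) = refl
  Θ-mono M (suc r) i j zero = refl
  Θ-mono M (suc r) i j (suc k) = Θ-mono M r i j k

  Θ-𝟙-mono : ∀ M r → Θ (PM.𝟙 PM.⊖ PM.mono M r) MS.≋ (MS.𝐈 MS.⊞ MS.⊟ (λ i j → PA.mono (M i j) r))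
  Θ-𝟙-mono M r i j k = +-cong (Θ-𝟙 i j k) (-‿cong (Θ-mono M r i j k))

-- The Study determinant of the Lyndon product

module LyndonDeterminant {c ℓ : Level} (R : CommutativeRing c ℓ) (k : ℕ) (A : Fin k → Fin k → Over.ℍ R) where
  open Over R
  open Quaternions R
  open QuaternionSeries R
  open Study
  open Ring ℍ-ring hiding (zero)
  open FiniteSums ℍ-ring
  open Matrices ℍ-ring
  open MatrixSeries ℍ-ring k
  open LyndonWords k
  private
    module C = CommutativeRing Cser
    module H = Ring Hser
    module PH = PowerSeries ℍ-ring
    module HS = FiniteSums Hser
    module PM = PS (Ring.rawRing (matrixRing k))

  X : Fin k → Mat k k
  X a e f = δ a e * A a f

  open LyndonFactorization (matrixRing k) X using (eval; letters; lyndonFactor; lyndonProduct; lyndon-factorization)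

  letters≋A : letters ≋ A
  letters≋A e f = trans (entry X) (trans (sum-cong (λ a → *-congʳ (δ-sym a e))) (∑-δˡ e (λ a → A a f)))
    where
    module MF = FiniteSums (matrixRing k)
    entry : ∀ {n} (F : Fin n → Mat k k) → MF.sum F e f ≈ sum (λ a → F a e f)
    entry {zero} F = trans (MF.sum-[] F e f) (sym (sum-[] _))
    entry {suc n} F = trans (MF.sum-∷ F e f) (trans (+-congˡ (entry (λ a → F (suc a)))) (sym (sum-∷ _)))

  walk : Fin k → Word → Fin k → ℍ
  walk a [] f = A a f
  walk a (b ∷ u) f = A a b * walk b u f

  -- The product is supported on the row of its first letter, and the later letters fix all
  -- intermediate indices. The word thus determines a single walk, with only its final index f free.
  eval-walk : ∀ a u e f → eval (a ∷ u) e f ≈ δ a e * walk a u f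
  eval-walk a [] e f = ⊡-identityʳ (X a) e f
  eval-walk a (b ∷ u) e f = begin
    sum (λ g → (δ a e * A a g) * eval (b ∷ u) g f)          ≈⟨ sum-cong (λ g → *-congˡ (trans (eval-walk b u g f) (*-congʳ (δ-sym b g)))) ⟩
    sum (λ g → (δ a e * A a g) * (δ g b * walk b u f))      ≈⟨ sum-cong (λ g → *-assoc _ _ _) ⟨
    sum (λ g → (δ a e * A a g) * δ g b * walk b u f)        ≈⟨ ∑-* _ _ ⟨
    sum (λ g → (δ a e * A a g) * δ g b) * walk b u f        ≈⟨ *-congʳ (∑-δʳ b (λ g → δ a e * A a g)) ⟩
    (δ a e * A a b) * walk b u f                            ≈⟨ *-assoc _ _ _ ⟩
    δ a e * (A a b * walk b u f)                            ∎
    where open SetoidReasoning setoid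

  Δ : PM.Series → Cs.Series
  Δ f = S (Θ f)

  Δ-⊗ : ∀ f g → Δ (f PM.⊗ g) C.≈ Δ f C.* Δ g
  Δ-⊗ f g = C.trans (S-cong (Θ-⊗ f g)) (S-⊡ (Θ f) (Θ g))

  Δ-𝟙 : Δ PM.𝟙 C.≈ C.1#
  Δ-𝟙 = C.trans (S-cong Θ-𝟙) (S-𝐈 k)

  -- The matrix of the word is the column δ a times the row of walks, the power of t being carried
  -- by the row. Contracting in the other order closes the walk at a.
  Δ-word : ∀ a u → Δ (PM.𝟙 PM.⊖ PM.mono (eval (a ∷ u)) (length (a ∷ u))) C.≈ ν (Hs.𝟙 Hs.⊖ Hs.mono (walk a u a) (length (a ∷ u)))
  Δ-word a u = C.trans (S-cong split) (C.trans (S-rank-one column row) (ν-cong close))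
    where
    r = length (a ∷ u)
    column row : Fin k → Hs.Series
    column e = Hs.mono (δ a e) 0
    row f = Hs.mono (walk a u f) r
    split : Θ (PM.𝟙 PM.⊖ PM.mono (eval (a ∷ u)) r) HM.≋ (HM.𝐈 HM.⊞ HM.⊟ (λ e f → column e H.* row f))
    split e f = H.trans (Θ-𝟙-mono (eval (a ∷ u)) r e f) (H.+-congˡ {HM.𝐈 e f} (H.-‿cong
      (H.trans (PH.mono-cong r (eval-walk a u e f)) (H.sym (PH.mono-⊗-mono (δ a e) (walk a u f) 0 r)))))
    close : (H.1# H.- HS.sum (λ e → row e H.* column e)) H.≈ (Hs.𝟙 Hs.⊖ Hs.mono (walk a u a) r)
    close = H.+-congˡ {H.1#} (H.-‿cong (H.trans (HS.sum-cong (λ e → H.*-congˡ {row e} (column-δ e))) (HS.∑-δʳ a row)))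
      where
      column-δ : ∀ e → column e H.≈ HS.δ e a
      column-δ e with a Finₚ.≟ e | e Finₚ.≟ a
      ... | yes _ | yes _ = H.refl {Hs.𝟙}
      ... | no _ | no _ = H.refl {Hs.𝟘}
      ... | yes p | no q with () ← q (≡.sym p)
      ... | no p | yes q with () ← p (≡.sym q)

  wordNorm : Word → Cs.Series
  wordNorm [] = Cs.𝟙
  wordNorm (a ∷ u) = if isLyndon (a ∷ u) then ν (Hs.𝟙 Hs.⊖ Hs.mono (walk a u a) (length (a ∷ u))) else Cs.𝟙

  Δ-lyndonFactor : ∀ l → Δ (lyndonFactor l) C.≈ wordNorm l
  Δ-lyndonFactor [] = Δ-𝟙
  Δ-lyndonFactor (a ∷ u) with isLyndon (a ∷ u)
  ... | true = Δ-word a u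
  ... | false = Δ-𝟙

  Δ-lyndonProduct : ∀ ws → Δ (lyndonProduct ws) C.≈ foldr (λ l z → wordNorm l C.* z) C.1# ws
  Δ-lyndonProduct [] = Δ-𝟙
  Δ-lyndonProduct (l ∷ ws) = C.trans (Δ-⊗ (lyndonFactor l) (lyndonProduct ws)) (C.*-cong {Δ (lyndonFactor l)} {wordNorm l} {Δ (lyndonProduct ws)} (Δ-lyndonFactor l) (Δ-lyndonProduct ws))

  module _ (N : ℕ) where
    open Truncated N

    -- `lyndon-factorization` holds up to t^N only, so `S-≃` first takes it through the determinant;
    -- the factors are then separated by exact multiplicativity.
    det-lyndon : S (HM.𝐈 HM.⊞ HM.⊟ (λ e f → Hs.mono (A e f) 1)) ≃ foldr (λ l z → wordNorm l C.* z) C.1# (sortedWords N)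
    det-lyndon r r≤N = Cc.trans (S-cong (λ e f → H.sym (H.trans (Θ-𝟙-mono letters 1 e f) (H.+-congˡ {HM.𝐈 e f} (H.-‿cong (PH.mono-cong 1 (letters≋A e f)))))) r)
      (Cc.trans (S-≃ (λ e f i i≤N → lyndon-factorization N i i≤N e f) r r≤N) (Δ-lyndonProduct (sortedWords N) r))
      where module Cc = CommutativeRing ℂ-commutativeRing

-- The zeta function

module ReducedCycles (G : Graph) where
  open Graph G
  open CycleDefs G

  continues : Arc → Arc → Bool
  continues e f = does (t e Finₚ.≟ o f) ∧ not (does (f Finₚ.≟ rev e))

  continuesAlong : Arc → List Arc → Arc → Bool
  continuesAlong e [] f = continues e f
  continuesAlong e (e' ∷ es) f = continues e e' ∧ continuesAlong e' es f

  continuesAlong-path : ∀ e es f → continuesAlong e es f ≡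
    (isPath (e ∷ es) ∧ does (t (last e es) Finₚ.≟ o f)) ∧ (not (hasBacktracking (e ∷ es)) ∧ not (does (f Finₚ.≟ rev (last e es))))
  continuesAlong-path e [] f = ≡.refl
  continuesAlong-path e (e' ∷ es) f = ≡.trans (≡.cong (continues e e' ∧_) (continuesAlong-path e' es f))
      (shuffle (does (t e Finₚ.≟ o e')) (does (e' Finₚ.≟ rev e)) _ _ _ _)
    where
    shuffle : ∀ p q P c h z → (p ∧ not q) ∧ ((P ∧ c) ∧ (not h ∧ z)) ≡ ((p ∧ P) ∧ c) ∧ (not (q ∨ h) ∧ z)
    shuffle false q P c h z = ≡.refl
    shuffle true true P c h z = ≡.sym (∧-zeroʳ (P ∧ c))
    shuffle true false P c h z = ≡.refl

  hasBacktracking-++ : ∀ e es f fs → hasBacktracking ((e ∷ es) ++ f ∷ fs) ≡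
    hasBacktracking (e ∷ es) ∨ (does (f Finₚ.≟ rev (last e es)) ∨ hasBacktracking (f ∷ fs))
  hasBacktracking-++ e [] f fs = ≡.refl
  hasBacktracking-++ e (e' ∷ es) f fs = ≡.trans (≡.cong (does (e' Finₚ.≟ rev e) ∨_) (hasBacktracking-++ e' es f fs))
      (assoc (does (e' Finₚ.≟ rev e)) _ _)
    where
    assoc : ∀ x y z → x ∨ (y ∨ z) ≡ (x ∨ y) ∨ z
    assoc false y z = ≡.refl
    assoc true y z = ≡.refl

  -- The step from the last arc back to the first is also the junction of the two copies in C².
  -- Closing the walk without backtracking thus tests both the cycle condition and C².
  continuesAlong-closed : ∀ e es → continuesAlong e es e ≡ isCycle (e ∷ es) ∧ isReduced (e ∷ es)
  continuesAlong-closed e es = ≡.trans (continuesAlong-path e es e)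
      (≡.cong (isCycle (e ∷ es) ∧_) (≡.trans (absorb (hasBacktracking (e ∷ es)) (does (e Finₚ.≟ rev (last e es))))
        (≡.cong (λ b → not (hasBacktracking (e ∷ es)) ∧ not b) (≡.sym (hasBacktracking-++ e es e es)))))
    where
    absorb : ∀ h z → not h ∧ not z ≡ not h ∧ not (h ∨ (z ∨ h))
    absorb true z = ≡.refl
    absorb false true = ≡.refl
    absorb false false = ≡.refl

module Products {c ℓ : Level} (K : CommutativeRing c ℓ) where
  open CommutativeRing K hiding (zero)
  open CSP *-commutativeSemigroup using (interchange)

  ∏ : ∀ {a} {A : Set a} → List A → (A → Carrier) → Carrier
  ∏ xs f = foldr (λ x z → f x * z) 1# xs

  ∏-cong : ∀ {a} {A : Set a} (xs : List A) {f g : A → Carrier} → (∀ x → f x ≈ g x) → ∏ xs f ≈ ∏ xs g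
  ∏-cong [] p = refl
  ∏-cong (x ∷ xs) p = *-cong (p x) (∏-cong xs p)

  ∏-* : ∀ {a} {A : Set a} (xs : List A) (f g : A → Carrier) → ∏ xs (λ x → f x * g x) ≈ ∏ xs f * ∏ xs g
  ∏-* [] f g = sym (*-identityˡ _)
  ∏-* (x ∷ xs) f g = trans (*-congˡ (∏-* xs f g)) (interchange _ _ _ _)

  ∏-++ : ∀ {a} {A : Set a} (xs ys : List A) (f : A → Carrier) → ∏ (xs ++ ys) f ≈ ∏ xs f * ∏ ys f
  ∏-++ [] ys f = sym (*-identityˡ _)
  ∏-++ (x ∷ xs) ys f = trans (*-congˡ (∏-++ xs ys f)) (sym (*-assoc _ _ _))

  ∏-map : ∀ {a b} {A : Set a} {B : Set b} (h : A → B) xs (f : B → Carrier) → ∏ (List.map h xs) f ≈ ∏ xs (λ x → f (h x))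
  ∏-map h [] f = refl
  ∏-map h (x ∷ xs) f = *-congˡ (∏-map h xs f)

  ∏-concatMap : ∀ {a b} {A : Set a} {B : Set b} (h : A → List B) xs (f : B → Carrier) → ∏ (concatMap h xs) f ≈ ∏ xs (λ x → ∏ (h x) f)
  ∏-concatMap h [] f = refl
  ∏-concatMap h (x ∷ xs) f = trans (∏-++ (h x) _ f) (*-congˡ (∏-concatMap h xs f))

  ∏-1 : ∀ {a} {A : Set a} (xs : List A) → ∏ xs (λ _ → 1#) ≈ 1#
  ∏-1 [] = refl
  ∏-1 (x ∷ xs) = trans (*-identityˡ _) (∏-1 xs)

  ∏-filter : ∀ {a} {A : Set a} (b : A → Bool) xs (f : A → Carrier) →
    ∏ (filter (λ x → T? (b x)) xs) f ≈ ∏ xs (λ x → if b x then f x else 1#)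
  ∏-filter b [] f = refl
  ∏-filter b (x ∷ xs) f with b x
  ... | true = *-congˡ (∏-filter b xs f)
  ... | false = trans (∏-filter b xs f) (sym (*-identityˡ _))

  -- The index runs from 1 to N, as in `Zfactors`: the empty word has no factor.
  ∏≤ : ℕ → (ℕ → Carrier) → Carrier
  ∏≤ zero g = 1#
  ∏≤ (suc r) g = ∏≤ r g * g (suc r)

  ∏≤-cong : ∀ N {f g : ℕ → Carrier} → (∀ r → f (suc r) ≈ g (suc r)) → ∏≤ N f ≈ ∏≤ N g
  ∏≤-cong zero p = refl
  ∏≤-cong (suc N) p = *-cong (∏≤-cong N p) (p N)

  ∏-∏≤ : ∀ {a} {A : Set a} N (xs : List A) (g : A → ℕ → Carrier) → ∏ xs (λ x → ∏≤ N (g x)) ≈ ∏≤ N (λ r → ∏ xs (λ x → g x r))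
  ∏-∏≤ zero xs g = ∏-1 xs
  ∏-∏≤ (suc N) xs g = trans (∏-* xs _ _) (*-congʳ (∏-∏≤ N xs g))

  ∏≤-shift : ∀ N (g : ℕ → Carrier) → g 1 * ∏≤ N (λ r → g (suc r)) ≈ ∏≤ (suc N) g
  ∏≤-shift zero g = *-comm _ _
  ∏≤-shift (suc N) g = trans (sym (*-assoc _ _ _)) (*-congʳ (∏≤-shift N g))

  module _ (k : ℕ) where
    open LyndonWords k
    -- Commutativity turns the lexicographic order into a grouping by length. In the block of a
    -- first letter a, the word [ a ] has length 1, and each further word is one letter longer than
    -- its tail.
    ∏-sortedWords : ∀ N (f : Word → Carrier) → ∏ (sortedWords N) f ≈ ∏≤ N (λ r → ∏ (List.map toList (allWords k r)) f)
    ∏-sortedWords zero f = refl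
    ∏-sortedWords (suc N) f = begin
      ∏ (sortedWords (suc N)) f
        ≈⟨ ∏-concatMap (λ a → [ a ] ∷ List.map (a ∷_) (sortedWords N)) (allFin k) f ⟩
      ∏ (allFin k) (λ a → f [ a ] * ∏ (List.map (a ∷_) (sortedWords N)) f)
        ≈⟨ ∏-cong (allFin k) (λ a → *-congˡ (trans (∏-map (a ∷_) (sortedWords N) f) (∏-sortedWords N (λ u → f (a ∷ u))))) ⟩
      ∏ (allFin k) (λ a → f [ a ] * ∏≤ N (λ r → W r (λ u → f (a ∷ u))))
        ≈⟨ trans (∏-* (allFin k) _ _) (*-congˡ (∏-∏≤ N (allFin k) (λ a r → W r (λ u → f (a ∷ u))))) ⟩
      ∏ (allFin k) (λ a → f [ a ]) * ∏≤ N (λ r → ∏ (allFin k) (λ a → W r (λ u → f (a ∷ u))))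
        ≈⟨ *-cong (trans (∏-cong (allFin k) (λ a → sym (*-identityʳ _))) (sym (letterwise 0))) (∏≤-cong N (λ r → sym (letterwise (suc r)))) ⟩
      W 1 f * ∏≤ N (λ r → W (suc r) f) ≈⟨ ∏≤-shift N (λ r → W r f) ⟩
      ∏≤ (suc N) (λ r → W r f) ∎
      where
      open SetoidReasoning setoid
      W : ℕ → (Word → Carrier) → Carrier
      W r g = ∏ (List.map toList (allWords k r)) g
      letterwise : ∀ r → W (suc r) f ≈ ∏ (allFin k) (λ a → W r (λ u → f (a ∷ u)))
      letterwise r = trans (∏-map toList (allWords k (suc r)) f) (trans (∏-concatMap _ (allFin k) (λ v → f (toList v)))
        (∏-cong (allFin k) (λ a → trans (∏-map (a Vec.∷_) (allWords k r) (λ v → f (toList v))) (sym (∏-map toList (allWords k r) (λ u → f (a ∷ u)))))))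

module ZetaFunction {c ℓ : Level} (R : CommutativeRing c ℓ) (G : Graph) (w : Fin' G → Fin' G → Over.ℍ R) where
  open Over R
  open Weighted G w
  open Graph G
  open CycleDefs G
  open Arcs G
  open ReducedCycles G
  open Quaternions R
  open QuaternionSeries R
  open Study
  open Products Cser
  private
    module C = CommutativeRing Cser
    module H = Ring Hser
    module HS = FiniteSums Hser
    module Q = Ring ℍ-ring
    module QP = RingProperties ℍ-ring
    module QS = FiniteSums ℍ-ring
    module ℂ′ = CommutativeRing ℂ-commutativeRing
    module PH = PowerSeries ℍ-ring

  A : Arc → Arc → ℍ
  A e f = wA e Q.* (QS.δ (t e) (o f) Q.- QS.δ (rev e) f)

  open LyndonDeterminant R (m ℕ.+ m) A using (walk; wordNorm; det-lyndon)
  open LyndonWords (m ℕ.+ m) using (isLyndon; sortedWords)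

  -- A reversal always satisfies t e = o (rev e), so the difference of the two deltas is 1 or 0 and
  -- never -1.
  A-continues : ∀ e f → A e f Q.≈ (if continues e f then wA e else Q.0#)
  A-continues e f with t e Finₚ.≟ o f | f Finₚ.≟ rev e | rev e Finₚ.≟ f
  ... | yes _ | yes _ | yes _ = Q.trans (Q.*-congˡ {wA e} (Q.-‿inverseʳ Q.1#)) (Q.zeroʳ (wA e))
  ... | yes _ | no _ | no _ = Q.trans (Q.*-congˡ {wA e} (Q.trans (Q.+-congˡ {Q.1#} QP.-0#≈0#) (Q.+-identityʳ Q.1#))) (Q.*-identityʳ (wA e))
  ... | no _ | no _ | no _ = Q.trans (Q.*-congˡ {wA e} (Q.-‿inverseʳ Q.0#)) (Q.zeroʳ (wA e))
  ... | no p | yes ≡.refl | _ with () ← p (≡.sym (o-rev e))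
  A-continues e f | _ | yes p | no q with () ← q (≡.sym p)
  A-continues e f | _ | no p | yes q with () ← p (≡.sym q)

  walk-continues : ∀ e es f → walk e es f Q.≈ (if continuesAlong e es f then wP (e ∷ es) else Q.0#)
  walk-continues e [] f with continues e f | A-continues e f
  ... | true | p = Q.trans p (Q.sym (Q.*-identityʳ (wA e)))
  ... | false | p = p
  walk-continues e (e' ∷ es) f = Q.trans (Q.*-cong {A e e'} (A-continues e e') (walk-continues e' es f)) combine
    where
    combine : (if continues e e' then wA e else Q.0#) Q.* (if continuesAlong e' es f then wP (e' ∷ es) else Q.0#)
      Q.≈ (if continues e e' ∧ continuesAlong e' es f then wP (e ∷ e' ∷ es) else Q.0#)
    combine with continues e e' | continuesAlong e' es f
    ... | true | true = Q.refl
    ... | true | false = Q.zeroʳ (wA e)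
    ... | false | _ = Q.zeroˡ _

  cycleNorm : List Arc → Cs.Series
  cycleNorm cs = ν (cycFactor cs)

  private
    vanish : ∀ r {z} → z Q.≈ Q.0# → (Hs.𝟙 Hs.⊖ Hs.mono z r) H.≈ H.1#
    vanish r z≈0 k = Q.trans (Q.+-congˡ {Hs.𝟙 k} (Q.trans (Q.-‿cong (Q.trans (PH.mono-cong r z≈0 k) (PH.mono-0 r k))) QP.-0#≈0#)) (Q.+-identityʳ (Hs.𝟙 k))

    select : ∀ cyc red lyn r z p → z Q.≈ (if cyc ∧ red then p else Q.0#) →
      (if lyn then ν (Hs.𝟙 Hs.⊖ Hs.mono z r) else Cs.𝟙) C.≈ (if cyc ∧ red ∧ lyn then ν (Hs.𝟙 Hs.⊖ Hs.mono p r) else C.1#)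
    select true true true r z p e = ν-cong (H.+-congˡ {Hs.𝟙} (H.-‿cong (PH.mono-cong r e)))
    select true true false r z p e = C.refl {Cs.𝟙}
    select true false true r z p e = C.trans (ν-cong (vanish r e)) ν-1
    select true false false r z p e = C.refl {Cs.𝟙}
    select false red true r z p e = C.trans (ν-cong (vanish r e)) ν-1
    select false red false r z p e = C.refl {Cs.𝟙}

  wordNorm-cycle : ∀ l → wordNorm l C.≈ (if isLyndonCycle l then cycleNorm l else C.1#)
  wordNorm-cycle [] = C.refl {Cs.𝟙}
  wordNorm-cycle (e ∷ es) = select (isCycle (e ∷ es)) (isReduced (e ∷ es)) (isLyndon (e ∷ es)) (length (e ∷ es)) (walk e es e) (wP (e ∷ es))
    (Q.trans (walk-continues e es e) (Q.reflexive (≡.cong (λ b → if b then wP (e ∷ es) else Q.0#) (continuesAlong-closed e es))))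

  cycleProduct : ℕ → Cs.Series
  cycleProduct N = ∏≤ N (λ r → ∏ (lyndonCycles r) cycleNorm)

  ∏-wordNorm : ∀ N → ∏ (sortedWords N) wordNorm C.≈ cycleProduct N
  ∏-wordNorm N = C.trans (∏-cong (sortedWords N) wordNorm-cycle)
    (C.trans (∏-sortedWords (m ℕ.+ m) N (λ l → if isLyndonCycle l then cycleNorm l else C.1#))
             (∏≤-cong N (λ r → C.sym (∏-filter isLyndonCycle (List.map toList (allWords (m ℕ.+ m) (suc r))) cycleNorm))))

  τ : Hs.Series
  τ = Hs.mono Q.1# 1

  const : ℍ → Hs.Series
  const a = Hs.mono a 0

  private
    φ⁻¹ φ : Arc → Hs.Series
    φ⁻¹ e = Hs.inv₁ (edgeFactor (o e) (t e))
    φ e = edgeFactor (o e) (t e)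

    mono-neg : ∀ a r → Hs.mono (Q.- a) r H.≈ (H.- Hs.mono a r)
    mono-neg a zero zero = Q.refl
    mono-neg a zero (suc k) = Q.sym QP.-0#≈0#
    mono-neg a (suc r) zero = Q.sym QP.-0#≈0#
    mono-neg a (suc r) (suc k) = mono-neg a r k

    mono-+ : ∀ a b r → Hs.mono (a Q.+ b) r H.≈ (Hs.mono a r H.+ Hs.mono b r)
    mono-+ a b zero zero = Q.refl
    mono-+ a b zero (suc k) = Q.sym (Q.+-identityˡ Q.0#)
    mono-+ a b (suc r) zero = Q.sym (Q.+-identityˡ Q.0#)
    mono-+ a b (suc r) (suc k) = mono-+ a b r k

    δ-const : ∀ {n} (i j : Fin n) → HS.δ i j H.≈ const (QS.δ i j)
    δ-const i j with i Finₚ.≟ j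
    ... | yes _ = H.refl {Hs.𝟙}
    ... | no _ = H.refl {Hs.𝟘}

    x-mono : ∀ e → (τ H.* const (wA e)) H.≈ Hs.mono (wA e) 1
    x-mono e = H.trans (PH.mono-⊗-mono Q.1# (wA e) 1 0) (PH.mono-cong 1 (Q.*-identityˡ (wA e)))

    x-δ : ∀ e {n} (i j : Fin n) → (τ H.* const (wA e) H.* HS.δ i j) H.≈ Hs.mono (wA e Q.* QS.δ i j) 1
    x-δ e i j = H.trans (H.*-cong {τ H.* const (wA e)} {Hs.mono (wA e) 1} {HS.δ i j} {const (QS.δ i j)} (x-mono e) (δ-const i j)) (PH.mono-⊗-mono (wA e) (QS.δ i j) 1 0)

    wA-rev : ∀ e → wA (rev e) ≡ w (t e) (o e)
    wA-rev e = ≡.cong₂ w (o-rev e) (t-rev e)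

    edge-entry : ∀ e f → Hs.mono (A e f) 1 H.≈ (τ H.* const (wA e) H.* HS.δ (t e) (o f) H.- τ H.* const (wA e) H.* HS.δ (rev e) f)
    edge-entry e f = H.trans (PH.mono-cong 1 (Q.trans (Q.distribˡ (wA e) p (Q.- q)) (Q.+-congˡ {wA e Q.* p} (Q.sym (QP.-‿distribʳ-* (wA e) q)))))
      (H.trans (mono-+ (wA e Q.* p) (Q.- (wA e Q.* q)) 1)
      (H.+-cong {Hs.mono (wA e Q.* p) 1} (H.sym (x-δ e (t e) (o f))) (H.trans (mono-neg (wA e Q.* q) 1) (H.-‿cong (H.sym (x-δ e (rev e) f))))))
      where
      p q : ℍ
      p = QS.δ (t e) (o f)
      q = QS.δ (rev e) f

    φ-eq : ∀ e → φ e H.≈ (H.1# H.- (τ H.* const (wA e)) H.* (τ H.* const (wA (rev e))))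
    φ-eq e = H.+-congˡ {H.1#} (H.-‿cong (H.sym (H.trans (H.*-cong {τ H.* const (wA e)} {Hs.mono (wA e) 1} {τ H.* const (wA (rev e))} {Hs.mono (wA (rev e)) 1} (x-mono e) (x-mono (rev e)))
      (H.trans (PH.mono-⊗-mono (wA e) (wA (rev e)) 1 1) (PH.mono-cong 2 (Q.*-congˡ {wA e} (Q.reflexive (wA-rev e))))))))

    φ⁻¹-φ : ∀ e → (φ⁻¹ e H.* φ e) H.≈ H.1#
    φ⁻¹-φ e = PH.inv₁-inverseˡ (edgeFactor (o e) (t e)) (Q.trans (Q.+-congˡ {Q.1#} QP.-0#≈0#) (Q.+-identityʳ Q.1#))

    y : Fin n → Fin n → Hs.Series
    y u v = Hs.inv₁ (edgeFactor u v) Hs.⊗ const (w u v)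

    d : Arc → Hs.Series
    d e = Hs.inv₁ (edgeFactor (o e) (t e)) Hs.⊗ Hs.mono (w (o e) (t e) Q.* w (t e) (o e)) 0

    d-eq : ∀ e → (φ⁻¹ e H.* (const (wA e) H.* const (wA (rev e)))) H.≈ d e
    d-eq e = H.*-congˡ {φ⁻¹ e} (H.trans (PH.mono-⊗-mono (wA e) (wA (rev e)) 0 0) (PH.mono-cong 0 (Q.*-congˡ {wA e} (Q.reflexive (wA-rev e)))))

    τ² : (τ H.* τ) H.≈ Hs.mono Q.1# 2
    τ² = H.trans (PH.mono-⊗-mono Q.1# Q.1# 1 1) (PH.mono-cong 2 (Q.*-identityˡ Q.1#))

    sumFin-sum : ∀ {k} (F : Fin k → Hs.Series) → Hs.sumFin F H.≈ HS.sum F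
    sumFin-sum {k} F = go (λ i → i)
      where
      go : ∀ {n} (g : Fin n → Fin k) → foldr Hs._⊕_ Hs.𝟘 (List.map F (List.tabulate g)) H.≈ HS.sum (λ i → F (g i))
      go {zero} g = H.sym (HS.sum-[] (λ i → F (g i)))
      go {suc n} g = H.trans (H.+-congˡ {F (g zero)} (go (λ i → g (suc i)))) (H.sym (HS.sum-∷ (λ i → F (g i))))

    if-cong : ∀ b {f g : Hs.Series} → f H.≈ g → (if b then f else Hs.𝟘) H.≈ (if b then g else Hs.𝟘)
    if-cong true p = p
    if-cong false p = H.refl {Hs.𝟘}

    D̃-eq : ∀ u v → D̃ u v H.≈ (if does (u Finₚ.≟ v) then HS.sum (λ e → if does (o e Finₚ.≟ u) then d e else H.0#) else H.0#)
    D̃-eq u v = if-cong (does (u Finₚ.≟ v)) (sumFin-sum (λ e → if does (o e Finₚ.≟ u) then d e else Hs.𝟘))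

  private
    prodFin-ι : ∀ {k} (F : Fin k → Hs.Series) (g : Fin k → Cs.Series) → (∀ i → F i H.≈ ι (g i)) → Hs.prodFin F H.≈ ι (prod g)
    prodFin-ι {k} F g p = go (λ i → i)
      where
      go : ∀ {n} (h : Fin n → Fin k) → Hs.prodList (List.map F (List.tabulate h)) H.≈ ι (prod (λ i → g (h i)))
      go {zero} h = H.sym ι-1
      go {suc n} h = H.trans (H.*-cong {F (h zero)} {ι (g (h zero))} (p (h zero)) (go (λ i → h (suc i)))) (H.sym (ι-⊗ (g (h zero)) (prod (λ i → g (h (suc i))))))

  -- The quantity evaluated twice: over Lyndon words in `edgeProduct≃cycleProduct` and over the
  -- vertices in `edgeProduct-bass`.
  edgeProduct : Cs.Series
  edgeProduct = S (HM.𝐈 HM.⊞ HM.⊟ (λ e f → Hs.mono (A e f) 1))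

  edgeProduct-bass : edgeProduct C.≈ S mainMatrix C.* prod (λ k → ν (φ (k ↑ˡ m)))
  edgeProduct-bass = EdgeToVertex.edge-to-vertex Hser Cser splitting G τ (λ e → const (wA e)) φ⁻¹ (PH.tpow-central 1)
    φ φ-eq φ⁻¹-φ y (λ e → H.refl {y (o e) (t e)}) d d-eq W̃ D̃ mainMatrix (Hs.mono Q.1# 2) τ²
    (λ u v → H.refl {W̃ u v}) D̃-eq (λ u v → H.refl {mainMatrix u v}) (λ e f → Hs.mono (A e f) 1) edge-entry

  rhs≈ι-edgeProduct : rhs H.≈ ι edgeProduct
  rhs≈ι-edgeProduct = H.trans
    (H.*-cong {ι (Sdet mainMatrix)} {ι (S mainMatrix)} {Hs.prodFin F} {ι pe} (ι-cong (Sdet≈S mainMatrix)) (prodFin-ι F (λ i → ν (φ (i ↑ˡ m))) (λ i → norm (φ (i ↑ˡ m)))))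
    (H.trans (H.sym (ι-⊗ (S mainMatrix) pe)) (ι-cong (C.sym edgeProduct-bass)))
    where
    F : Fin m → Hs.Series
    F i = edgeFactor (o (i ↑ˡ m)) (t (i ↑ˡ m)) Hs.⊗ star (edgeFactor (o (i ↑ˡ m)) (t (i ↑ˡ m)))
    pe : Cs.Series
    pe = prod (λ i → ν (φ (i ↑ˡ m)))

  edgeProduct≃cycleProduct : ∀ N k → k ℕ.≤ N → edgeProduct k ℂ′.≈ cycleProduct N k
  edgeProduct≃cycleProduct N k k≤N = ℂ′.trans (det-lyndon N k k≤N) (∏-wordNorm N k)

module _ {c ℓ : Level} (K : CommutativeRing c ℓ) where
  open CommutativeRing K
  *-inverse : ∀ {a b c d} → a * c ≈ 1# → b * d ≈ 1# → (a * b) * (c * d) ≈ 1#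
  *-inverse p q = trans (CSP.interchange *-commutativeSemigroup _ _ _ _) (trans (*-cong p q) (*-identityˡ 1#))

-- Inversion of the product over cycles

module _ {c ℓ : Level} (R : CommutativeRing c ℓ) (G : Graph) (w : Fin' G → Fin' G → Over.ℍ R) where
  open Over R
  open Weighted G w
  open Graph G
  open CycleDefs G
  open Quaternions R
  open QuaternionSeries R
  open Products Cser
  open ZetaFunction R G w using (cycleNorm; cycleProduct; edgeProduct; rhs≈ι-edgeProduct; edgeProduct≃cycleProduct)
  private
    module C = CommutativeRing Cser
    module H = Ring Hser
    module Q = Ring ℍ-ring
    module QP = RingProperties ℍ-ring
    module ℂ′ = CommutativeRing ℂ-commutativeRing
    module PH = PowerSeries ℍ-ring
    module PC = PowerSeries ℂ′.ring

    infix 4 _≈[_]_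
    _≈[_]_ : Hs.Series → ℕ → Hs.Series → Set ℓ
    f ≈[ N ] g = ∀ k → k ℕ.≤ N → f k Q.≈ g k

    ⊗-trunc : ∀ N {f f' g g'} → f ≈[ N ] f' → g ≈[ N ] g' → f Hs.⊗ g ≈[ N ] f' Hs.⊗ g'
    ⊗-trunc N {f} {f'} {g} {g'} p q k k≤N = PH.⊗-cong≤ k {f} {f'} {g} {g'} (λ i i≤k → p i (ℕₚ.≤-trans i≤k k≤N)) (λ i i≤k → q i (ℕₚ.≤-trans i≤k k≤N))

    ⊗-one : ∀ N f g → f ≈[ N ] Hs.𝟙 → g ≈[ N ] Hs.𝟙 → f Hs.⊗ g ≈[ N ] Hs.𝟙
    ⊗-one N f g p q k k≤N = Q.trans (⊗-trunc N {f} {Hs.𝟙} {g} {Hs.𝟙} p q k k≤N) (H.*-identityˡ Hs.𝟙 k)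

    -- Up to t^N the factor 1 in 1 · inv₁ f may be replaced by f, and f · inv₁ f is 1 exactly.
    inv₁-trunc : ∀ N f → f ≈[ N ] Hs.𝟙 → Hs.inv₁ f ≈[ N ] Hs.𝟙
    inv₁-trunc N f p k k≤N = Q.trans (Q.sym (H.*-identityˡ (Hs.inv₁ f) k))
      (Q.trans (⊗-trunc N {Hs.𝟙} {f} {Hs.inv₁ f} {Hs.inv₁ f} (λ i i≤N → Q.sym (p i i≤N)) (λ i _ → Q.refl {Hs.inv₁ f i}) k k≤N)
               (PH.inv₁-inverseʳ f (p 0 z≤n) k))

    mono-low : ∀ a r k → k ℕ.≤ r → Hs.mono a (suc r) k ≡ Q.0#
    mono-low a r zero k≤r = ≡.refl
    mono-low a (suc r) (suc k) (s≤s k≤r) = mono-low a r k k≤r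

    cycFactor-low : ∀ r cs → length cs ≡ suc r → cycFactor cs ≈[ r ] Hs.𝟙
    cycFactor-low r cs eq k k≤r rewrite eq = Q.trans (Q.+-congˡ {Hs.𝟙 k} (Q.trans (Q.-‿cong (Q.reflexive (mono-low (wP cs) r k k≤r))) QP.-0#≈0#)) (Q.+-identityʳ (Hs.𝟙 k))

    qstar-cong : ∀ {x y} → x Q.≈ y → qstar x Q.≈ qstar y
    qstar-cong (p , q , r , s) = p , R′.-‿cong q , R′.-‿cong r , R′.-‿cong s
      where
      module R′ = CommutativeRing R

    star-low : ∀ r f → f ≈[ r ] Hs.𝟙 → star f ≈[ r ] Hs.𝟙
    star-low r f p k k≤r = Q.trans (qstar-cong (p k k≤r)) (star-𝟙 k)
      where
      module R′ = CommutativeRing R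
      neg0 = AGP.ε⁻¹≈ε R′.+-abelianGroup
      star-𝟙 : ∀ k → qstar (Hs.𝟙 k) Q.≈ Hs.𝟙 k
      star-𝟙 zero = R′.refl , neg0 , neg0 , neg0
      star-𝟙 (suc k) = R′.refl , neg0 , neg0 , neg0

    normFactor : List Arc → Hs.Series
    normFactor cs = cycFactor cs Hs.⊗ star (cycFactor cs)

    normFactor-low : ∀ r cs → length cs ≡ suc r → normFactor cs ≈[ r ] Hs.𝟙
    normFactor-low r cs eq = ⊗-one r (cycFactor cs) (star (cycFactor cs)) (cycFactor-low r cs eq) (star-low r (cycFactor cs) (cycFactor-low r cs eq))

    zFactors : List (List Arc) → List Hs.Series
    zFactors = List.map (λ cs → Hs.inv₁ (cycFactor cs Hs.⊗ star (cycFactor cs)))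

    -- Cycles of length r + 1 contribute 1 up to t^r, so they leave the coefficients already fixed
    -- unchanged.
    zFactors-low : ∀ r css → All (λ cs → length cs ≡ suc r) css → Hs.prodList (zFactors css) ≈[ r ] Hs.𝟙
    zFactors-low r [] [] k k≤r = Q.refl {Hs.𝟙 k}
    zFactors-low r (cs ∷ css) (p ∷ ps) = ⊗-one r (Hs.inv₁ (normFactor cs)) (Hs.prodList (zFactors css))
      (inv₁-trunc r (normFactor cs) (normFactor-low r cs p)) (zFactors-low r css ps)

    lyndonCycles-length : ∀ r → All (λ cs → length cs ≡ r) (lyndonCycles r)
    lyndonCycles-length r = Allₚ.filter⁺ (λ fs → T? (isLyndonCycle fs)) (Allₚ.map⁺ (All.universal Vecₚ.length-toList (allWords (m ℕ.+ m) r)))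

    prodList-++ : ∀ fs gs → Hs.prodList (fs ++ gs) H.≈ (Hs.prodList fs H.* Hs.prodList gs)
    prodList-++ [] gs = H.sym (H.*-identityˡ (Hs.prodList gs))
    prodList-++ (f ∷ fs) gs = H.trans (H.*-congˡ {f} (prodList-++ fs gs)) (H.sym (H.*-assoc f (Hs.prodList fs) (Hs.prodList gs)))

    Zfactors-step : ∀ r → Hs.prodList (Zfactors (suc r)) ≈[ r ] Hs.prodList (Zfactors r)
    Zfactors-step r k k≤r = Q.trans (prodList-++ (Zfactors r) (zFactors (lyndonCycles (suc r))) k)
      (Q.trans (⊗-trunc r {Hs.prodList (Zfactors r)} {Hs.prodList (Zfactors r)} {Hs.prodList (zFactors (lyndonCycles (suc r)))} {Hs.𝟙}
                 (λ i _ → Q.refl {Hs.prodList (Zfactors r) i}) (zFactors-low r (lyndonCycles (suc r)) (lyndonCycles-length (suc r))) k k≤r)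
               (H.*-identityʳ (Hs.prodList (Zfactors r)) k))

    -- Coefficient k of Z is read at stage k of the product, and no later stage changes it. So one
    -- stage N serves all coefficients up to N.
    Z-trunc : ∀ {k N} → k ℕ.≤′ N → Z k Q.≈ Hs.prodList (Zfactors N) k
    Z-trunc {k} (ℕ.≤′-reflexive ≡.refl) = Q.refl {Z k}
    Z-trunc {k} {suc N} (ℕ.≤′-step p) = Q.trans (Z-trunc p) (Q.sym (Zfactors-step N k (ℕₚ.≤′⇒≤ p)))

    cycleNorm⁻¹ : List Arc → Cs.Series
    cycleNorm⁻¹ cs = Cs.inv₁ (cycleNorm cs)

    cycleNorm-0 : ∀ r cs → length cs ≡ suc r → cycleNorm cs 0 ℂ′.≈ ℂ′.1#
    cycleNorm-0 r cs eq = ℂ′.trans (ℂ′.sym (partS-cong {normFactor cs 0} {ofℂ (cycleNorm cs 0)} (norm (cycFactor cs) 0)))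
      (partS-cong {normFactor cs 0} {Q.1#} (normFactor-low r cs eq 0 z≤n))

    -- Both sides invert the norm factor, one from the left and one from the right. This moves each
    -- inverse into the commutative ring.
    inv₁-ι : ∀ r cs → length cs ≡ suc r → Hs.inv₁ (normFactor cs) H.≈ ι (cycleNorm⁻¹ cs)
    inv₁-ι r cs eq = RingIdentities.inverse-unique Hser {normFactor cs} {Hs.inv₁ (normFactor cs)} {ι (cycleNorm⁻¹ cs)}
      (PH.inv₁-inverseˡ (normFactor cs) (normFactor-low r cs eq 0 z≤n))
      (H.trans (H.*-congʳ {ι (cycleNorm⁻¹ cs)} {normFactor cs} {ι (cycleNorm cs)} (norm (cycFactor cs)))
        (H.trans (H.sym (ι-⊗ (cycleNorm cs) (cycleNorm⁻¹ cs))) (H.trans (ι-cong (PC.inv₁-inverseʳ (cycleNorm cs) (cycleNorm-0 r cs eq))) ι-1)))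

    zFactors-ι : ∀ r css → All (λ cs → length cs ≡ suc r) css → Hs.prodList (zFactors css) H.≈ ι (∏ css cycleNorm⁻¹)
    zFactors-ι r [] [] = H.sym ι-1
    zFactors-ι r (cs ∷ css) (p ∷ ps) = H.trans
      (H.*-cong {Hs.inv₁ (normFactor cs)} {ι (cycleNorm⁻¹ cs)} {Hs.prodList (zFactors css)} {ι (∏ css cycleNorm⁻¹)} (inv₁-ι r cs p) (zFactors-ι r css ps))
      (H.sym (ι-⊗ (cycleNorm⁻¹ cs) (∏ css cycleNorm⁻¹)))

    zetaProduct : ℕ → Cs.Series
    zetaProduct N = ∏≤ N (λ r → ∏ (lyndonCycles r) cycleNorm⁻¹)

    Zfactors-ι : ∀ N → Hs.prodList (Zfactors N) H.≈ ι (zetaProduct N)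
    Zfactors-ι zero = H.sym ι-1
    Zfactors-ι (suc N) = H.trans (prodList-++ (Zfactors N) (zFactors (lyndonCycles (suc N))))
      (H.trans (H.*-cong {Hs.prodList (Zfactors N)} {ι (zetaProduct N)} {Hs.prodList (zFactors (lyndonCycles (suc N)))} {ι (∏ (lyndonCycles (suc N)) cycleNorm⁻¹)}
                  (Zfactors-ι N) (zFactors-ι N (lyndonCycles (suc N)) (lyndonCycles-length (suc N))))
               (H.sym (ι-⊗ (zetaProduct N) (∏ (lyndonCycles (suc N)) cycleNorm⁻¹))))

    ∏-inverse : ∀ r css → All (λ cs → length cs ≡ suc r) css → (∏ css cycleNorm⁻¹ C.* ∏ css cycleNorm) C.≈ C.1#
    ∏-inverse r [] [] = C.*-identityˡ C.1#
    ∏-inverse r (cs ∷ css) (p ∷ ps) = *-inverse Cser {cycleNorm⁻¹ cs} {∏ css cycleNorm⁻¹} {cycleNorm cs} {∏ css cycleNorm}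
      (C.trans (C.*-comm (cycleNorm⁻¹ cs) (cycleNorm cs)) (PC.inv₁-inverseʳ (cycleNorm cs) (cycleNorm-0 r cs p))) (∏-inverse r css ps)

    zetaProduct-inverse : ∀ N → (zetaProduct N C.* cycleProduct N) C.≈ C.1#
    zetaProduct-inverse zero = C.*-identityˡ C.1#
    zetaProduct-inverse (suc N) = *-inverse Cser {zetaProduct N} {∏ (lyndonCycles (suc N)) cycleNorm⁻¹} {cycleProduct N} {∏ (lyndonCycles (suc N)) cycleNorm}
      (zetaProduct-inverse N) (∏-inverse N (lyndonCycles (suc N)) (lyndonCycles-length (suc N)))

  -- For coefficient N both factors matter only up to t^N. There they are the embedded products over
  -- the cycles of length at most N, which are inverse to each other exactly.
  Z⊗rhs : (Z H.* rhs) H.≈ H.1#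
  Z⊗rhs N = Q.trans
    (⊗-trunc N {Z} {ι (zetaProduct N)} {rhs} {ι (cycleProduct N)}
      (λ k k≤N → Q.trans (Z-trunc (ℕₚ.≤⇒≤′ k≤N)) (Zfactors-ι N k))
      (λ k k≤N → Q.trans (rhs≈ι-edgeProduct k) (ofℂ-cong {edgeProduct k} {cycleProduct N k} (edgeProduct≃cycleProduct N k k≤N))) N ℕₚ.≤-refl)
    (H.trans (H.sym (ι-⊗ (zetaProduct N) (cycleProduct N))) (H.trans (ι-cong (zetaProduct-inverse N)) ι-1) N)

  lhs≈rhs : lhs Hs.≈ₛ rhs
  -- The constant term of Z is `1#` by computation, because `Zfactors zero` is empty; so `inv₁ Z` is
  -- a genuine left inverse.
  lhs≈rhs = RingIdentities.inverse-unique Hser {Z} {lhs} {rhs} (PH.inv₁-inverseˡ Z (Q.refl {Q.1#})) Z⊗rhs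

theorem7p2 : {c ℓ : Level} (R : CommutativeRing c ℓ) → IsRealNumbers R →
    (G : Graph) → Connected G →
    (w : Fin' G → Fin' G → Over.ℍ R) → Over.IsWeight R G w →
    Over.Hs._≈ₛ_ R (Over.Weighted.lhs R G w) (Over.Weighted.rhs R G w)
theorem7p2 R _ G _ w _ = lhs≈rhs R G w
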